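{- $\mathrm{Fin}(10)=\mathrm{Adm}(10)\setminus\{(1,8),(3,1),(3,5),(4,1),(4,3),(5,1),(5,2)\}$.
   Context: $K_4-e$ is the graph on four vertices $a,b,c,d$ with edges $ab,ac,ad,bc,bd$; it is denoted $[a,b,c-d]$. A $(K_4-e)$-design of order $v$ is a pair $(X,\mathcal B)$ where $X$ is a set of $v$ vertices and $\mathcal B$ is a collection of copies of $K_4-e$ (blocks) with vertices in $X$ whose edge sets partition the edges of $K_v$ on $X$; it has $b_v=v(v-1)/10$ blocks. For a graph $B$, $T(B)$ is the set of its triangles (3-vertex subsets inducing a triangle); e.g. $T([a,b,c-d])=\{\{a,b,c\},\{a,b,d\}\}$, and $T(\mathcal B)=\bigcup_{B\in\mathcal B}T(B)$. Two designs $(X,\mathcal B_1),(X,\mathcal B_2)$ on the same vertex set intersect in $s$ blocks if $|\mathcal B_1\cap\mathcal B_2|=s$, and in $t$ triangles if $|T(\mathcal B_1)\cap T(\mathcal B_2)|=t$. Define $\mathrm{Fin}(v)=\{(s,t):$ there exists a pair of $(K_4-e)$-designs of order $v$ on the same vertex set intersecting in $s$ blocks and $t+2s$ triangles$\}$; $J(v)=\{s:$ there is a pair of $(K_4-e)$-designs of order $v$ intersecting in $s$ blocks$\}$; $J_T(v)=\{t:$ there is a pair of $(K_4-e)$-designs of order $v$ intersecting in $t$ triangles$\}$; and $\mathrm{Adm}(v)=\{(s,t): s,t\ge 0,\ s+t\le b_v,\ s\in J(v),\ t+2s\in J_T(v)\}$. (Known from the literature: $J(10)=\{0,1,\dots,6,9\}$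 and $J_T(10)=\{0,1,\dots,12,14,15,18\}$.) -}

module Defs where

open import Data.Fin.Base using (Fin)
open import Data.Fin.Subset using (Subset; ∣_∣) renaming (_∈_ to _∈ₛ_)
open import Data.List.Base using (List; []; _∷_; length; lookup)
open import Data.List.Membership.Propositional using (_∈_)
import Data.List.Membership.Setoid as SetoidMembership
open import Data.List.Relation.Unary.Any using (Any)
open import Data.List.Relation.Unary.Unique.Propositional using (Unique)
import Data.List.Relation.Unary.Unique.Setoid as SetoidUnique
open import Data.Nat.Base using (ℕ; _+_; _*_; _∸_; _/_; _≤_)
open import Data.Product.Base using (_×_; _,_; ∃; ∃₂)
open import Data.Product using (∃!)
open import Data.Sum.Base using (_⊎_)
open import Function.Bundles using (_⇔_)
open import Function.Properties.Equivalence using (⇔-isEquivalence)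
open import Level using (0ℓ; _⊔_)
open import Relation.Binary.Bundles using (Setoid)
open import Relation.Binary.PropositionalEquality.Core using (_≡_; _≢_)
open import Relation.Binary.PropositionalEquality.Properties using (setoid)
open import Relation.Binary.Structures using (IsEquivalence)
open import Relation.Unary using (Pred)

-- The elements satisfying P, taken up to the equality of S, number exactly n.
HasCardinality : ∀ {c ℓ p} (S : Setoid c ℓ) → Pred (Setoid.Carrier S) p → ℕ →
                 Set (c ⊔ ℓ ⊔ p)
HasCardinality S P n =
  ∃ λ xs → SetoidUnique.Unique S xs
         × (∀ x → P x ⇔ SetoidMembership._∈_ S x xs)
         × length xs ≡ n

-- A copy [a,b,c-d] of K₄ - e with vertices in Fin v; the missing edge is cd.
record Block (v : ℕ) : Set where
  constructor block
  field
    a b c d  : Fin v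
    distinct : Unique (a ∷ b ∷ c ∷ d ∷ [])

edges : ∀ {v} → Block v → List (Fin v × Fin v)
edges (block a b c d _) = (a , b) ∷ (a , c) ∷ (a , d) ∷ (b , c) ∷ (b , d) ∷ []

Adjacent : ∀ {v} → Block v → Fin v → Fin v → Set
Adjacent B x y = (x , y) ∈ edges B ⊎ (y , x) ∈ edges B

-- Equality of blocks as graphs: [a,b,c-d], [b,a,c-d], [a,b,d-c] and [b,a,d-c]
-- are the same block.  Vertex sets need not be compared, since no vertex of
-- K₄ - e is isolated.
infix 4 _≈_
_≈_ : ∀ {v} → Block v → Block v → Set
B ≈ B′ = ∀ x y → Adjacent B x y ⇔ Adjacent B′ x y

blockSetoid : ℕ → Setoid 0ℓ 0ℓ
blockSetoid v = record
  { Carrier       = Block v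
  ; _≈_           = _≈_
  ; isEquivalence = record
    { refl  = λ _ _ → IsEquivalence.refl ⇔-isEquivalence
    ; sym   = λ e x y → IsEquivalence.sym ⇔-isEquivalence (e x y)
    ; trans = λ e f x y → IsEquivalence.trans ⇔-isEquivalence (e x y) (f x y)
    }
  }

-- The vertex set is Fin v.  Uniqueness of the index i, rather than of the
-- block, rules out repeated blocks, so the list represents a set of blocks.
record Design (v : ℕ) : Set where
  field
    blocks    : List (Block v)
    partition : ∀ x y → x ≢ y →
                ∃! _≡_ λ (i : Fin (length blocks)) → Adjacent (lookup blocks i) x y

open Design public

-- The number of blocks of a (K₄ - e)-design of order v.
b[_] : ℕ → ℕ
b[ v ] = (v * (v ∸ 1)) / 10

-- S ∈ T(B)
IsTriangleOf : ∀ {v} → Block v → Pred (Subset v) 0ℓ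
IsTriangleOf B S =
  ∣ S ∣ ≡ 3 × (∀ x y → x ∈ₛ S → y ∈ₛ S → x ≢ y → Adjacent B x y)

-- T(𝓑), the union of T(B) over the blocks B of the design
T : ∀ {v} → Design v → Pred (Subset v) 0ℓ
T D S = Any (λ B → IsTriangleOf B S) (blocks D)

IntersectInBlocks : ∀ {v} → Design v → Design v → ℕ → Set
IntersectInBlocks {v} D₁ D₂ s =
  HasCardinality (blockSetoid v) (λ B → B ∈ᵇ blocks D₁ × B ∈ᵇ blocks D₂) s
  where open SetoidMembership (blockSetoid v) renaming (_∈_ to _∈ᵇ_)

IntersectInTriangles : ∀ {v} → Design v → Design v → ℕ → Set
IntersectInTriangles {v} D₁ D₂ t =
  HasCardinality (setoid (Subset v)) (λ S → T D₁ S × T D₂ S) t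

J : ℕ → Pred ℕ 0ℓ
J v s = ∃₂ λ (D₁ D₂ : Design v) → IntersectInBlocks D₁ D₂ s

J-T : ℕ → Pred ℕ 0ℓ
J-T v t = ∃₂ λ (D₁ D₂ : Design v) → IntersectInTriangles D₁ D₂ t

-- The set Fin(v) of fine intersection pairs (Fin is the type of finite ordinals).
Fine : ℕ → Pred (ℕ × ℕ) 0ℓ
Fine v (s , t) =
  ∃₂ λ (D₁ D₂ : Design v) →
    IntersectInBlocks D₁ D₂ s × IntersectInTriangles D₁ D₂ (t + 2 * s)

Adm : ℕ → Pred (ℕ × ℕ) 0ℓ
Adm v (s , t) = s + t ≤ b[ v ] × J v s × J-T v (t + 2 * s)

{-# OPTIONS --safe #-}
module Submission where

-- In a design of order 10 a vertex lies in x blocks as an end of the edge ab and in y blocks as c or d,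
-- and 3x + 2y = 9 forces (x, y) = (3, 0) or (1, 3).  Double counting gives 9 blocks and four vertices of
-- the first kind (the β's) and six of the second (the α's).  Every edge between β's is then the edge ab
-- of a block whose c and d are α's; each α sees the β's through a perfect matching of them, so these six
-- blocks amount to a map g from the α's to the three perfect matchings, with fibres of size 2.  The other
-- three blocks form a design on the α's, which is a cyclic ordering of three disjoint pairs: each block
-- is [pair, next pair].  So a design is a 4-subset together with two balanced maps g, m : Fin 6 → Fin 3.
-- Up to isomorphism there are three of them, and fixing the first design to be one of these leaves
-- 210 · 90 · 90 labelled second designs.  The blocks around the β's and those among the α's contribute
-- to s and t separately, so that 210 · (90 + 90) evaluations for each of the three are enough.
--
-- Since a design covers the edge ab once, a block of the second design lies in the first iff both of its
-- triangles do; hence s counts the blocks with two, and t those with exactly one, common triangle.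

open import Defs
open import Data.Bool.Base using (Bool; true; false; _∧_; _∨_; not; if_then_else_; _xor_)
open import Data.Bool.Properties using (¬-not; ∨-comm) renaming (_≟_ to _≟ᴮ_)
open import Data.Empty using (⊥; ⊥-elim)
open import Data.Fin.Base using (Fin; zero; suc; _↑ʳ_; join; punchIn; punchOut; splitAt)
open import Data.Fin.Patterns
import Data.Fin.Properties as Fin
open import Data.Fin.Properties using (_≟_; 0≢1+n; all?; any?; injective⇒≤; punchInᵢ≢i; punchIn-injective; punchOut-injective)
open import Data.Fin.Permutation using (Permutation′; permutation)
open import Data.Fin.Subset using (Subset; inside; outside; ⁅_⁆; _∪_; ∣_∣; _⊆_) renaming (_∈_ to _∈ₛ_)
open import Data.Fin.Subset.Properties using (x∈⁅x⁆; x∈⁅y⁆⇒x≡y; x∈p∪q⁺; x∈p∪q⁻; p⊆q⇒∣p∣≤∣q∣; drop-∷-⊆; ∣⁅x⁆∣≡1) renaming (_∈?_ to _∈ₛ?_)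
open import Data.List.Base as List using (List; []; _∷_; _++_; length; filter; allFin; cartesianProduct; cartesianProductWith; deduplicate)
import Data.List.Membership.DecPropositional as DecMembership
open import Data.List.Membership.Propositional using (_∈_; find; lose)
open import Data.List.Membership.Propositional.Properties using (∈-++⁺ˡ; ∈-++⁺ʳ; ∈-allFin; ∈-cartesianProduct⁺; ∈-deduplicate⁺; ∈-filter⁺; ∈-filter⁻; ∈-lookup; ∈-map⁺; ∈-tabulate⁻)
import Data.List.Membership.Setoid as SetoidMembership
import Data.List.Membership.Setoid.Properties as SetoidMembershipₚ
open import Data.List.Properties using (length-map)
open import Data.List.Relation.Unary.All as All using (All; []; _∷_)
import Data.List.Relation.Unary.All.Properties as Allₚ
open import Data.List.Relation.Unary.AllPairs using ([]; _∷_)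
open import Data.List.Relation.Unary.Any as Any using (Any; here; there)
import Data.List.Relation.Unary.Any.Properties as Anyₚ
open import Data.List.Relation.Unary.Unique.DecPropositional using (unique?)
open import Data.List.Relation.Unary.Unique.Propositional using (Unique)
import Data.List.Relation.Unary.Unique.Propositional.Properties as Uniqueₚ
import Data.List.Relation.Unary.Unique.Setoid as SetoidUnique
import Data.List.Relation.Unary.Unique.Setoid.Properties as SetoidUniqueₚ
open import Data.Nat.Base using (ℕ; zero; suc; _+_; _*_; _≤_; _<_; z≤n; s≤s; _≡ᵇ_)
import Data.Nat.Properties as ℕ
open import Data.Nat.Properties using (+-*-semiring; +-identityʳ; +-assoc; +-comm; +-suc; +-cancelˡ-≡; +-mono-≤; *-cancelˡ-≡; *-cancelʳ-≡; *-identityˡ; *-monoʳ-≤; ≤-antisym; ≤-refl; ≤-reflexive; ≤-trans; <⇒≱; m≤m+n; m≤n+m; m≤n⇒m≤1+n; n<1+n; 1+n≰n)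
open import Data.Nat.Solver using (module +-*-Solver)
open import Data.Product.Base using (_×_; _,_; ∃; ∃₂; proj₁; proj₂)
open import Data.Product.Properties using (≡-dec)
open import Data.Sum.Base as Sum using (_⊎_; inj₁; inj₂; [_,_]′)
open import Data.Sum.Properties using (inj₁-injective; inj₂-injective)
open import Data.Vec.Base as Vec using (Vec; []; _∷_; lookup; tabulate) renaming (here to vhere)
open import Data.Vec.Properties using (lookup∘tabulate)
open import Function.Base using (_∘_; id)
open import Function.Bundles using (_⇔_; mk⇔; Equivalence)
open import Function.Definitions using (Injective)
open import Relation.Binary.Bundles using (Setoid)
open import Relation.Binary.PropositionalEquality hiding (J)
open import Relation.Nullary using (Dec; yes; no; does; ¬_; ¬?; contradiction; _→-dec_; _×-dec_; _⊎-dec_)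
open import Relation.Nullary.Decidable using (True; dec-true; dec-false; toWitness)
open import Relation.Unary using (Pred; _≐_; _∖_)
open import Algebra.Properties.Semiring.Sum +-*-semiring using (sum; sum-cong-≗; sum-replicate-zero; sum-remove; sum-permute; ∑-distrib-+; ∑-comm; *-distribˡ-sum; *-distribʳ-sum)
open DecMembership ℕ._≟_ using () renaming (_∈?_ to _∈ℕ?_)
open DecMembership (≡-dec ℕ._≟_ ℕ._≟_) using () renaming (_∈?_ to _∈ᵖ?_)

-- The type checker itself has to carry out the search, and 210 · 90 · 90 is already 1 701 000
-- second designs for each first one. To keep the search small, s and t are packed into the single
-- number 16 s + t, which is a sum of weights over the blocks of the second design. Fixing the first
-- design is legitimate because this number does not change when both designs are relabelled at
-- once. To make relabelling mere composition, a design is reduced to the ternary relation "z is a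
-- tip of the block with spine x, y", which also forgets the order of its blocks. The seven
-- exceptional pairs have no individual argument: they are the admissible pairs that the enumeration
-- never meets. The same enumeration bounds J(10) and J_T(10), since any two designs that witness
-- membership in one of these sets have some s and t; `Adm` is thereby reduced to a finite check.

infix 4 _==_
_==_ : ∀ {n} → Fin n → Fin n → Bool
x == y = does (x ≟ y)

==⇒≡ : ∀ {n} {x y : Fin n} → (x == y) ≡ true → x ≡ y
==⇒≡ {x = x} {y} e with x ≟ y
... | yes p = p
==⇒≡ () | no _

==-refl : ∀ {n} (x : Fin n) → (x == x) ≡ true
==-refl x = dec-true (x ≟ x) refl

≢⇒== : ∀ {n} {x y : Fin n} → x ≢ y → (x == y) ≡ false
≢⇒== {x = x} {y} = dec-false (x ≟ y)

≡true-ext : ∀ {a b} → (a ≡ true → b ≡ true) → (b ≡ true → a ≡ true) → a ≡ b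
≡true-ext {true}  {b}     f g = sym (f refl)
≡true-ext {false} {false} f g = refl
≡true-ext {false} {true}  f g = g refl

true≢false : ∀ {a} → a ≡ true → a ≡ false → ⊥
true≢false refl ()

∧-true : ∀ {a b} → a ∧ b ≡ true → a ≡ true × b ≡ true
∧-true {true} {true} _ = refl , refl

∨-true : ∀ {a b} → a ∨ b ≡ true → a ≡ true ⊎ b ≡ true
∨-true {true}  _ = inj₁ refl
∨-true {false} e = inj₂ e

∨-trueʳ : ∀ a {b} → b ≡ true → a ∨ b ≡ true
∨-trueʳ true  _ = refl
∨-trueʳ false e = e

-- Counting the elements of a finite set

[_]ᵇ : Bool → ℕ
[ false ]ᵇ = 0
[ true  ]ᵇ = 1

-- Counts are sums of indicators, so that double counting is an exchange of sums (`∑-comm`) and a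
-- bijective change of variables is `sum-permute`.
# : ∀ {n} → (Fin n → Bool) → ℕ
# P = sum (λ i → [ P i ]ᵇ)

#-cong : ∀ {n} {P Q : Fin n → Bool} → (∀ i → P i ≡ Q i) → # P ≡ # Q
#-cong e = sum-cong-≗ (cong [_]ᵇ ∘ e)

#-remove : ∀ {n} (P : Fin (suc n) → Bool) i → # P ≡ [ P i ]ᵇ + # (P ∘ punchIn i)
#-remove P i = sum-remove {i = i} (λ j → [ P j ]ᵇ)

sum-≗0 : ∀ {n} {f : Fin n → ℕ} → (∀ i → f i ≡ 0) → sum f ≡ 0
sum-≗0 {n} e = trans (sum-cong-≗ e) (sum-replicate-zero n)

sum-point : ∀ {n} (i : Fin n) (f : Fin n → ℕ) → (∀ j → j ≢ i → f j ≡ 0) → sum f ≡ f i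
sum-point {suc _} i f e = trans (sum-remove {i = i} f)
  (trans (cong (f i +_) (sum-≗0 (λ j → e (punchIn i j) (punchInᵢ≢i i j)))) (+-identityʳ _))

#-== : ∀ {n} (i : Fin n) → # (_== i) ≡ 1
#-== i = trans (sum-point i _ (λ j j≢i → cong [_]ᵇ (≢⇒== j≢i))) (cong [_]ᵇ (==-refl i))

opaque
  #⇒∃ : ∀ {n k} (P : Fin n → Bool) → # P ≡ suc k → ∃ λ i → P i ≡ true
  #⇒∃ {zero} P ()
  #⇒∃ {suc n} P e with P zero in eq
  ... | true  = zero , eq
  ... | false with i , p ← #⇒∃ (P ∘ suc) e = suc i , p

#≡0⇒false : ∀ {n} (P : Fin n → Bool) → # P ≡ 0 → ∀ i → P i ≡ false
#≡0⇒false {suc n} P e i with P i in eq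
... | false = refl
... | true  with () ← trans (sym e) (trans (#-remove P i) (cong (λ b → [ b ]ᵇ + # (P ∘ punchIn i)) eq))

-- Induction on `xs`: removing its head from `P` lowers the count by one and, by uniqueness, keeps
-- the tail inside `P`.
length≤# : ∀ {n} (P : Fin n → Bool) (xs : List (Fin n)) →
           Unique xs → All (λ x → P x ≡ true) xs → length xs ≤ # P
length≤# P [] _ _ = z≤n
length≤# {suc n} P (x ∷ xs) (x∉xs ∷ u) (px ∷ pxs) =
  ≤-trans (s≤s (length≤# Q xs u (All.zipWith Q-true (x∉xs , pxs)))) (≤-reflexive (sym #P))
  where
  Q : Fin (suc n) → Bool
  Q i = not (i == x) ∧ P i
  Q-true : ∀ {y} → x ≢ y × P y ≡ true → Q y ≡ true
  Q-true (x≢y , py) rewrite ≢⇒== (x≢y ∘ sym) = py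
  #P : # P ≡ suc (# Q)
  #P = trans (#-remove P x) (cong₂ _+_ (cong [_]ᵇ px)
    (sym (trans (#-remove Q x) (cong₂ _+_ (cong (λ b → [ not b ∧ P x ]ᵇ) (==-refl x))
      (#-cong (λ j → cong (λ b → not b ∧ P (punchIn x j)) (≢⇒== (punchInᵢ≢i x j))))))))

#-exhausted : ∀ {n} (P : Fin n → Bool) (xs : List (Fin n)) → Unique xs →
              All (λ x → P x ≡ true) xs → # P ≡ length xs → ∀ {y} → P y ≡ true → y ∈ xs
#-exhausted P xs u all e {y} py with DecMembership._∈?_ _≟_ y xs
... | yes y∈xs = y∈xs
-- `y ∷ xs` would be too long a list without repetitions inside `P`.
... | no  y∉xs = contradiction
  (≤-trans (length≤# P (y ∷ xs) (Allₚ.¬Any⇒All¬ xs y∉xs ∷ u) (py ∷ all)) (≤-reflexive e)) 1+n≰n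

opaque
  #≡1-unique : ∀ {n} (P : Fin n → Bool) → # P ≡ 1 → ∀ {x y} → P x ≡ true → P y ≡ true → x ≡ y
  #≡1-unique P e {x} {y} px py with x ≟ y
  ... | yes x≡y = x≡y
  ... | no  x≢y = contradiction
    (≤-trans (length≤# P (x ∷ y ∷ []) ((x≢y ∷ []) ∷ [] ∷ []) (px ∷ py ∷ [])) (≤-reflexive e)) λ { (s≤s ()) }

  #≡2⇒other : ∀ {n} (P : Fin n → Bool) → # P ≡ 2 → ∀ {x} → P x ≡ true → ∃ λ y → y ≢ x × P y ≡ true
  #≡2⇒other {suc n} P e {x} px
    with j , pj ← #⇒∃ {k = 0} (P ∘ punchIn x)
           (+-cancelˡ-≡ 1 _ _ (trans (cong (λ b → [ b ]ᵇ + # (P ∘ punchIn x)) (sym px))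
             (trans (sym (#-remove P x)) e)))
    = punchIn x j , punchInᵢ≢i x j , pj

  #≡2⇒∈ : ∀ {n} (P : Fin n → Bool) → # P ≡ 2 → ∀ {x y} → x ≢ y → P x ≡ true → P y ≡ true →
          ∀ {z} → P z ≡ true → z ≡ x ⊎ z ≡ y
  #≡2⇒∈ P e x≢y px py pz with #-exhausted P _ ((x≢y ∷ []) ∷ [] ∷ []) (px ∷ py ∷ []) e pz
  ... | here p = inj₁ p
  ... | there (here p) = inj₂ p

#-⊆-≡ : ∀ {n} (P Q : Fin n → Bool) → (∀ i → P i ≡ true → Q i ≡ true) → # P ≡ # Q → ∀ i → P i ≡ Q i
#-⊆-≡ {suc n} P Q P⊆Q e i with P i in p | Q i in q
... | true  | true  = refl
... | false | false = refl
... | true  | false = sym (trans (sym q) (P⊆Q i p))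
-- Away from `i` the smaller predicate would hold at one more point than the larger one.
... | false | true  = contradiction (≤-trans (≤-reflexive e′)
  (#-mono (P ∘ punchIn i) (Q ∘ punchIn i) (P⊆Q ∘ punchIn i))) 1+n≰n
  where
  #-mono : ∀ {m} (P Q : Fin m → Bool) → (∀ i → P i ≡ true → Q i ≡ true) → # P ≤ # Q
  #-mono {zero}  P Q h = z≤n
  #-mono {suc m} P Q h with P zero in p | Q zero in q
  ... | true  | true  = s≤s (#-mono (P ∘ suc) (Q ∘ suc) (h ∘ suc))
  ... | false | false = #-mono (P ∘ suc) (Q ∘ suc) (h ∘ suc)
  ... | false | true  = m≤n⇒m≤1+n (#-mono (P ∘ suc) (Q ∘ suc) (h ∘ suc))
  ... | true  | false = ⊥-elim (true≢false (h zero p) q)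
  e′ : suc (# (Q ∘ punchIn i)) ≡ # (P ∘ punchIn i)
  e′ = trans (cong (λ b → [ b ]ᵇ + # (Q ∘ punchIn i)) (sym q)) (trans (sym (#-remove Q i))
         (trans (sym e) (trans (#-remove P i) (cong (λ b → [ b ]ᵇ + # (P ∘ punchIn i)) p))))

-- If `f` missed a value `j`, punching `j` out of the codomain would embed `Fin (suc n)` into
-- `Fin n`.
injective⇒permutation : ∀ {n} (f : Fin n → Fin n) → Injective _≡_ _≡_ f → Permutation′ n
injective⇒permutation {n} f inj = permutation f f⁻¹ f∘f⁻¹ (λ i → inj (f∘f⁻¹ (f i)))
  where
  surjective : ∀ {n} (f : Fin n → Fin n) → Injective _≡_ _≡_ f → ∀ j → ∃ λ i → f i ≡ j
  surjective {suc n} f inj j with any? (λ i → f i ≟ j)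
  ... | yes p = p
  ... | no ¬p = contradiction (injective⇒≤ {f = λ i → punchOut (j≢f i)}
    (λ {x} {y} → inj ∘ punchOut-injective (j≢f x) (j≢f y))) 1+n≰n
    where
    j≢f : ∀ i → j ≢ f i
    j≢f i e = ¬p (i , sym e)
  f⁻¹ : Fin n → Fin n
  f⁻¹ j = proj₁ (surjective f inj j)
  f∘f⁻¹ : ∀ j → f (f⁻¹ j) ≡ j
  f∘f⁻¹ j = proj₂ (surjective f inj j)

sum-reindex : ∀ {n} (f : Fin n → Fin n) → Injective _≡_ _≡_ f → (g : Fin n → ℕ) → sum (g ∘ f) ≡ sum g
sum-reindex f inj g = sym (sum-permute g (injective⇒permutation f inj))

#-==-∧ : ∀ {n} (c : Fin n) (P : Fin n → Bool) → # (λ z → (z == c) ∧ P z) ≡ [ P c ]ᵇ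
#-==-∧ c P = trans (sum-point c (λ z → [ (z == c) ∧ P z ]ᵇ) (λ z z≢c → cong (λ b → [ b ∧ P z ]ᵇ) (≢⇒== z≢c)))
                   (cong (λ b → [ b ∧ P c ]ᵇ) (==-refl c))

#-pair-∧ : ∀ {n} {c d : Fin n} → c ≢ d → (P : Fin n → Bool) →
           # (λ z → ((z == c) ∨ (z == d)) ∧ P z) ≡ [ P c ]ᵇ + [ P d ]ᵇ
#-pair-∧ {c = c} {d} c≢d P = trans (sum-cong-≗ split)
  (trans (∑-distrib-+ (λ z → [ (z == c) ∧ P z ]ᵇ) (λ z → [ (z == d) ∧ P z ]ᵇ)) (cong₂ _+_ (#-==-∧ c P) (#-==-∧ d P)))
  where
  split : ∀ z → [ ((z == c) ∨ (z == d)) ∧ P z ]ᵇ ≡ [ (z == c) ∧ P z ]ᵇ + [ (z == d) ∧ P z ]ᵇ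
  split z with z ≟ c | z ≟ d
  ... | yes refl | yes refl = contradiction refl c≢d
  ... | yes _    | no _     = sym (+-identityʳ _)
  ... | no _     | _        = refl

#-others : ∀ {n} (P : Fin n → Bool) → # P ≡ 2 → ∀ x → # (λ y → P x ∧ (not (x == y) ∧ P y)) ≡ [ P x ]ᵇ
#-others {n} P two x with P x in px
... | false = sum-≗0 {n} {f = λ _ → 0} (λ _ → refl)
... | true with y , y≢x , py ← #≡2⇒other P two {x} px = trans (#-cong (λ z → ≡true-ext (to z) (from z))) (#-== y)
  where
  to : ∀ z → not (x == z) ∧ P z ≡ true → (z == y) ≡ true
  to z e with #≡2⇒∈ P two (y≢x ∘ sym) px py (proj₂ (∧-true {not (x == z)} e))
  ... | inj₁ refl = ⊥-elim (true≢false (proj₁ (∧-true {not (x == z)} e)) (cong not (==-refl z)))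
  ... | inj₂ refl = ==-refl z
  from : ∀ z → (z == y) ≡ true → not (x == z) ∧ P z ≡ true
  from z e with refl ← ==⇒≡ {x = z} e = cong₂ _∧_ (cong not (≢⇒== (y≢x ∘ sym))) py

#-pair : ∀ {n} {c d : Fin n} → c ≢ d → # (λ z → (z == c) ∨ (z == d)) ≡ 2
#-pair {c = c} {d} c≢d = trans (#-cong (λ z → sym (∧-true′ ((z == c) ∨ (z == d))))) (#-pair-∧ c≢d (λ _ → true))
  where
  ∧-true′ : ∀ b → b ∧ true ≡ b
  ∧-true′ true  = refl
  ∧-true′ false = refl

-- Splitting a finite set in two

-- A word in `left` and `right`, that is a p-subset and its complement, each listed in increasing
-- order. Unlike a Boolean predicate it carries both sizes, so an enumeration meets only subsets of
-- the right size.
data Split : ℕ → ℕ → ℕ → Set where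
  done  : Split 0 0 0
  left  : ∀ {n p q} → Split n p q → Split (suc n) (suc p) q
  right : ∀ {n p q} → Split n p q → Split (suc n) p (suc q)

place : ∀ {n p q} → Split n p q → Fin p ⊎ Fin q → Fin n
place (left s)  (inj₁ zero)    = zero
place (left s)  (inj₁ (suc i)) = suc (place s (inj₁ i))
place (left s)  (inj₂ j)       = suc (place s (inj₂ j))
place (right s) (inj₁ i)       = suc (place s (inj₁ i))
place (right s) (inj₂ zero)    = zero
place (right s) (inj₂ (suc j)) = suc (place s (inj₂ j))

place-injective : ∀ {n p q} (s : Split n p q) → Injective _≡_ _≡_ (place s)
place-injective (left s)  {inj₁ zero}    {inj₁ zero}    e = refl
place-injective (left s)  {inj₁ (suc i)} {inj₁ (suc j)} e with refl ← place-injective s (Fin.suc-injective e) = refl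
place-injective (left s)  {inj₁ (suc i)} {inj₂ j}       e with () ← place-injective s (Fin.suc-injective e)
place-injective (left s)  {inj₂ i}       {inj₁ (suc j)} e with () ← place-injective s (Fin.suc-injective e)
place-injective (left s)  {inj₂ i}       {inj₂ j}       e with refl ← place-injective s (Fin.suc-injective e) = refl
place-injective (right s) {inj₂ zero}    {inj₂ zero}    e = refl
place-injective (right s) {inj₂ (suc i)} {inj₂ (suc j)} e with refl ← place-injective s (Fin.suc-injective e) = refl
place-injective (right s) {inj₂ (suc i)} {inj₁ j}       e with () ← place-injective s (Fin.suc-injective e)
place-injective (right s) {inj₁ i}       {inj₂ (suc j)} e with () ← place-injective s (Fin.suc-injective e)
place-injective (right s) {inj₁ i}       {inj₁ j}       e with refl ← place-injective s (Fin.suc-injective e) = refl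

place-surjective : ∀ {n p q} (s : Split n p q) x → ∃ λ v → place s v ≡ x
place-surjective (left s)  zero = inj₁ zero , refl
place-surjective (left s)  (suc x) with place-surjective s x
... | inj₁ i , refl = inj₁ (suc i) , refl
... | inj₂ j , refl = inj₂ j , refl
place-surjective (right s) zero = inj₂ zero , refl
place-surjective (right s) (suc x) with place-surjective s x
... | inj₁ i , refl = inj₁ i , refl
... | inj₂ j , refl = inj₂ (suc j) , refl

sum-place : ∀ {n p q} (s : Split n p q) (f : Fin n → ℕ) →
            sum f ≡ sum (λ i → f (place s (inj₁ i))) + sum (λ j → f (place s (inj₂ j)))
sum-place done      f = refl
sum-place (left s)  f = trans (cong (f zero +_) (sum-place s (f ∘ suc))) (sym (+-assoc (f zero) _ _))
sum-place (right s) f = trans (cong (f zero +_) (sum-place s (f ∘ suc)))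
  (x+[y+z]≡y+[x+z] (f zero) (sum (λ i → f (suc (place s (inj₁ i))))) _)
  where
  x+[y+z]≡y+[x+z] : ∀ x y z → x + (y + z) ≡ y + (x + z)
  x+[y+z]≡y+[x+z] x y z = trans (sym (+-assoc x y z)) (trans (cong (_+ z) (+-comm x y)) (+-assoc y x z))

splits : ∀ n p q → List (Split n p q)
splits zero    zero    zero    = done ∷ []
splits zero    zero    (suc q) = []
splits zero    (suc p) q       = []
splits (suc n) zero    zero    = []
splits (suc n) zero    (suc q) = List.map right (splits n zero q)
splits (suc n) (suc p) zero    = List.map left (splits n p zero)
splits (suc n) (suc p) (suc q) = List.map left (splits n p (suc q)) ++ List.map right (splits n (suc p) q)

splits-complete : ∀ {n p q} (s : Split n p q) → s ∈ splits n p q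
splits-complete done = here refl
splits-complete {p = suc p} {zero}  (left s)  = ∈-map⁺ left (splits-complete s)
splits-complete {p = suc p} {suc q} (left s)  = ∈-++⁺ˡ (∈-map⁺ left (splits-complete s))
splits-complete {p = zero}  {suc q} (right s) = ∈-map⁺ right (splits-complete s)
splits-complete {suc n} {suc p} {suc q} (right s) =
  ∈-++⁺ʳ (List.map left (splits n p (suc q))) (∈-map⁺ right (splits-complete s))

split-by : ∀ {n p q} (P : Fin n → Bool) → # P ≡ p → # (not ∘ P) ≡ q →
           ∃ λ (s : Split n p q) → (∀ i → P (place s (inj₁ i)) ≡ true) × (∀ j → P (place s (inj₂ j)) ≡ false)
split-by {zero}  P refl refl = done , (λ ()) , λ ()
split-by {suc n} P refl refl with P zero in eq
... | true  with s , t , f ← split-by (P ∘ suc) refl refl = left s , (λ { zero → eq ; (suc i) → t i }) , f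
... | false with s , t , f ← split-by (P ∘ suc) refl refl = right s , t , λ { zero → eq ; (suc j) → f j }

#-not : ∀ {n} (P : Fin n → Bool) → # P + # (not ∘ P) ≡ n
#-not {zero}  P = refl
#-not {suc n} P with P zero
... | true  = cong suc (#-not (P ∘ suc))
... | false = trans (+-suc _ _) (cong suc (#-not (P ∘ suc)))

-- Designs as matrices of roles

data Role : Set where
  spine tip none : Role

isSpine isTip : Role → Bool
isSpine spine = true
isSpine _     = false
isTip tip = true
isTip _   = false

adj : Role → Role → Bool
adj spine spine = true
adj spine tip   = true
adj tip   spine = true
adj _     _     = false

adj-comm : ∀ a b → adj a b ≡ adj b a
adj-comm spine spine = refl
adj-comm spine tip   = refl
adj-comm spine none  = refl
adj-comm tip   spine = refl
adj-comm tip   tip   = refl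
adj-comm tip   none  = refl
adj-comm none  spine = refl
adj-comm none  tip   = refl
adj-comm none  none  = refl

adj-ss : ∀ {r r′} → isSpine r ≡ true → isSpine r′ ≡ true → adj r r′ ≡ true
adj-ss {spine} {spine} _ _ = refl

adj-st : ∀ {r r′} → isSpine r ≡ true → isTip r′ ≡ true → adj r r′ ≡ true
adj-st {spine} {tip} _ _ = refl

adj⇒ : ∀ r r′ → adj r r′ ≡ true → (isSpine r ≡ true × isSpine r′ ≡ true) ⊎ (isSpine r ≡ true × isTip r′ ≡ true)
  ⊎ (isTip r ≡ true × isSpine r′ ≡ true)
adj⇒ spine spine e = inj₁ (refl , refl)
adj⇒ spine tip   e = inj₂ (inj₁ (refl , refl))
adj⇒ tip   spine e = inj₂ (inj₂ (refl , refl))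

-- The blocks are indexed by Fin n, and block i is given by the role r i x of each vertex x:
-- in [a,b,c-d], a and b are spine vertices and c and d are tips.
record IsSystem {n} (r : Fin n → Fin 10 → Role) : Set where
  field
    two-spines : ∀ i → # (isSpine ∘ r i) ≡ 2
    two-tips   : ∀ i → # (isTip ∘ r i) ≡ 2
    cover      : ∀ {x y} → x ≢ y → # (λ i → adj (r i x) (r i y)) ≡ 1

relabel : ∀ {n} {r : Fin n → Fin 10 → Role} (f : Fin 10 → Fin 10) → Injective _≡_ _≡_ f →
          IsSystem r → IsSystem (λ i → r i ∘ f)
relabel {r = r} f inj sys = record
  { two-spines = λ i → trans (sum-reindex f inj (λ x → [ isSpine (r i x) ]ᵇ)) (two-spines i)
  ; two-tips   = λ i → trans (sum-reindex f inj (λ x → [ isTip (r i x) ]ᵇ)) (two-tips i)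
  ; cover      = λ x≢y → cover (x≢y ∘ inj)
  } where open IsSystem sys

module Degrees {n} {r : Fin n → Fin 10 → Role} (sys : IsSystem r) where
  open IsSystem sys

  spines-at tips-at : Fin 10 → ℕ
  spines-at x = # (λ i → isSpine (r i x))
  tips-at   x = # (λ i → isTip (r i x))

  -- The coefficient of a spine is 4 rather than 3 because `adj` relates a spine to itself; the
  -- surplus is removed in `degree`.
  block-degree : ∀ x i → # (λ y → adj (r i x) (r i y)) ≡ 4 * [ isSpine (r i x) ]ᵇ + 2 * [ isTip (r i x) ]ᵇ
  block-degree x i with r i x
  ... | spine = trans (sum-cong-≗ (λ y → spine-row (r i y)))
                  (trans (∑-distrib-+ (λ y → [ isSpine (r i y) ]ᵇ) (λ y → [ isTip (r i y) ]ᵇ))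
                    (cong₂ _+_ (two-spines i) (two-tips i)))
    where
    spine-row : ∀ a → [ adj spine a ]ᵇ ≡ [ isSpine a ]ᵇ + [ isTip a ]ᵇ
    spine-row spine = refl
    spine-row tip   = refl
    spine-row none  = refl
  ... | tip   = trans (#-cong (λ y → tip-row (r i y))) (two-spines i)
    where
    tip-row : ∀ a → adj tip a ≡ isSpine a
    tip-row spine = refl
    tip-row tip   = refl
    tip-row none  = refl
  ... | none  = sum-≗0 {f = λ y → [ adj none (r i y) ]ᵇ} (λ y → refl)

  -- Count the pairs of a block and a vertex y adjacent to x in it. The nine y other than x are
  -- covered once each, and the diagonal y = x contributes `spines-at x`, which cancels the surplus
  -- of `block-degree`.
  degree : ∀ x → 3 * spines-at x + 2 * tips-at x ≡ 9
  degree x = +-cancelˡ-≡ A _ _ (begin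
    A + (3 * A + 2 * U)                                           ≡⟨ +-assoc A (3 * A) (2 * U) ⟨
    4 * A + 2 * U                                                 ≡⟨ cong₂ _+_
      (*-distribˡ-sum 4 (λ i → [ isSpine (r i x) ]ᵇ)) (*-distribˡ-sum 2 (λ i → [ isTip (r i x) ]ᵇ)) ⟩
    sum (λ i → 4 * [ isSpine (r i x) ]ᵇ) + sum (λ i → 2 * [ isTip (r i x) ]ᵇ)
                                                                  ≡⟨ ∑-distrib-+ (λ i → 4 * [ isSpine
                                                                    (r i x) ]ᵇ) (λ i → 2 * [ isTip (r i x) ]ᵇ) ⟨
    sum (λ i → 4 * [ isSpine (r i x) ]ᵇ + 2 * [ isTip (r i x) ]ᵇ) ≡⟨ sum-cong-≗ (block-degree x) ⟨
    sum (λ i → sum (λ y → [ adj (r i x) (r i y) ]ᵇ))              ≡⟨ ∑-comm (λ i y → [ adj (r i x) (r i y) ]ᵇ) ⟩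
    sum (λ y → # (λ i → adj (r i x) (r i y)))                     ≡⟨ sum-remove {i = x}
      (λ y → # (λ i → adj (r i x) (r i y))) ⟩
    # (λ i → adj (r i x) (r i x)) + sum (λ y → # (λ i → adj (r i x) (r i (punchIn x y))))
                                                                  ≡⟨ cong₂ _+_ (#-cong (λ i → adj-self (r i x)))
                                                                    (sum-cong-≗ {9} (λ y → cover
                                                                    (λ e → punchInᵢ≢i x y (sym e)))) ⟩
    A + 9                                                         ∎)
    where
    open ≡-Reasoning
    A = spines-at x
    U = tips-at x
    adj-self : ∀ a → adj a a ≡ isSpine a
    adj-self spine = refl
    adj-self tip   = refl
    adj-self none  = refl

  3a+2t≡9 : ∀ a t → 3 * a + 2 * t ≡ 9 → a ≡ 3 × t ≡ 0 ⊎ a ≡ 1 × t ≡ 3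
  3a+2t≡9 0 0 ()
  3a+2t≡9 0 1 ()
  3a+2t≡9 0 2 ()
  3a+2t≡9 0 3 ()
  3a+2t≡9 0 4 ()
  3a+2t≡9 1 0 ()
  3a+2t≡9 1 1 ()
  3a+2t≡9 1 2 ()
  3a+2t≡9 1 3 e = inj₂ (refl , refl)
  3a+2t≡9 1 4 ()
  3a+2t≡9 2 0 ()
  3a+2t≡9 2 1 ()
  3a+2t≡9 2 2 ()
  3a+2t≡9 2 3 ()
  3a+2t≡9 2 4 ()
  3a+2t≡9 3 0 e = inj₁ (refl , refl)
  3a+2t≡9 3 1 ()
  3a+2t≡9 3 2 ()
  3a+2t≡9 3 3 ()
  3a+2t≡9 3 4 ()
  -- From t = 5 or a = 4 on, one summand alone exceeds 9.
  3a+2t≡9 a (suc (suc (suc (suc (suc t))))) e = contradiction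
    (≤-trans (*-monoʳ-≤ 2 (m≤m+n 5 t)) (≤-trans (m≤n+m _ (3 * a)) (≤-reflexive e))) (<⇒≱ (n<1+n 9))
  3a+2t≡9 (suc (suc (suc (suc a)))) t e = contradiction
    (≤-trans (*-monoʳ-≤ 3 (m≤m+n 4 a)) (≤-trans (m≤m+n _ (2 * t)) (≤-reflexive e))) (<⇒≱ (m≤m+n 10 2))

  spine-or-mixed : ∀ x → spines-at x ≡ 3 × tips-at x ≡ 0 ⊎ spines-at x ≡ 1 × tips-at x ≡ 3
  spine-or-mixed x = 3a+2t≡9 _ _ (degree x)

  neverTip : Fin 10 → Bool
  neverTip x = tips-at x ≡ᵇ 0

  slots : (f : Role → Bool) → (∀ i → # (f ∘ r i) ≡ 2) → sum (λ x → # (λ i → f (r i x))) ≡ sum {n} (λ _ → 2)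
  slots f two = trans (∑-comm (λ x i → [ f (r i x) ]ᵇ)) (sum-cong-≗ two)

  spines : ∀ x → spines-at x ≡ 1 + 2 * [ neverTip x ]ᵇ
  spines x with spine-or-mixed x
  ... | inj₁ (a , t) rewrite t = a
  ... | inj₂ (a , t) rewrite t = a

  ∑spines : sum spines-at ≡ 10 + 2 * # neverTip
  ∑spines = trans (sum-cong-≗ spines) (trans (∑-distrib-+ (λ _ → 1) (λ x → 2 * [ neverTip x ]ᵇ))
              (cong (10 +_) (sym (*-distribˡ-sum 2 (λ x → [ neverTip x ]ᵇ)))))

  -- If p vertices are never tips, the spine positions number 10 + 2p and the tip positions 30 - 3p.
  -- Both equal twice the number of blocks, so p = 4.
  #neverTip : # neverTip ≡ 4
  #neverTip = *-cancelˡ-≡ _ 4 5 (+-cancelˡ-≡ 10 _ _ (begin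
    10 + 5 * # neverTip                                ≡⟨ solve 1
      (λ p → con 10 :+ con 5 :* p := con 10 :+ con 2 :* p :+ con 3 :* p) refl (# neverTip) ⟩
    10 + 2 * # neverTip + 3 * # neverTip               ≡⟨ cong (_+ 3 * # neverTip) ∑spines ⟨
    sum spines-at + 3 * # neverTip                     ≡⟨ cong (_+ 3 * # neverTip)
      (trans (slots isSpine two-spines) (sym (slots isTip two-tips))) ⟩
    sum tips-at + 3 * # neverTip                       ≡⟨ cong (sum tips-at +_)
      (*-distribˡ-sum 3 (λ x → [ neverTip x ]ᵇ)) ⟩
    sum tips-at + sum (λ x → 3 * [ neverTip x ]ᵇ)      ≡⟨ ∑-distrib-+ tips-at (λ x → 3 * [ neverTip x ]ᵇ) ⟨
    sum (λ x → tips-at x + 3 * [ neverTip x ]ᵇ)        ≡⟨ sum-cong-≗ tips ⟩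
    sum {10} (λ x → 3)                                 ≡⟨⟩
    30                                                 ∎))
    where
    open ≡-Reasoning
    open +-*-Solver
    tips : ∀ x → tips-at x + 3 * [ neverTip x ]ᵇ ≡ 3
    tips x with spine-or-mixed x
    ... | inj₁ (a , t) rewrite t = refl
    ... | inj₂ (a , t) rewrite t = refl

  block-count : n ≡ 9
  block-count = *-cancelʳ-≡ n 9 2 (begin
    n * 2               ≡⟨ const-sum n ⟨
    sum {n} (λ _ → 2)   ≡⟨ slots isSpine two-spines ⟨
    sum spines-at       ≡⟨ ∑spines ⟩
    10 + 2 * # neverTip ≡⟨ cong (λ k → 10 + 2 * k) #neverTip ⟩
    18                  ∎)
    where
    open ≡-Reasoning
    const-sum : ∀ k → sum {k} (λ _ → 2) ≡ k * 2
    const-sum zero    = refl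
    const-sum (suc k) = cong (2 +_) (const-sum k)

-- The structure of a design of order 10

-- Addition in (ℤ/2)²: the three perfect matchings of K₄ on Fin 4 are the fibres of xor₄ on its edges.
xor₄ : Fin 4 → Fin 4 → Fin 4
xor₄ 0F y  = y
xor₄ x  0F = x
xor₄ 1F 1F = 0F
xor₄ 1F 2F = 3F
xor₄ 1F 3F = 2F
xor₄ 2F 1F = 3F
xor₄ 2F 2F = 0F
xor₄ 2F 3F = 1F
xor₄ 3F 1F = 2F
xor₄ 3F 2F = 1F
xor₄ 3F 3F = 0F

opaque
  xor₄-comm : ∀ j k → xor₄ j k ≡ xor₄ k j
  xor₄-comm = toWitness {a? = all? λ j → all? λ k → xor₄ j k ≟ xor₄ k j} _

-- A fixed-point-free involution of four points is one of the three perfect matchings, hence the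
-- translation by `p 0F`. The check runs over the four values of `p` because functions cannot be
-- enumerated directly.
involution-xor₄ : (p : Fin 4 → Fin 4) → (∀ j → p j ≢ j) → (∀ j → p (p j) ≡ j) →
                 ∀ j k → (p j == k) ≡ (xor₄ j k == p 0F)
involution-xor₄ p p≢ pp j k = trans (cong (_== k) (sym (≗p j)))
  (check (p 0F) (p 1F) (p 2F) (p 3F) (λ i e → p≢ i (trans (sym (≗p i)) e))
    (λ i → trans (≗p _) (trans (cong p (≗p i)) (pp i))) j k)
  where
  ≗p : ∀ j → lookup (p 0F ∷ p 1F ∷ p 2F ∷ p 3F ∷ []) j ≡ p j
  ≗p 0F = refl
  ≗p 1F = refl
  ≗p 2F = refl
  ≗p 3F = refl
  check : ∀ a b c d → let q = lookup (a ∷ b ∷ c ∷ d ∷ []) in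
          (∀ j → q j ≢ j) → (∀ j → q (q j) ≡ j) → ∀ j k → (q j == k) ≡ (xor₄ j k == q 0F)
  check = toWitness {a? = all? λ a → all? λ b → all? λ c → all? λ d →
    let q = lookup (a ∷ b ∷ c ∷ d ∷ []) in
    all? (λ j → ¬? (q j ≟ j)) →-dec (all? (λ j → q (q j) ≟ j) →-dec
    (all? λ j → all? λ k → (q j == k) ≟ᴮ (xor₄ j k == q 0F)))} _

next : Fin 3 → Fin 3
next 0F = 1F
next 1F = 2F
next 2F = 0F

Balanced : (Fin 6 → Fin 3) → Set
Balanced f = ∀ k → # (λ z → f z == k) ≡ 2

-- Blocks of a design of order 6: the spines are the pairs z, μ z, and E z w says that w is a tip
-- of the block with spine z, μ z.
module Order6
  (μ : Fin 6 → Fin 6) (E : Fin 6 → Fin 6 → Bool)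
  (μ≢ : ∀ z → μ z ≢ z) (μμ : ∀ z → μ (μ z) ≡ z)
  (Eμ : ∀ z w → E (μ z) w ≡ E z w)
  (Ez : ∀ z → E z z ≡ false) (Ezμ : ∀ z → E z (μ z) ≡ false)
  (E-asym : ∀ {z w} → w ≢ z → w ≢ μ z → E w z ≡ not (E z w))
  (E# : ∀ z → # (E z) ≡ 2)
  where

  μ-injective : ∀ {z w} → μ z ≡ μ w → z ≡ w
  μ-injective {z} {w} e = trans (sym (μμ z)) (trans (cong μ e) (μμ w))

  -- Tips come in pairs: using `E-asym` twice exchanges the roles of spine and tip, so that the
  -- invariance `Eμ` of the spine carries over to the tip.
  E-μ : ∀ z w → E z (μ w) ≡ E z w
  E-μ z w with w ≟ z | w ≟ μ z
  ... | yes refl | _        = trans (Ezμ w) (sym (Ez w))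
  ... | no _     | yes refl = trans (cong (E z) (μμ z)) (trans (Ez z) (sym (Ezμ z)))
  ... | no w≢z   | no w≢μz  = begin
    E z (μ w)    ≡⟨ E-asym {μ w} {z} (λ e → w≢μz (trans (sym (μμ w)) (cong μ (sym e))))
      (λ e → w≢z (sym (trans e (μμ w)))) ⟩
    not (E (μ w) z) ≡⟨ cong not (Eμ w z) ⟩
    not (E w z)  ≡⟨ E-asym {w} {z} (w≢z ∘ sym) (λ e → w≢μz (sym (trans (cong μ e) (μμ w)))) ⟨
    E z w        ∎
    where open ≡-Reasoning

  opaque
    label : Bool → Bool → Fin 3
    label true  _     = 0F
    label false true  = 1F
    label false false = 2F

    root : Fin 6 → Bool
    root w = (w == 0F) ∨ (w == μ 0F)

    -- The pairs are numbered along the cycle, starting with that of 0F: the tips of its block get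
    -- 1F, the remaining pair 2F.
    m : Fin 6 → Fin 3
    m w = label (root w) (E 0F w)

    root⇒ : ∀ {w} → root w ≡ true → w ≡ 0F ⊎ w ≡ μ 0F
    root⇒ {w} e with w ≟ 0F | w ≟ μ 0F
    ... | yes p | _     = inj₁ p
    ... | no _  | yes p = inj₂ p
    root⇒ () | no _ | no _

    root-E : ∀ {w} → root w ≡ true → E 0F w ≡ false
    root-E {w} e with root⇒ {w} e
    ... | inj₁ refl = Ez 0F
    ... | inj₂ refl = Ezμ 0F

    root-row : ∀ {z} w → root z ≡ true → E z w ≡ E 0F w
    root-row {z} w e with root⇒ {z} e
    ... | inj₁ refl = refl
    ... | inj₂ refl = Eμ 0F w

    root-μ : ∀ w → root (μ w) ≡ root w
    root-μ w = ≡true-ext (to w) (λ e → to (μ w) (trans (cong root (μμ w)) e))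
      where
      root0 : root 0F ≡ true
      root0 = refl
      rootμ0 : root (μ 0F) ≡ true
      rootμ0 with μ 0F ≟ 0F
      ... | yes _ = refl
      ... | no  _ = ==-refl (μ 0F)
      to : ∀ w → root (μ w) ≡ true → root w ≡ true
      to w e with root⇒ {μ w} e
      ... | inj₁ p rewrite trans (sym (μμ w)) (cong μ p) = rootμ0
      ... | inj₂ p rewrite μ-injective p = root0

    m-μ : ∀ w → m (μ w) ≡ m w
    m-μ w = cong₂ label (root-μ w) (E-μ 0F w)

    m==1 : ∀ w → (m w == 1F) ≡ E 0F w
    m==1 w with root w in e | E 0F w in f
    ... | true  | true  = ⊥-elim (true≢false f (root-E {w} e))
    ... | true  | false = refl
    ... | false | true  = refl
    ... | false | false = refl

    m==0 : ∀ w → (m w == 0F) ≡ root w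
    m==0 w with root w | E 0F w
    ... | true  | _     = refl
    ... | false | true  = refl
    ... | false | false = refl

    balanced : Balanced m
    balanced 0F = trans (#-cong m==0) (#-pair (μ≢ 0F ∘ sym))
    balanced 1F = trans (#-cong m==1) (E# 0F)
    -- The third fibre is what the first two leave of the six points.
    balanced 2F = +-cancelˡ-≡ 4 _ _ (trans
      (cong₂ _+_ (cong₂ _+_ (sym (balanced 0F)) (sym (balanced 1F))) refl) total)
      where
      one : ∀ (k : Fin 3) → [ k == 0F ]ᵇ + [ k == 1F ]ᵇ + [ k == 2F ]ᵇ ≡ 1
      one 0F = refl
      one 1F = refl
      one 2F = refl
      total : # (λ z → m z == 0F) + # (λ z → m z == 1F) + # (λ z → m z == 2F) ≡ 6
      total = trans (cong (_+ # (λ z → m z == 2F)) (sym (∑-distrib-+ (λ z → [ m z == 0F ]ᵇ) (λ z → [ m z == 1F ]ᵇ))))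
        (trans (sym (∑-distrib-+ (λ z → [ m z == 0F ]ᵇ + [ m z == 1F ]ᵇ) (λ z → [ m z == 2F ]ᵇ)))
          (sum-cong-≗ (one ∘ m)))

    fibre : ∀ {z w} → m w ≡ m z → w ≡ z ⊎ w ≡ μ z
    fibre {z} {w} e = #≡2⇒∈ (λ y → m y == m z) (balanced (m z)) (μ≢ z ∘ sym)
      (==-refl (m z)) (trans (cong (_== m z) (m-μ z)) (==-refl (m z))) (trans (cong (_== m z) e) (==-refl (m z)))

    E-fibre : ∀ {z w} → m w ≡ m z → E z w ≡ false
    E-fibre e with fibre e
    ... | inj₁ refl = Ez _
    ... | inj₂ refl = Ezμ _

    from-root : ∀ {z w} → m z ≡ 0F → E z w ≡ (m w == 1F)
    from-root {z} {w} e = trans (root-row w (trans (sym (m==0 z)) (cong (_== 0F) e))) (sym (m==1 w))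

    flip : ∀ {z w} → m w ≢ m z → E w z ≡ not (E z w)
    flip {z} ne = E-asym (λ { refl → ne refl }) (λ { refl → ne (m-μ z) })

    -- Tips of the block of pair 1F cannot lie in pair 0F, whose own block already covers the edges
    -- between these two pairs. So they lie in pair 2F and, being two, fill it.
    from-one : ∀ {z w} → m z ≡ 1F → E z w ≡ (m w == 2F)
    from-one {z} {w} ez = #-⊆-≡ (E z) (λ y → m y == 2F) only2 (trans (E# z) (sym (balanced 2F))) w
      where
      only2 : ∀ y → E z y ≡ true → (m y == 2F) ≡ true
      only2 y t with m y in ey
      ... | 0F = ⊥-elim (true≢false t (trans (flip {y} {z} λ e → 0≢1+n (trans (sym ey) (trans (sym e) ez)))
                   (cong not (trans (from-root ey) (cong (_== 1F) ez)))))
      ... | 1F = ⊥-elim (true≢false t (E-fibre (trans ey (sym ez))))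
      ... | 2F = refl

    -- The row of pair 2F is read backwards from the other two rows through `flip`, which closes the
    -- cycle.
    E-next : ∀ z w → E z w ≡ (m w == next (m z))
    E-next z w with m z in ez
    ... | 0F = from-root ez
    ... | 1F = from-one ez
    ... | 2F with m w in ew
    ...   | 0F = trans (flip {w} {z} λ e → 0≢1+n (trans (sym ew) (trans (sym e) ez)))
                   (cong not (trans (from-root ew) (cong (_== 1F) ez)))
    ...   | 1F = trans (flip {w} {z} λ e → 0≢1+n (Fin.suc-injective (trans (sym ew) (trans (sym e) ez))))
                   (cong not (trans (from-one ew) (cong (_== 2F) ez)))
    ...   | 2F = E-fibre (trans ew (sym ez))

-- The tip relation and the normal form of a design

opaque
  -- Forgetting which block is the witness makes designs comparable without matching their indices.
  -- The test for `x` and `y` being distinct keeps a single spine vertex from counting as a spine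
  -- edge.
  tipOf : ∀ {n} → (Fin n → Fin 10 → Role) → (x y z : Fin 10) → Bool
  tipOf r x y z = not (x == y) ∧ does (any? λ i → (isSpine (r i x) ∧ isSpine (r i y) ∧ isTip (r i z)) ≟ᴮ true)

  tipOf⇒ : ∀ {n} {r : Fin n → Fin 10 → Role} {x y z} → tipOf r x y z ≡ true →
           x ≢ y × ∃ λ i → isSpine (r i x) ≡ true × isSpine (r i y) ≡ true × isTip (r i z) ≡ true
  tipOf⇒ {r = r} {x} {y} {z} e with x ≟ y | any? (λ i → (isSpine (r i x) ∧ isSpine (r i y) ∧ isTip (r i z)) ≟ᴮ true)
  ... | no x≢y | yes (i , t) with sx , t ← ∧-true {isSpine (r i x)} t = x≢y , i , sx , ∧-true t
  tipOf⇒ () | yes _ | _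
  tipOf⇒ () | no _  | no _

  tipOf⇐ : ∀ {n} {r : Fin n → Fin 10 → Role} {x y z} → x ≢ y → ∀ i →
           isSpine (r i x) ≡ true → isSpine (r i y) ≡ true → isTip (r i z) ≡ true → tipOf r x y z ≡ true
  tipOf⇐ {r = r} {x} {y} {z} x≢y i sx sy tz rewrite ≢⇒== x≢y = dec-true (any? _) (i , cong₂ _∧_ sx (cong₂ _∧_ sy tz))

-- inj₁ j and inj₂ z are the vertices on three spines and on one spine respectively; the block with
-- spine j, k has as tips the two z for which j, k is an edge of the matching suc (g z).
standard : (g m : Fin 6 → Fin 3) → (u v w : Fin 4 ⊎ Fin 6) → Bool
standard g m (inj₁ j) (inj₁ k) (inj₂ z) = xor₄ j k == suc (g z)
standard g m (inj₂ x) (inj₂ y) (inj₂ z) = not (x == y) ∧ (m x == m y) ∧ (m z == next (m x))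
standard g m _        _        _        = false

module NormalForm {n} {r : Fin n → Fin 10 → Role} (sys : IsSystem r) (s : Split 10 4 6)
  (β-tips   : ∀ j → Degrees.tips-at   sys (place s (inj₁ j)) ≡ 0)
  (β-spines : ∀ j → Degrees.spines-at sys (place s (inj₁ j)) ≡ 3)
  (α-spines : ∀ z → Degrees.spines-at sys (place s (inj₂ z)) ≡ 1)
  where
  open IsSystem sys

  R : Fin n → Fin 4 ⊎ Fin 6 → Role
  R i v = r i (place s v)

  third-spine : ∀ i {u v w} → u ≢ v → isSpine (R i u) ≡ true → isSpine (R i v) ≡ true →
                isSpine (R i w) ≡ true → w ≡ u ⊎ w ≡ v
  third-spine i u≢v su sv sw with #≡2⇒∈ (isSpine ∘ r i) (two-spines i) (u≢v ∘ place-injective s) su sv sw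
  ... | inj₁ e = inj₁ (place-injective s e)
  ... | inj₂ e = inj₂ (place-injective s e)

  edge : ∀ {u v} → u ≢ v → ∃ λ i → adj (R i u) (R i v) ≡ true
  edge {u} {v} u≢v = #⇒∃ (λ i → adj (R i u) (R i v)) (cover (u≢v ∘ place-injective s))

  edge-unique : ∀ {u v} → u ≢ v → ∀ {i j} → adj (R i u) (R i v) ≡ true → adj (R j u) (R j v) ≡ true → i ≡ j
  edge-unique {u} {v} u≢v = #≡1-unique (λ i → adj (R i u) (R i v)) (cover (u≢v ∘ place-injective s))

  β-noTip : ∀ i j → isTip (R i (inj₁ j)) ≡ false
  β-noTip i j = #≡0⇒false (λ i → isTip (R i (inj₁ j))) (β-tips j) i

  adj-noTipˡ : ∀ a b → isTip a ≡ false → adj a b ≡ true → isSpine a ≡ true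
  adj-noTipˡ spine b t e = refl
  adj-noTipˡ none  b t ()

  adj-noTipʳ : ∀ a b → isTip b ≡ false → adj a b ≡ true → isSpine b ≡ true
  adj-noTipʳ a b t e = adj-noTipˡ b a t (trans (adj-comm b a) e)

  spine-notTip : ∀ {a} → isSpine a ≡ true → isTip a ≡ false
  spine-notTip {spine} _ = refl

  β≢ : ∀ {j k : Fin 4} → j ≢ k → _≢_ {A = Fin 4 ⊎ Fin 6} (inj₁ j) (inj₁ k)
  β≢ j≢k = j≢k ∘ inj₁-injective

  α≢ : ∀ {x y : Fin 6} → x ≢ y → _≢_ {A = Fin 4 ⊎ Fin 6} (inj₂ x) (inj₂ y)
  α≢ x≢y = x≢y ∘ inj₂-injective

  β≢α : ∀ {j : Fin 4} {z : Fin 6} → inj₁ j ≢ inj₂ z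
  β≢α ()

  -- An end of the edge that is never a tip must be a spine of the covering block, and here this
  -- holds for both ends.
  βblock : ∀ {j k} → j ≢ k → ∃ λ i → isSpine (R i (inj₁ j)) ≡ true × isSpine (R i (inj₁ k)) ≡ true
  βblock {j} {k} j≢k with i , e ← edge (β≢ j≢k) =
    i , adj-noTipˡ _ _ (β-noTip i j) e , adj-noTipʳ (R i (inj₁ j)) _ (β-noTip i k) e

  -- The block with spine `j`, `punchIn j a`: for fixed `j` the index `a` runs over the other three
  -- β's.
  K : Fin 4 → Fin 3 → Fin n
  K j a = proj₁ (βblock (punchInᵢ≢i j a ∘ sym))

  K-spineˡ : ∀ j a → isSpine (R (K j a) (inj₁ j)) ≡ true
  K-spineˡ j a = proj₁ (proj₂ (βblock (punchInᵢ≢i j a ∘ sym)))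

  K-spineʳ : ∀ j a → isSpine (R (K j a) (inj₁ (punchIn j a))) ≡ true
  K-spineʳ j a = proj₂ (proj₂ (βblock (punchInᵢ≢i j a ∘ sym)))

  K-injective : ∀ j {a b} → K j a ≡ K j b → a ≡ b
  K-injective j {a} {b} e
    with third-spine (K j a) (β≢ (punchInᵢ≢i j a ∘ sym)) (K-spineˡ j a) (K-spineʳ j a)
           (trans (cong (λ i → isSpine (R i (inj₁ (punchIn j b)))) e) (K-spineʳ j b))
  ... | inj₁ p = contradiction (inj₁-injective p) (punchInᵢ≢i j b)
  ... | inj₂ p = sym (punchIn-injective j b a (inj₁-injective p))

  -- The three blocks `K j a` are distinct, and `j` lies on only three spines.
  βspine⇒K : ∀ i j → isSpine (R i (inj₁ j)) ≡ true → ∃ λ a → i ≡ K j a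
  βspine⇒K i j sj = ∈-tabulate⁻ (#-exhausted (λ i → isSpine (R i (inj₁ j))) (List.tabulate (K j))
    (Uniqueₚ.tabulate⁺ (K-injective j))
    (Allₚ.tabulate⁺ (K-spineˡ j)) (β-spines j) sj)

  no-βα-spine : ∀ i {j z} → isSpine (R i (inj₁ j)) ≡ true → isSpine (R i (inj₂ z)) ≡ true → ⊥
  no-βα-spine i {j} sj sz with a , refl ← βspine⇒K i j sj
    with third-spine (K j a) (β≢ (punchInᵢ≢i j a ∘ sym)) (K-spineˡ j a) (K-spineʳ j a) sz
  ... | inj₁ ()
  ... | inj₂ ()

  -- The block covering the edge has `j` on its spine, hence is some `K j a`; its spine consists of
  -- β's, so the α is left to be a tip.
  βα : ∀ z j → ∃ λ a → isTip (R (K j a) (inj₂ z)) ≡ true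
  βα z j with i , e ← edge (β≢α {j} {z}) with a , refl ← βspine⇒K i j (adj-noTipˡ _ _ (β-noTip i j) e) =
    a , lemma (R (K j a) (inj₁ j)) (R (K j a) (inj₂ z)) (K-spineˡ j a) (no-βα-spine (K j a) (K-spineˡ j a)) e
    where
    lemma : ∀ a b → isSpine a ≡ true → (isSpine b ≡ true → ⊥) → adj a b ≡ true → isTip b ≡ true
    lemma spine spine _ f _ = ⊥-elim (f refl)
    lemma spine tip   _ _ _ = refl

  partner : Fin 6 → Fin 4 → Fin 4
  partner z j = punchIn j (proj₁ (βα z j))

  -- The edge from `j` to `z` lies in one block only, so block `i` is the one that defines
  -- `partner z j`, and `k` is its other spine.
  partner-unique : ∀ {z i j k} → j ≢ k → isSpine (R i (inj₁ j)) ≡ true → isSpine (R i (inj₁ k)) ≡ true →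
                   isTip (R i (inj₂ z)) ≡ true → partner z j ≡ k
  partner-unique {z} {i} {j} {k} j≢k sj sk tz
    with a , ta ← βα z j
    with refl ← edge-unique (β≢α {j} {z}) {i} {K j a} (adj-st {R i (inj₁ j)} sj tz)
      (adj-st {R (K j a) (inj₁ j)} (K-spineˡ j a) ta)
    with third-spine (K j a) (β≢ (punchInᵢ≢i j a ∘ sym)) (K-spineˡ j a) (K-spineʳ j a) sk
  ... | inj₁ p = contradiction (sym (inj₁-injective p)) j≢k
  ... | inj₂ p = sym (inj₁-injective p)

  partner-involutive : ∀ z j → partner z (partner z j) ≡ j
  partner-involutive z j = let a , t = βα z j in
    partner-unique (punchInᵢ≢i j a) (K-spineʳ j a) (K-spineˡ j a) t

  -- `punchIn 0F` is `suc`, so `suc (g z)` is the partner of 0F, which determines the whole matching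
  -- by `involution-xor₄`.
  g : Fin 6 → Fin 3
  g z = proj₁ (βα z 0F)

  partner-g : ∀ z j k → (partner z j == k) ≡ (xor₄ j k == suc (g z))
  partner-g z = involution-xor₄ (partner z) (λ j → punchInᵢ≢i j _) (partner-involutive z)

  αtips : ∀ i → # (λ z → isTip (R i (inj₂ z))) ≡ 2
  αtips i = trans (cong (_+ # (λ z → isTip (R i (inj₂ z))))
    (sym (sum-≗0 {f = λ j → [ isTip (R i (inj₁ j)) ]ᵇ} (λ j → cong [_]ᵇ (β-noTip i j)))))
    (trans (sym (sum-place s (λ x → [ isTip (r i x) ]ᵇ))) (two-tips i))

  -- The fibre of `g` over `a` is the set of tips of the block with spine 0F, `suc a`.
  g-balanced : Balanced g
  g-balanced a = trans (#-cong λ z → ≡true-ext (to z) (from z)) (αtips (K 0F a))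
    where
    to : ∀ z → (g z == a) ≡ true → isTip (R (K 0F a) (inj₂ z)) ≡ true
    to z e with refl ← ==⇒≡ {x = g z} e = proj₂ (βα z 0F)
    from : ∀ z → isTip (R (K 0F a) (inj₂ z)) ≡ true → (g z == a) ≡ true
    from z t = trans (cong (_== a) (Fin.suc-injective {i = g z} {a}
      (partner-unique 0≢1+n (K-spineˡ 0F a) (K-spineʳ 0F a) t))) (==-refl a)

  κ : Fin 6 → Fin n
  κ z = proj₁ (#⇒∃ (λ i → isSpine (R i (inj₂ z))) (α-spines z))

  κ-spine : ∀ z → isSpine (R (κ z) (inj₂ z)) ≡ true
  κ-spine z = proj₂ (#⇒∃ (λ i → isSpine (R i (inj₂ z))) (α-spines z))

  κ-unique : ∀ {i z} → isSpine (R i (inj₂ z)) ≡ true → i ≡ κ z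
  κ-unique {i} {z} sz = #≡1-unique (λ i → isSpine (R i (inj₂ z))) (α-spines z) sz (κ-spine z)

  αpartner : ∀ z → ∃ λ y → y ≢ z × isSpine (R (κ z) (inj₂ y)) ≡ true
  αpartner z with x , x≢ , sx ← #≡2⇒other (isSpine ∘ r (κ z)) (two-spines (κ z)) (κ-spine z) with place-surjective s x
  ... | inj₁ j , refl = ⊥-elim (no-βα-spine (κ z) sx (κ-spine z))
  ... | inj₂ y , refl = y , (λ { refl → x≢ refl }) , sx

  μ : Fin 6 → Fin 6
  μ z = proj₁ (αpartner z)

  μ≢ : ∀ z → μ z ≢ z
  μ≢ z = proj₁ (proj₂ (αpartner z))

  κμ-spine : ∀ z → isSpine (R (κ z) (inj₂ (μ z))) ≡ true
  κμ-spine z = proj₂ (proj₂ (αpartner z))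

  κ-μ : ∀ z → κ (μ z) ≡ κ z
  κ-μ z = sym (κ-unique (κμ-spine z))

  κ-spines : ∀ {z w} → isSpine (R (κ z) (inj₂ w)) ≡ true → w ≡ z ⊎ w ≡ μ z
  κ-spines {z} sw with third-spine (κ z) (α≢ (μ≢ z ∘ sym)) (κ-spine z) (κμ-spine z) sw
  ... | inj₁ p = inj₁ (inj₂-injective p)
  ... | inj₂ p = inj₂ (inj₂-injective p)

  μμ : ∀ z → μ (μ z) ≡ z
  μμ z with κ-spines {z} (trans (cong (λ i → isSpine (R i (inj₂ (μ (μ z))))) (sym (κ-μ z))) (κμ-spine (μ z)))
  ... | inj₁ p = p
  ... | inj₂ p = contradiction p (μ≢ (μ z))

  E : Fin 6 → Fin 6 → Bool
  E z w = isTip (R (κ z) (inj₂ w))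

  -- The edge is covered exactly once, and not as a spine edge because `w` is not the partner of
  -- `z`. So exactly one end is a spine of the covering block, which is then the `κ` of that end,
  -- and the other end is a tip.
  E-asym : ∀ {z w} → w ≢ z → w ≢ μ z → E w z ≡ not (E z w)
  E-asym {z} {w} w≢z w≢μz with E z w in ezw | E w z in ewz
  ... | true  | false = refl
  ... | false | true  = refl
  ... | true  | true  = ⊥-elim (apart (trans (cong (λ i → isSpine (R i (inj₂ w))) κ≡) (κ-spine w)))
    where
    apart : isSpine (R (κ z) (inj₂ w)) ≡ true → ⊥
    apart sw with κ-spines {z} sw
    ... | inj₁ p = w≢z p
    ... | inj₂ p = w≢μz p
    κ≡ : κ z ≡ κ w
    κ≡ = edge-unique (α≢ w≢z) (trans (adj-comm (R (κ z) (inj₂ w)) _)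
      (adj-st {R (κ z) (inj₂ z)} (κ-spine z) ezw)) (adj-st {R (κ w) (inj₂ w)} (κ-spine w) ewz)
  ... | false | false with i , e ← edge (α≢ w≢z) = ⊥-elim (cases refl refl)
    where
    cases : ∀ {a b} → R i (inj₂ w) ≡ a → R i (inj₂ z) ≡ b → ⊥
    cases {spine} {spine} p q
      with refl ← κ-unique {i} {z} (cong isSpine q)
      with κ-spines {z} {w} (cong isSpine p)
    ... | inj₁ p = w≢z p
    ... | inj₂ p = w≢μz p
    cases {spine} {tip} p q with refl ← κ-unique {i} {w} (cong isSpine p) = true≢false (cong isTip q) ewz
    cases {tip} {spine} p q with refl ← κ-unique {i} {z} (cong isSpine q) = true≢false (cong isTip p) ezw
    cases {tip}  {tip}  p q with () ← trans (sym e) (cong₂ adj p q)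
    cases {tip}  {none} p q with () ← trans (sym e) (cong₂ adj p q)
    cases {none} {_}    p q with () ← trans (sym e) (cong₂ adj p q)
    cases {spine} {none} p q with () ← trans (sym e) (cong₂ adj p q)

  open Order6 μ E μ≢ μμ (λ z w → cong (λ i → isTip (R i (inj₂ w))) (κ-μ z))
    (λ z → spine-notTip (κ-spine z)) (λ z → spine-notTip (κμ-spine z)) E-asym (αtips ∘ κ)
    public using (m; m-μ; fibre; E-next) renaming (balanced to m-balanced)

  Tip : (u v w : Fin 4 ⊎ Fin 6) → Set
  Tip u v w = u ≢ v × ∃ λ i → isSpine (R i u) ≡ true × isSpine (R i v) ≡ true × isTip (R i w) ≡ true

  β-Tip : ∀ {z j k} → partner z j ≡ k → Tip (inj₁ j) (inj₁ k) (inj₂ z)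
  β-Tip {z} {j} refl = punchInᵢ≢i j _ ∘ sym ∘ inj₁-injective , K j
    (proj₁ (βα z j)) , K-spineˡ j _ , K-spineʳ j _ , proj₂ (βα z j)

  α-Tip : ∀ {x y z} → y ≡ μ x → E x z ≡ true → Tip (inj₂ x) (inj₂ y) (inj₂ z)
  α-Tip {x} refl t = μ≢ x ∘ sym ∘ inj₂-injective , κ x , κ-spine x , κμ-spine x , t

  α-partner : ∀ {x y} → x ≢ y → m x ≡ m y → y ≡ μ x
  α-partner x≢y e with fibre (sym e)
  ... | inj₁ p = contradiction (sym p) x≢y
  ... | inj₂ p = p

  κ-partner : ∀ i {x y} → x ≢ y → isSpine (R i (inj₂ x)) ≡ true → isSpine (R i (inj₂ y)) ≡ true → y ≡ μ x
  κ-partner i {x} x≢y sx sy with κ-spines {x} (trans (cong (λ i → isSpine (R i (inj₂ _))) (sym (κ-unique sx))) sy)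
  ... | inj₁ p = contradiction (sym p) x≢y
  ... | inj₂ p = p

  Tip⇒standard : ∀ u v w → Tip u v w → standard g m u v w ≡ true
  Tip⇒standard u        v        (inj₁ l) (u≢v , i , su , sv , tw) = ⊥-elim (true≢false tw (β-noTip i l))
  Tip⇒standard (inj₁ j) (inj₂ y) (inj₂ z) (u≢v , i , su , sv , tw) = ⊥-elim (no-βα-spine i su sv)
  Tip⇒standard (inj₂ x) (inj₁ k) (inj₂ z) (u≢v , i , su , sv , tw) = ⊥-elim (no-βα-spine i sv su)
  Tip⇒standard (inj₁ j) (inj₁ k) (inj₂ z) (u≢v , i , su , sv , tw) = trans (sym (partner-g z j k))
    (trans (cong (_== k) (partner-unique (u≢v ∘ cong inj₁) su sv tw)) (==-refl k))
  Tip⇒standard (inj₂ x) (inj₂ y) (inj₂ z) (u≢v , i , su , sv , tw) =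
    cong₂ _∧_ (cong not (≢⇒== x≢y)) (cong₂ _∧_
      (trans (cong (m x ==_) (trans (cong m (κ-partner i x≢y su sv)) (m-μ x))) (==-refl (m x)))
      (trans (sym (E-next x z)) (trans (cong (λ i → isTip (R i (inj₂ z))) (sym (κ-unique su))) tw)))
    where
    x≢y : x ≢ y
    x≢y = u≢v ∘ cong inj₂

  standard⇒Tip : ∀ u v w → standard g m u v w ≡ true → Tip u v w
  standard⇒Tip (inj₁ j) (inj₁ k) (inj₂ z) e = β-Tip (==⇒≡ {x = partner z j} {k} (trans (partner-g z j k) e))
  standard⇒Tip (inj₂ x) (inj₂ y) (inj₂ z) e =
    α-Tip (α-partner (λ x≡y → true≢false (proj₁ e₁) (cong not (trans (cong (_== y) x≡y) (==-refl y))))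
      (==⇒≡ {x = m x} (proj₁ e₂)))
      (trans (E-next x z) (proj₂ e₂))
    where
    e₁ = ∧-true {not (x == y)} e
    e₂ = ∧-true {m x == m y} (proj₂ e₁)

  normal-form : ∀ u v w → tipOf r (place s u) (place s v) (place s w) ≡ standard g m u v w
  normal-form u v w = ≡true-ext to from
    where
    to : tipOf r (place s u) (place s v) (place s w) ≡ true → standard g m u v w ≡ true
    to e = let u≢v , t = tipOf⇒ {r = r} e in Tip⇒standard u v w (u≢v ∘ cong (place s) , t)
    from : standard g m u v w ≡ true → tipOf r (place s u) (place s v) (place s w) ≡ true
    from e = let u≢v , i , su , sv , tw = standard⇒Tip u v w e in
             tipOf⇐ {r = r} (u≢v ∘ place-injective s) i su sv tw

record Normalised {n} (r : Fin n → Fin 10 → Role) : Set where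
  field
    vertices   : Split 10 4 6
    g m        : Fin 6 → Fin 3
    g-balanced : Balanced g
    m-balanced : Balanced m
    tips       : ∀ u v w → tipOf r (place vertices u) (place vertices v) (place vertices w) ≡ standard g m u v w

opaque
  normalise : ∀ {n} {r : Fin n → Fin 10 → Role} → IsSystem r → Normalised r
  normalise sys = record
    { vertices = proj₁ splitting ; g = g ; m = m ; g-balanced = g-balanced ; m-balanced = m-balanced ; tips = normal-form }
    where
    open Degrees sys
    splitting : ∃ λ (s : Split 10 4 6) → (∀ j → neverTip (place s (inj₁ j)) ≡ true) ×
      (∀ z → neverTip (place s (inj₂ z)) ≡ false)
    splitting = split-by neverTip #neverTip
      (+-cancelˡ-≡ 4 _ _ (trans (cong (_+ # (not ∘ neverTip)) (sym #neverTip)) (#-not neverTip)))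
    β-degrees : ∀ x → neverTip x ≡ true → spines-at x ≡ 3 × tips-at x ≡ 0
    β-degrees x e with spine-or-mixed x
    ... | inj₁ p = p
    ... | inj₂ (_ , t) with () ← trans (sym e) (cong (_≡ᵇ 0) t)
    α-degrees : ∀ x → neverTip x ≡ false → spines-at x ≡ 1
    α-degrees x e with spine-or-mixed x
    ... | inj₁ (_ , t) with () ← trans (sym e) (cong (_≡ᵇ 0) t)
    ... | inj₂ (a , _) = a
    open NormalForm sys (proj₁ splitting) (λ j → proj₂ (β-degrees _ (proj₁ (proj₂ splitting) j)))
      (λ j → proj₁ (β-degrees _ (proj₁ (proj₂ splitting) j))) (λ z → α-degrees _ (proj₂ (proj₂ splitting) z))

-- Three designs up to isomorphism

halve : Fin 6 → Fin 3
halve 0F = 0F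
halve 1F = 0F
halve 2F = 1F
halve 3F = 1F
halve 4F = 2F
halve 5F = 2F

-- Chooses the fibre of a balanced map over 0F, then the one over 1F among the remaining four
-- points: 15 · 6 = 90 codes.
Arrangement : Set
Arrangement = Split 6 2 4 × Split 4 2 2

arrange : Arrangement → Fin 6 → Fin 6
arrange (s , s′) = place s ∘ Sum.map₂ (place s′ ∘ splitAt 2) ∘ splitAt 2

splitAt-injective : ∀ m {n} → Injective _≡_ _≡_ (splitAt m {n})
splitAt-injective m {n} {x} {y} e =
  trans (sym (Fin.join-splitAt m n x)) (trans (cong (join m n) e) (Fin.join-splitAt m n y))

arrange-injective : ∀ a → Injective _≡_ _≡_ (arrange a)
arrange-injective (s , s′) e = splitAt-injective 2 (map₂-injective _ _ (place-injective s e))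
  where
  map₂-injective : ∀ u v → Sum.map₂ {A = Fin 2} (place s′ ∘ splitAt 2) u ≡ Sum.map₂ (place s′ ∘ splitAt 2) v → u ≡ v
  map₂-injective (inj₁ i) (inj₁ j) p = p
  map₂-injective (inj₂ i) (inj₂ j) p = cong inj₂ (splitAt-injective 2 (place-injective s′ (inj₂-injective p)))

arrangements : List Arrangement
arrangements = cartesianProduct (splits 6 2 4) (splits 4 2 2)

arrangements-complete : ∀ a → a ∈ arrangements
arrangements-complete (s , s′) = ∈-cartesianProduct⁺ (splits-complete s) (splits-complete s′)

place⁻¹ : ∀ {n p q} → Split n p q → Fin n → Fin p ⊎ Fin q
place⁻¹ s x = proj₁ (place-surjective s x)

part : Arrangement → Fin 6 → Fin 3
part (s , s′) i = [ (λ _ → 0F) , (λ j → [ (λ _ → 1F) , (λ _ → 2F) ]′ (place⁻¹ s′ j)) ]′ (place⁻¹ s i)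

opaque
  -- The first equation gives the change of variables that turns `f` into `halve`. The second
  -- recovers `f` from its code, so that a property of all balanced maps can be decided on
  -- `arrangements`.
  arrangement-of : (f : Fin 6 → Fin 3) → Balanced f →
                   ∃ λ a → (∀ i → f (arrange a i) ≡ halve i) × (∀ i → f i ≡ part a i)
  arrangement-of f bal
    with s , f≡0 , f≢0 ← split-by (λ z → f z == 0F) (bal 0F)
           (+-cancelˡ-≡ 2 _ _ (trans (cong (_+ # (λ z → not (f z == 0F))) (sym (bal 0F))) (#-not (λ z → f z == 0F))))
    -- The fibre over 0F contributes nothing to the count of 1F, so the other four points contain
    -- both places where `f` is 1F.
    with #1 ← trans (sym (trans (sum-place s (λ z → [ f z == 1F ]ᵇ)) (cong (_+ # (λ j → f (place s (inj₂ j)) == 1F))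
           (sum-≗0 {f = λ i → [ f (place s (inj₁ i)) == 1F ]ᵇ}
             (λ i → cong (λ k → [ k == 1F ]ᵇ) (==⇒≡ {x = f (place s (inj₁ i))} {0F} (f≡0 i))))))) (bal 1F)
    with s′ , f≡1 , f≢1 ← split-by (λ j → f (place s (inj₂ j)) == 1F) #1
           (+-cancelˡ-≡ 2 _ _ (trans (cong (_+ # (λ j → not (f (place s (inj₂ j)) == 1F))) (sym #1))
             (#-not (λ j → f (place s (inj₂ j)) == 1F)))) =
    (s , s′)
    , (λ { 0F → ==⇒≡ (f≡0 0F) ; 1F → ==⇒≡ (f≡0 1F)
         ; 2F → ==⇒≡ (f≡1 0F) ; 3F → ==⇒≡ (f≡1 1F)
         ; 4F → two (f≢0 _) (f≢1 0F) ; 5F → two (f≢0 _) (f≢1 1F) })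
    , λ i → trans (cong f (sym (proj₂ (place-surjective s i)))) (outer s s′ f≡0 f≢0 f≡1 f≢1 (place⁻¹ s i))
    where
    two : ∀ {k : Fin 3} → (k == 0F) ≡ false → (k == 1F) ≡ false → k ≡ 2F
    two {2F} _ _ = refl
    module _ (s : Split 6 2 4) (s′ : Split 4 2 2)
      (f≡0 : ∀ i → (f (place s (inj₁ i)) == 0F) ≡ true) (f≢0 : ∀ j → (f (place s (inj₂ j)) == 0F) ≡ false)
      (f≡1 : ∀ i → (f (place s (inj₂ (place s′ (inj₁ i)))) == 1F) ≡ true)
      (f≢1 : ∀ j → (f (place s (inj₂ (place s′ (inj₂ j)))) == 1F) ≡ false) where
      inner : ∀ v → f (place s (inj₂ (place s′ v))) ≡ [ (λ _ → 1F) , (λ _ → 2F) ]′ v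
      inner (inj₁ i) = ==⇒≡ (f≡1 i)
      inner (inj₂ j) = two (f≢0 _) (f≢1 j)
      outer : ∀ v → f (place s v) ≡ [ (λ _ → 0F) , (λ j → [ (λ _ → 1F) , (λ _ → 2F) ]′ (place⁻¹ s′ j)) ]′ v
      outer (inj₁ i) = ==⇒≡ (f≡0 i)
      outer (inj₂ j) = trans (cong (f ∘ place s ∘ inj₂) (sym (proj₂ (place-surjective s′ j)))) (inner (place⁻¹ s′ j))

-- The partitions of Fin 6 into pairs given by halve and by class c share 3, 1 or 0 pairs for c = 0, 1, 2.
class : Fin 3 → Fin 6 → Fin 3
class 0F = halve
class 1F = lookup (0F ∷ 0F ∷ 1F ∷ 2F ∷ 1F ∷ 2F ∷ [])
class 2F = lookup (0F ∷ 1F ∷ 1F ∷ 2F ∷ 2F ∷ 0F ∷ [])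

-- `standard` uses `m` only through equality of labels and `next`, so a cyclic shift of the labels
-- gives the same design.
rotate : Fin 3 → Fin 3 → Fin 3
rotate 0F k = k
rotate 1F k = next k
rotate 2F k = next (next k)

opaque
  rotate-== : ∀ ρ k l → (rotate ρ k == rotate ρ l) ≡ (k == l)
  rotate-== = toWitness {a? = all? λ ρ → all? λ k → all? λ l → (rotate ρ k == rotate ρ l) ≟ᴮ (k == l)} _

  rotate-next : ∀ ρ k → next (rotate ρ k) ≡ rotate ρ (next k)
  rotate-next = toWitness {a? = all? λ ρ → all? λ k → next (rotate ρ k) ≟ rotate ρ (next k)} _

-- A permutation of Fin 3 together with a permutation of Fin 6 inducing it on the pairs of halve.
Symmetry : Set
Symmetry = Vec (Fin 3) 3 × Vec (Fin 6) 6

-- Every permutation of the three nonzero elements is an automorphism of (ℤ/2)², so with 0F fixed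
-- the action on the β's permutes the three matchings by `π`.
onβ : Symmetry → Fin 4 → Fin 4
onβ (π , _) zero    = zero
onβ (π , _) (suc k) = suc (lookup π k)

onα : Symmetry → Fin 6 → Fin 6
onα (_ , σ) = lookup σ

-- Six permutations of the pairs of `halve` times eight choices of swaps inside them: the 48
-- elements of the stabiliser of this partition.
symmetries : List Symmetry
symmetries = cartesianProductWith symmetry
  ( (0F ∷ 1F ∷ 2F ∷ []) ∷ (0F ∷ 2F ∷ 1F ∷ []) ∷ (1F ∷ 0F ∷ 2F ∷ [])
  ∷ (1F ∷ 2F ∷ 0F ∷ []) ∷ (2F ∷ 0F ∷ 1F ∷ []) ∷ (2F ∷ 1F ∷ 0F ∷ []) ∷ [])
  (cartesianProduct (false ∷ true ∷ []) (cartesianProduct (false ∷ true ∷ []) (false ∷ true ∷ [])))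
  where
  pair : Fin 3 → Bool → Vec (Fin 6) 2
  pair 0F b = if b then 1F ∷ 0F ∷ [] else 0F ∷ 1F ∷ []
  pair 1F b = if b then 3F ∷ 2F ∷ [] else 2F ∷ 3F ∷ []
  pair 2F b = if b then 5F ∷ 4F ∷ [] else 4F ∷ 5F ∷ []
  symmetry : Vec (Fin 3) 3 → Bool × Bool × Bool → Symmetry
  symmetry (i ∷ j ∷ k ∷ []) (a , b , c) = i ∷ j ∷ k ∷ [] , pair i a Vec.++ pair j b Vec.++ pair k c

IsSymmetry : Symmetry → Set
IsSymmetry σ = (∀ j k → onβ σ j ≡ onβ σ k → j ≡ k) × (∀ y z → onα σ y ≡ onα σ z → y ≡ z)
             × (∀ j k z → (xor₄ (onβ σ j) (onβ σ k) == suc (halve (onα σ z))) ≡ (xor₄ j k == suc (halve z)))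

opaque
  symmetries-correct : All IsSymmetry symmetries
  symmetries-correct = toWitness {a? = All.all? (λ σ →
      (all? λ j → all? λ k → (onβ σ j ≟ onβ σ k) →-dec (j ≟ k))
      ×-dec (all? λ y → all? λ z → (onα σ y ≟ onα σ z) →-dec (y ≟ z))
      ×-dec (all? λ j → all? λ k → all? λ z →
        (xor₄ (onβ σ j) (onβ σ k) == suc (halve (onα σ z))) ≟ᴮ (xor₄ j k == suc (halve z)))) symmetries} _

Aligned : Arrangement → Symmetry → Set
Aligned a σ = ∃₂ λ c ρ → ∀ i → part a (onα σ i) ≡ rotate ρ (class c i)

opaque
  -- The union of two pairings of six points consists of cycles of lengths 2, 2, 2 or 2, 4 or 6,
  -- which accounts for the three values of `c`. That the cyclic order of the pairs adds no further
  -- case is part of the check.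
  alignments : All (λ a → Any (Aligned a) symmetries) arrangements
  alignments = toWitness {a? = All.all? (λ a → Any.any? (λ σ →
    any? λ c → any? λ ρ → all? λ i → part a (onα σ i) ≟ rotate ρ (class c i)) symmetries) arrangements} _

opaque
  align : (f : Fin 6 → Fin 3) → Balanced f →
          ∃ λ σ → IsSymmetry σ × ∃₂ λ c ρ → ∀ i → f (onα σ i) ≡ rotate ρ (class c i)
  align f bal with a , _ , f≡part ← arrangement-of f bal
    with σ , σ∈ , c , ρ , e ← find (All.lookup alignments (arrangements-complete a)) =
    σ , All.lookup symmetries-correct σ∈ , c , ρ , λ i → trans (f≡part (onα σ i)) (e i)

==-injective : ∀ {m n} (f : Fin m → Fin n) → Injective _≡_ _≡_ f → ∀ x y → (f x == f y) ≡ (x == y)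
==-injective f inj x y = ≡true-ext
  (λ e → trans (cong (_== y) (inj (==⇒≡ e))) (==-refl y))
  (λ e → trans (cong (λ i → f i == f y) (==⇒≡ {x = x} e)) (==-refl (f y)))

vertex : Fin 10 → Fin 4 ⊎ Fin 6
vertex = splitAt 4

record Canonical {n} (r : Fin n → Fin 10 → Role) : Set where
  field
    order           : Fin 10 → Fin 10
    order-injective : Injective _≡_ _≡_ order
    c               : Fin 3
    tips            : ∀ x y z → tipOf r (order x) (order y) (order z) ≡
                                standard halve (class c) (vertex x) (vertex y) (vertex z)

-- `arrange a` turns `g` into `halve`. Only then is `σ` chosen, among the permutations that keep it
-- so, to bring `m` into one of the classes.
module Relabelling (g m : Fin 6 → Fin 3) (a : Arrangement) (g∘a : ∀ i → g (arrange a i) ≡ halve i)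
  (σ : Symmetry) (σ-sym : IsSymmetry σ) (c ρ : Fin 3) (m∘σ : ∀ i → m (arrange a (onα σ i)) ≡ rotate ρ (class c i)) where

  α : Fin 6 → Fin 6
  α = arrange a ∘ onα σ

  φ : Fin 4 ⊎ Fin 6 → Fin 4 ⊎ Fin 6
  φ = Sum.map (onβ σ) α

  α-injective : ∀ y z → α y ≡ α z → y ≡ z
  α-injective y z = proj₁ (proj₂ σ-sym) y z ∘ arrange-injective a

  φ-injective : ∀ u v → φ u ≡ φ v → u ≡ v
  φ-injective (inj₁ j) (inj₁ k) e = cong inj₁ (proj₁ σ-sym j k (inj₁-injective e))
  φ-injective (inj₂ y) (inj₂ z) e = cong inj₂ (α-injective y z (inj₂-injective e))

  m∘α : ∀ y z → (m (α y) == m (α z)) ≡ (class c y == class c z)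
  m∘α y z = trans (cong₂ _==_ (m∘σ y) (m∘σ z)) (rotate-== ρ (class c y) (class c z))

  m∘α-next : ∀ y z → (m (α z) == next (m (α y))) ≡ (class c z == next (class c y))
  m∘α-next y z = trans (cong₂ _==_ (m∘σ z) (trans (cong next (m∘σ y)) (rotate-next ρ (class c y))))
    (rotate-== ρ (class c z) (next (class c y)))

  φ-standard : ∀ u v w → standard g m (φ u) (φ v) (φ w) ≡ standard halve (class c) u v w
  φ-standard (inj₁ j) (inj₁ k) (inj₂ z) =
    trans (cong (λ i → xor₄ (onβ σ j) (onβ σ k) == suc i) (g∘a (onα σ z))) (proj₂ (proj₂ σ-sym) j k z)
  φ-standard (inj₂ x) (inj₂ y) (inj₂ z) = cong₂ _∧_
    (cong not (==-injective α (λ {x} {y} → α-injective x y) x y))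
    (cong₂ _∧_ (m∘α x y) (m∘α-next x z))
  φ-standard (inj₁ j) (inj₁ k) (inj₁ _) = refl
  φ-standard (inj₁ j) (inj₂ y) w        = refl
  φ-standard (inj₂ x) (inj₁ k) w        = refl
  φ-standard (inj₂ x) (inj₂ y) (inj₁ _) = refl

balanced-arrange : ∀ f → Balanced f → ∀ a → Balanced (f ∘ arrange a)
balanced-arrange f bal a k = trans (sum-reindex (arrange a) (arrange-injective a) (λ z → [ f z == k ]ᵇ)) (bal k)

opaque
  canonise : ∀ {n} {r : Fin n → Fin 10 → Role} → IsSystem r → Canonical r
  canonise {r = r} sys = record
    { order = f ; order-injective = f-injective ; c = proj₁ (proj₂ (proj₂ aligned)) ; tips = f-tips }
    where
    open Normalised (normalise sys) renaming (tips to normal-tips)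
    arranged : ∃ λ a → (∀ i → g (arrange a i) ≡ halve i) × (∀ i → g i ≡ part a i)
    arranged = arrangement-of g g-balanced
    a : Arrangement
    a = proj₁ arranged
    aligned : ∃ λ σ → IsSymmetry σ × ∃₂ λ c ρ → ∀ i → m (arrange a (onα σ i)) ≡ rotate ρ (class c i)
    aligned = align (m ∘ arrange a) (balanced-arrange m m-balanced a)
    open Relabelling g m a (proj₁ (proj₂ arranged)) (proj₁ aligned) (proj₁ (proj₂ aligned))
      (proj₁ (proj₂ (proj₂ aligned))) (proj₁ (proj₂ (proj₂ (proj₂ aligned)))) (proj₂ (proj₂ (proj₂ (proj₂ aligned))))
    f : Fin 10 → Fin 10
    f x = place vertices (φ (vertex x))
    f-injective : Injective _≡_ _≡_ f
    f-injective {x} {y} e = splitAt-injective 4 {6} {x} {y}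
      (φ-injective (vertex x) (vertex y) (place-injective vertices {φ (vertex x)} {φ (vertex y)} e))
    f-tips : ∀ x y z → tipOf r (f x) (f y) (f z) ≡
               standard halve (class (proj₁ (proj₂ (proj₂ aligned)))) (vertex x) (vertex y) (vertex z)
    f-tips x y z = trans (normal-tips (φ (vertex x)) (φ (vertex y)) (φ (vertex z)))
      (φ-standard (vertex x) (vertex y) (vertex z))

-- Counting common triangles

Ternary : Set → Set
Ternary A = A → A → A → Bool

-- The tip relations of designs are symmetric in their first two arguments, so the three cyclic
-- shifts try every vertex as the tip.
triangle : ∀ {A} → Ternary A → Ternary A
triangle t x y z = t x y z ∨ t y z x ∨ t z x y

-- With these weights a pair of designs has total 2 (16 s + t), each spine being counted in both
-- directions, and this determines s and t because t ≤ 9.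
weight : ℕ → ℕ
weight 0 = 0
weight 1 = 1
weight 2 = 16
weight _ = 0

-- For designs this is nonzero only if x, y is the spine of a block of the second one, and then it
-- is the number of triangles of this block that the first one shares.
common : Ternary (Fin 10) → Ternary (Fin 10) → Fin 10 → Fin 10 → ℕ
common t₁ t₂ x y = # (λ z → t₂ x y z ∧ triangle t₁ x y z)

total : Ternary (Fin 10) → Ternary (Fin 10) → ℕ
total t₁ t₂ = sum (λ x → sum (λ y → weight (common t₁ t₂ x y)))

sum²-cong : ∀ {m n} {f g : Fin m → Fin n → ℕ} → (∀ x y → f x y ≡ g x y) →
            sum (λ x → sum (f x)) ≡ sum (λ x → sum (g x))
sum²-cong e = sum-cong-≗ (λ x → sum-cong-≗ (e x))

sum²-reindex : ∀ {n} (f : Fin n → Fin n) → Injective _≡_ _≡_ f → (h : Fin n → Fin n → ℕ) →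
               sum (λ x → sum (λ y → h (f x) (f y))) ≡ sum (λ x → sum (h x))
sum²-reindex f inj h = trans (sum-cong-≗ (λ x → sum-reindex f inj (h (f x)))) (sum-reindex f inj (λ x → sum (h x)))

common-cong : ∀ {t₁ t₁′ t₂ t₂′} → (∀ x y z → t₁ x y z ≡ t₁′ x y z) → (∀ x y z → t₂ x y z ≡ t₂′ x y z) →
              ∀ x y → common t₁ t₂ x y ≡ common t₁′ t₂′ x y
common-cong e₁ e₂ x y = #-cong (λ z → cong₂ _∧_ (e₂ x y z) (cong₂ _∨_ (e₁ x y z) (cong₂ _∨_ (e₁ y z x) (e₁ z x y))))

total-cong : ∀ {t₁ t₁′ t₂ t₂′} → (∀ x y z → t₁ x y z ≡ t₁′ x y z) → (∀ x y z → t₂ x y z ≡ t₂′ x y z) →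
             total t₁ t₂ ≡ total t₁′ t₂′
total-cong {t₁} {t₁′} {t₂} {t₂′} e₁ e₂ =
  sum²-cong {f = λ x y → weight (common t₁ t₂ x y)} {λ x y → weight (common t₁′ t₂′ x y)}
  (λ x y → cong weight (common-cong {t₁} {t₁′} {t₂} {t₂′} e₁ e₂ x y))

total-relabel : ∀ t₁ t₂ (f : Fin 10 → Fin 10) → Injective _≡_ _≡_ f →
                total (λ x y z → t₁ (f x) (f y) (f z)) (λ x y z → t₂ (f x) (f y) (f z)) ≡ total t₁ t₂
total-relabel t₁ t₂ f inj = trans
  (sum²-cong {f = λ x y → weight (common (λ x y z → t₁ (f x) (f y) (f z)) (λ x y z → t₂ (f x) (f y) (f z)) x y)}
             {λ x y → weight (common t₁ t₂ (f x) (f y))}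
    (λ x y → cong weight (sum-reindex f inj (λ z → [ t₂ (f x) (f y) z ∧ triangle t₁ (f x) (f y) z ]ᵇ))))
  (sum²-reindex f inj (λ x y → weight (common t₁ t₂ x y)))

-- The share of `total` that comes from spines between β's, where `τ` tells which triples are
-- triangles of the first design. Only `g` enters here, and only `m` in `scoreα`.
scoreβ : (g : Fin 6 → Fin 3) → (Fin 4 → Fin 4 → Fin 6 → Bool) → ℕ
scoreβ g τ = sum (λ j → sum (λ k → weight (# (λ z → (xor₄ j k == suc (g z)) ∧ τ j k z))))

scoreα : (m : Fin 6 → Fin 3) → Ternary (Fin 6) → ℕ
scoreα m τ = sum (λ x → sum (λ y → weight (# (λ z → (not (x == y) ∧ (m x == m y) ∧ (m z == next (m x))) ∧ τ x y z))))

module _ (s : Split 10 4 6) (t₁ t₂ : Ternary (Fin 10)) (g m : Fin 6 → Fin 3)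
  (tips : ∀ u v w → t₂ (place s u) (place s v) (place s w) ≡ standard g m u v w) where

  private
    β = λ j → place s (inj₁ j)
    α = λ z → place s (inj₂ z)
    W : Fin 10 → Fin 10 → ℕ
    W x y = weight (common t₁ t₂ x y)

  common-place : ∀ u v → common t₁ t₂ (place s u) (place s v) ≡
    # (λ z → standard g m u v (inj₁ z) ∧ triangle t₁ (place s u) (place s v) (β z)) +
    # (λ z → standard g m u v (inj₂ z) ∧ triangle t₁ (place s u) (place s v) (α z))
  common-place u v = trans (sum-place s (λ z → [ t₂ (place s u) (place s v) z ∧ triangle t₁ (place s u)
    (place s v) z ]ᵇ))
    (cong₂ _+_ (#-cong (λ z → cong (_∧ triangle t₁ (place s u) (place s v) (β z)) (tips u v (inj₁ z))))
               (#-cong (λ z → cong (_∧ triangle t₁ (place s u) (place s v) (α z)) (tips u v (inj₂ z)))))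

  -- No spine joins a β to an α, so the two mixed parts of the sum over vertex pairs vanish.
  total-place : total t₁ t₂ ≡ scoreβ g (λ j k z → triangle t₁ (β j) (β k) (α z)) +
                              scoreα m (λ x y z → triangle t₁ (α x) (α y) (α z))
  total-place = trans (sum-place s (λ x → sum (W x))) (cong₂ _+_
    (sum-cong-≗ (λ j → trans (sum-place s (W (β j))) (trans (cong₂ _+_
      (sum-cong-≗ (λ k → cong weight (common-place (inj₁ j) (inj₁ k))))
      (sum-≗0 {f = λ y → W (β j) (α y)} (λ y → cong weight (common-place (inj₁ j) (inj₂ y)))))
      (+-identityʳ _))))
    (sum-cong-≗ (λ x → trans (sum-place s (W (α x))) (cong₂ _+_
      (sum-≗0 {f = λ k → W (α x) (β k)} (λ k → cong weight (common-place (inj₂ x) (inj₁ k))))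
      (sum-cong-≗ (λ y → cong weight (common-place (inj₂ x) (inj₂ y))))))))

scoreβ-arrange : ∀ g a (g∘a : ∀ i → g (arrange a i) ≡ halve i) τ →
                 scoreβ g τ ≡ scoreβ halve (λ j k z → τ j k (arrange a z))
scoreβ-arrange g a g∘a τ = sum²-cong
  {f = λ j k → weight (# (λ z → (xor₄ j k == suc (g z)) ∧ τ j k z))}
  {λ j k → weight (# (λ z → (xor₄ j k == suc (halve z)) ∧ τ j k (arrange a z)))}
  λ j k → cong weight (trans
    (sym (sum-reindex (arrange a) (arrange-injective a) (λ z → [ (xor₄ j k == suc (g z)) ∧ τ j k z ]ᵇ)))
    (#-cong (λ z → cong (λ i → (xor₄ j k == suc i) ∧ τ j k (arrange a z)) (g∘a z))))

scoreα-arrange : ∀ m a (m∘a : ∀ i → m (arrange a i) ≡ halve i) τ →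
                 scoreα m τ ≡ scoreα halve (λ x y z → τ (arrange a x) (arrange a y) (arrange a z))
scoreα-arrange m a m∘a τ = trans
  (sym (sum²-reindex (arrange a) (arrange-injective a) h))
  (sum²-cong {f = λ x y → h (arrange a x) (arrange a y)} {λ x y → weight (# (λ z → Q x y z))}
    λ x y → cong weight (trans
      (sym (sum-reindex (arrange a) (arrange-injective a) (λ z → [ P (arrange a x) (arrange a y) z ]ᵇ)))
      (#-cong (λ z → cong (_∧ τ (arrange a x) (arrange a y) (arrange a z)) (cong₂ _∧_
        (cong not (==-injective (arrange a) (arrange-injective a) x y))
        (cong₂ _∧_ (cong₂ _==_ (m∘a x) (m∘a y)) (cong₂ _==_ (m∘a z) (cong next (m∘a x)))))))))
  where
  P Q : Ternary (Fin 6)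
  P x y z = (not (x == y) ∧ (m x == m y) ∧ (m z == next (m x))) ∧ τ x y z
  Q x y z = (not (x == y) ∧ (halve x == halve y) ∧ (halve z == next (halve x))) ∧ τ (arrange a x) (arrange a y)
    (arrange a z)
  h : Fin 6 → Fin 6 → ℕ
  h x y = weight (# (P x y))

weight₂ : Bool → Bool → ℕ
weight₂ true  true  = 16
weight₂ true  false = 1
weight₂ false true  = 1
weight₂ false false = 0

weight-+ : ∀ a b → weight ([ a ]ᵇ + ([ b ]ᵇ + 0)) ≡ weight₂ a b
weight-+ true  true  = refl
weight-+ true  false = refl
weight-+ false true  = refl
weight-+ false false = refl

-- The three matchings of `xor₄` are 01, 23, then 02, 13, then 03, 12. The vector lists the α's
-- fibre by fibre, so two of its entries are the tips over both edges of one matching.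
fastβ : (Fin 4 → Fin 4 → Fin 6 → Bool) → Vec (Fin 6) 6 → ℕ
fastβ τ (a ∷ b ∷ c ∷ d ∷ e ∷ f ∷ []) =
  w 0F 1F a b + (w 2F 3F a b + (w 0F 2F c d + (w 1F 3F c d + (w 0F 3F e f + w 1F 2F e f))))
  where
  w : Fin 4 → Fin 4 → Fin 6 → Fin 6 → ℕ
  w j k y z = weight₂ (τ j k y) (τ j k z)

fastα : Ternary (Fin 6) → Vec (Fin 6) 6 → ℕ
fastα τ (a ∷ b ∷ c ∷ d ∷ e ∷ f ∷ []) = w a b c d + (w c d e f + w e f a b)
  where
  w : Fin 6 → Fin 6 → Fin 6 → Fin 6 → ℕ
  w x y z z′ = weight₂ (τ x y z) (τ x y z′)

scoreβ-fast : ∀ (τ : Fin 4 → Fin 4 → Fin 6 → Bool) → (∀ j k z → τ j k z ≡ τ k j z) → (p : Fin 6 → Fin 6) →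
              scoreβ halve (λ j k z → τ j k (p z)) ≡ 2 * fastβ τ (tabulate p)
scoreβ-fast τ τ-sym p = begin
  -- This is the left side evaluated: `xor₄ j j` is 0F and never a successor, so the diagonal has
  -- disappeared. Each edge still occurs in both directions, whence the factor 2.
  (h 0F 1F + (h 0F 2F + (h 0F 3F + 0))) + ((h 1F 0F + (h 1F 2F + (h 1F 3F + 0))) +
    ((h 2F 0F + (h 2F 1F + (h 2F 3F + 0))) + ((h 3F 0F + (h 3F 1F + (h 3F 2F + 0))) + 0)))
    ≡⟨ cong₂ _+_ (refl {x = h 0F 1F + (h 0F 2F + (h 0F 3F + 0))})
      (cong₂ _+_ (cong (_+ (h 1F 2F + (h 1F 3F + 0))) (h-sym 1F 0F))
         (cong₂ _+_ (cong₂ _+_ (h-sym 2F 0F) (cong (_+ (h 2F 3F + 0)) (h-sym 2F 1F)))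
           (cong (_+ 0) (cong₂ _+_ (h-sym 3F 0F) (cong₂ _+_ (h-sym 3F 1F) (cong (_+ 0) (h-sym 3F 2F))))))) ⟩
  (h 0F 1F + (h 0F 2F + (h 0F 3F + 0))) + ((h 0F 1F + (h 1F 2F + (h 1F 3F + 0))) +
    ((h 0F 2F + (h 1F 2F + (h 2F 3F + 0))) + ((h 0F 3F + (h 1F 3F + (h 2F 3F + 0))) + 0)))
    ≡⟨ solve 6 (λ a b c d e f →
         (a :+ (b :+ (c :+ con 0))) :+ ((a :+ (d :+ (e :+ con 0))) :+
           ((b :+ (d :+ (f :+ con 0))) :+ ((c :+ (e :+ (f :+ con 0))) :+ con 0)))
         := con 2 :* (a :+ (f :+ (b :+ (e :+ (c :+ d))))))
         refl (h 0F 1F) (h 0F 2F) (h 0F 3F) (h 1F 2F) (h 1F 3F) (h 2F 3F) ⟩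
  2 * (h 0F 1F + (h 2F 3F + (h 0F 2F + (h 1F 3F + (h 0F 3F + h 1F 2F)))))
    ≡⟨ cong (2 *_) (cong₂ _+_ (weight-+ (τ 0F 1F (p 0F)) (τ 0F 1F (p 1F)))
      (cong₂ _+_ (weight-+ (τ 2F 3F (p 0F)) (τ 2F 3F (p 1F)))
         (cong₂ _+_ (weight-+ (τ 0F 2F (p 2F)) (τ 0F 2F (p 3F)))
           (cong₂ _+_ (weight-+ (τ 1F 3F (p 2F)) (τ 1F 3F (p 3F)))
           (cong₂ _+_ (weight-+ (τ 0F 3F (p 4F)) (τ 0F 3F (p 5F))) (weight-+ (τ 1F 2F (p 4F)) (τ 1F 2F (p 5F)))))))) ⟩
  2 * fastβ τ (tabulate p) ∎
  where
  open ≡-Reasoning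
  open +-*-Solver
  h : Fin 4 → Fin 4 → ℕ
  h j k = weight (# (λ z → (xor₄ j k == suc (halve z)) ∧ τ j k (p z)))
  h-sym : ∀ j k → h j k ≡ h k j
  h-sym j k = cong weight (#-cong (λ z → cong₂ _∧_ (cong (_== suc (halve z)) (xor₄-comm j k)) (τ-sym j k (p z))))

scoreα-fast : ∀ (τ : Ternary (Fin 6)) → (∀ x y z → τ x y z ≡ τ y x z) → (p : Fin 6 → Fin 6) →
              scoreα halve (λ x y z → τ (p x) (p y) (p z)) ≡ 2 * fastα τ (tabulate p)
scoreα-fast τ τ-sym p = begin
  (h 0F 1F + 0) + ((h 1F 0F + 0) + ((h 2F 3F + 0) + ((h 3F 2F + 0) + ((h 4F 5F + 0) + ((h 5F 4F + 0) + 0)))))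
    ≡⟨ solve 6 (λ a b c d e f →
         (a :+ con 0) :+ ((b :+ con 0) :+ ((c :+ con 0) :+
           ((d :+ con 0) :+ ((e :+ con 0) :+ ((f :+ con 0) :+ con 0)))))
         := (a :+ (c :+ e)) :+ (b :+ (d :+ f)))
         refl (h 0F 1F) (h 1F 0F) (h 2F 3F) (h 3F 2F) (h 4F 5F) (h 5F 4F) ⟩
  (h 0F 1F + (h 2F 3F + h 4F 5F)) + (h 1F 0F + (h 3F 2F + h 5F 4F))
    ≡⟨ cong₂ _+_ (cong₂ _+_ (weight-+ (τ (p 0F) (p 1F) (p 2F)) (τ (p 0F) (p 1F) (p 3F)))
         (cong₂ _+_ (weight-+ (τ (p 2F) (p 3F) (p 4F)) (τ (p 2F) (p 3F) (p 5F)))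
           (weight-+ (τ (p 4F) (p 5F) (p 0F)) (τ (p 4F) (p 5F) (p 1F)))))
       (cong₂ _+_ (swapped 0F 1F 2F 3F) (cong₂ _+_ (swapped 2F 3F 4F 5F) (swapped 4F 5F 0F 1F))) ⟩
  fastα τ (tabulate p) + fastα τ (tabulate p)
    ≡⟨ cong (fastα τ (tabulate p) +_) (+-identityʳ _) ⟨
  2 * fastα τ (tabulate p) ∎
  where
  open ≡-Reasoning
  open +-*-Solver
  h : Fin 6 → Fin 6 → ℕ
  h x y = weight (# (λ z → (not (x == y) ∧ (halve x == halve y) ∧ (halve z == next (halve x))) ∧ τ (p x) (p y) (p z)))
  swapped : ∀ a b c d → weight ([ τ (p b) (p a) (p c) ]ᵇ + ([ τ (p b) (p a) (p d) ]ᵇ + 0)) ≡ weight₂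
    (τ (p a) (p b) (p c)) (τ (p a) (p b) (p d))
  swapped a b c d = trans (weight-+ (τ (p b) (p a) (p c)) _)
    (cong₂ weight₂ (τ-sym (p b) (p a) (p c)) (τ-sym (p b) (p a) (p d)))

triangle-sym : ∀ {A} (t : Ternary A) → (∀ x y z → t x y z ≡ t y x z) → ∀ x y z → triangle t x y z ≡ triangle t y x z
triangle-sym t t-sym x y z = cong₂ _∨_ (t-sym x y z)
  (trans (∨-comm (t y z x) (t z x y)) (cong₂ _∨_ (t-sym z x y) (t-sym y z x)))

standard-sym : ∀ g m u v w → standard g m u v w ≡ standard g m v u w
standard-sym g m (inj₁ j) (inj₁ k) (inj₂ z) = cong (_== suc (g z)) (xor₄-comm j k)
standard-sym g m (inj₁ j) (inj₁ k) (inj₁ l) = refl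
standard-sym g m (inj₁ j) (inj₂ y) w        = refl
standard-sym g m (inj₂ x) (inj₁ k) w        = refl
standard-sym g m (inj₂ x) (inj₂ y) (inj₁ l) = refl
standard-sym g m (inj₂ x) (inj₂ y) (inj₂ z) = ≡true-ext (flip x y) (flip y x)
  where
  flip : ∀ x y → not (x == y) ∧ (m x == m y) ∧ (m z == next (m x)) ≡ true → not (y == x) ∧ (m y == m x) ∧
    (m z == next (m y)) ≡ true
  flip x y e = cong₂ _∧_ (cong not (≢⇒== {x = y} {x} λ p → true≢false e₁
    (cong not (trans (cong (x ==_) p) (==-refl x)))))
    (cong₂ _∧_ (trans (cong (_== m x) (sym my)) (==-refl (m x))) (trans (cong (λ k → m z == next k) (sym my)) e₃))
    where
    e₁ = proj₁ (∧-true {not (x == y)} e)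
    e₂₃ = proj₂ (∧-true {not (x == y)} e)
    my : m x ≡ m y
    my = ==⇒≡ (proj₁ (∧-true {m x == m y} e₂₃))
    e₃ = proj₂ (∧-true {m x == m y} e₂₃)

-- The exhaustive comparison

-- Stated in advance: `allChecked` is what shows that nothing else occurs, and `realised` that each
-- of the forty pairs does.
attained : List (ℕ × ℕ)
attained
  = (0 , 0) ∷ (0 , 1) ∷ (0 , 2) ∷ (0 , 3) ∷ (0 , 4) ∷ (0 , 5) ∷ (0 , 6) ∷ (0 , 7) ∷ (0 , 8) ∷ (0 , 9)
  ∷ (1 , 0) ∷ (1 , 1) ∷ (1 , 2) ∷ (1 , 3) ∷ (1 , 4) ∷ (1 , 5) ∷ (1 , 6) ∷ (1 , 7)
  ∷ (2 , 0) ∷ (2 , 1) ∷ (2 , 2) ∷ (2 , 3) ∷ (2 , 4) ∷ (2 , 5) ∷ (2 , 6) ∷ (2 , 7)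
  ∷ (3 , 0) ∷ (3 , 2) ∷ (3 , 3) ∷ (3 , 4) ∷ (3 , 6) ∷ (4 , 0) ∷ (4 , 2) ∷ (4 , 4)
  ∷ (5 , 0) ∷ (5 , 4) ∷ (6 , 0) ∷ (6 , 2) ∷ (6 , 3) ∷ (9 , 0) ∷ []

-- Matches the weights 16 and 1 of a block. Below 16 the second component is a digit, so the pair
-- can be read off.
code : ℕ × ℕ → ℕ
code (s , t) = 16 * s + t

-- Tables are evaluated once and shared by all the arrangements, unlike the functions they tabulate.
Table : ℕ → ℕ → ℕ → Set
Table m n k = Vec (Vec (Vec Bool k) n) m

table : ∀ {m n k} → (Fin m → Fin n → Fin k → Bool) → Table m n k
table τ = tabulate λ x → tabulate λ y → tabulate λ z → τ x y z

at : ∀ {m n k} → Table m n k → Fin m → Fin n → Fin k → Bool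
at T x y z = lookup (lookup (lookup T x) y) z

at-table : ∀ {m n k} (τ : Fin m → Fin n → Fin k → Bool) x y z → at (table τ) x y z ≡ τ x y z
at-table τ x y z = trans
  (cong (λ row → lookup (lookup row y) z) (lookup∘tabulate (λ x → tabulate λ y → tabulate λ z → τ x y z) x))
  (trans (cong (λ row → lookup row z) (lookup∘tabulate (λ y → tabulate λ z → τ x y z) y)) (lookup∘tabulate (τ x y) z))

canonicalTip : Fin 3 → Ternary (Fin 10)
canonicalTip c x y z = standard halve (class c) (vertex x) (vertex y) (vertex z)

canonicalTriangle : Fin 3 → Ternary (Fin 10)
canonicalTriangle c = triangle (canonicalTip c)

tableβ : Fin 3 → Split 10 4 6 → Table 4 4 6
tableβ c s = table λ j k z → canonicalTriangle c (place s (inj₁ j)) (place s (inj₁ k)) (place s (inj₂ z))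

tableα : Fin 3 → Split 10 4 6 → Table 6 6 6
tableα c s = table λ x y z → canonicalTriangle c (place s (inj₂ x)) (place s (inj₂ y)) (place s (inj₂ z))

arrays : List (Vec (Fin 6) 6)
arrays = List.map (tabulate ∘ arrange) arrangements

SumsIn : List ℕ → List ℕ → List ℕ → Set
SumsIn codes ps qs = All (λ p → All (λ q → p + q ∈ codes) qs) ps

-- Six blocks of weight 0, 1 or 16 give at most 28 scores and three blocks at most 10, so discarding
-- duplicates leaves at most 280 sums for each position of the β's.
Checked : List (Vec (Fin 6) 6) → List ℕ → Table 4 4 6 → Table 6 6 6 → Set
Checked as codes B A = SumsIn codes (deduplicate ℕ._≟_ (List.map (fastβ (at B)) as))
  (deduplicate ℕ._≟_ (List.map (fastα (at A)) as))

checked? : ∀ as codes B A → Dec (Checked as codes B A)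
checked? as codes B A = sumsIn? (deduplicate ℕ._≟_ (List.map (fastβ (at B)) as))
  (deduplicate ℕ._≟_ (List.map (fastα (at A)) as))
  where
  sumsIn? : ∀ ps qs → Dec (SumsIn codes ps qs)
  sumsIn? ps qs = All.all? (λ p → All.all? (λ q → (p + q) ∈ℕ? codes) qs) ps

allChecked? : ∀ c as codes ss → Dec (All (λ s → Checked as codes (tableβ c s) (tableα c s)) ss)
allChecked? c as codes = All.all? (λ s → checked? as codes (tableβ c s) (tableα c s))

opaque
  allChecked : ∀ c → All (λ s → Checked arrays (List.map code attained) (tableβ c s) (tableα c s)) (splits 10 4 6)
  allChecked 0F = toWitness {a? = allChecked? 0F arrays (List.map code attained) (splits 10 4 6)} _
  allChecked 1F = toWitness {a? = allChecked? 1F arrays (List.map code attained) (splits 10 4 6)} _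
  allChecked 2F = toWitness {a? = allChecked? 2F arrays (List.map code attained) (splits 10 4 6)} _

checked-sum : ∀ {as codes} {B : Table 4 4 6} {A : Table 6 6 6} → Checked as codes B A →
              ∀ {p q} → p ∈ as → q ∈ as → fastβ (at B) p + fastα (at A) q ∈ codes
checked-sum ch p∈ q∈ = All.lookup (All.lookup ch (∈-deduplicate⁺ ℕ._≟_ (∈-map⁺ _ p∈)))
  (∈-deduplicate⁺ ℕ._≟_ (∈-map⁺ _ q∈))

arrays-complete : ∀ a → tabulate (arrange a) ∈ arrays
arrays-complete a = ∈-map⁺ (tabulate ∘ arrange) (arrangements-complete a)

canonicalTriangle-sym : ∀ c x y z → canonicalTriangle c x y z ≡ canonicalTriangle c y x z
canonicalTriangle-sym c = triangle-sym _ (λ x y z → standard-sym halve (class c) (vertex x) (vertex y) (vertex z))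

scoreβ-cong : ∀ g {τ τ′} → (∀ j k z → τ j k z ≡ τ′ j k z) → scoreβ g τ ≡ scoreβ g τ′
scoreβ-cong g {τ} {τ′} e = sum²-cong
  {f = λ j k → weight (# (λ z → (xor₄ j k == suc (g z)) ∧ τ j k z))}
  {λ j k → weight (# (λ z → (xor₄ j k == suc (g z)) ∧ τ′ j k z))}
  (λ j k → cong weight (#-cong (λ z → cong ((xor₄ j k == suc (g z)) ∧_) (e j k z))))

scoreα-cong : ∀ m {τ τ′} → (∀ x y z → τ x y z ≡ τ′ x y z) → scoreα m τ ≡ scoreα m τ′
scoreα-cong m {τ} {τ′} e = sum²-cong
  {f = λ x y → weight (# (λ z → (not (x == y) ∧ (m x == m y) ∧ (m z == next (m x))) ∧ τ x y z))}
  {λ x y → weight (# (λ z → (not (x == y) ∧ (m x == m y) ∧ (m z == next (m x))) ∧ τ′ x y z))}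
  (λ x y → cong weight (#-cong (λ z → cong ((not (x == y) ∧ (m x == m y) ∧ (m z == next (m x))) ∧_) (e x y z))))

total-fast : ∀ (t₁ t₂ : Ternary (Fin 10)) s {g m} →
  (∀ u v w → t₂ (place s u) (place s v) (place s w) ≡ standard g m u v w) →
  (∀ x y z → triangle t₁ x y z ≡ triangle t₁ y x z) →
  ∀ a b → (∀ i → g (arrange a i) ≡ halve i) → (∀ i → m (arrange b i) ≡ halve i) →
  ∀ (B : Table 4 4 6) (A : Table 6 6 6) →
  (∀ j k z → at B j k z ≡ triangle t₁ (place s (inj₁ j)) (place s (inj₁ k)) (place s (inj₂ z))) →
  (∀ x y z → at A x y z ≡ triangle t₁ (place s (inj₂ x)) (place s (inj₂ y)) (place s (inj₂ z))) →
  total t₁ t₂ ≡ 2 * (fastβ (at B) (tabulate (arrange a)) + fastα (at A) (tabulate (arrange b)))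
total-fast t₁ t₂ s {g} {m} tips t₁-sym a b g∘a m∘b B A B≡ A≡ = begin
  total t₁ t₂                               ≡⟨ total-place s t₁ t₂ g m tips ⟩
  scoreβ g (λ j k z → triangle t₁ (place s (inj₁ j)) (place s (inj₁ k)) (place s (inj₂ z))) +
    scoreα m (λ x y z → triangle t₁ (place s (inj₂ x)) (place s (inj₂ y)) (place s (inj₂ z)))
                                            ≡⟨ cong₂ _+_ (scoreβ-cong g B≡) (scoreα-cong m A≡) ⟨
  scoreβ g (at B) + scoreα m (at A)         ≡⟨ cong₂ _+_ (scoreβ-arrange g a g∘a (at B))
    (scoreα-arrange m b m∘b (at A)) ⟩
  scoreβ halve (λ j k z → at B j k (arrange a z)) +
    scoreα halve (λ x y z → at A (arrange b x) (arrange b y) (arrange b z))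
                                            ≡⟨ cong₂ _+_ (scoreβ-fast (at B) B-sym (arrange a))
                                              (scoreα-fast (at A) A-sym (arrange b)) ⟩
  2 * fastβ (at B) p + 2 * fastα (at A) q   ≡⟨ ℕ.*-distribˡ-+ 2 (fastβ (at B) p) (fastα (at A) q) ⟨
  2 * (fastβ (at B) p + fastα (at A) q)     ∎
  where
  open ≡-Reasoning
  p q : Vec (Fin 6) 6
  p = tabulate (arrange a)
  q = tabulate (arrange b)
  B-sym : ∀ j k z → at B j k z ≡ at B k j z
  B-sym j k z = trans (B≡ j k z) (trans (t₁-sym (place s (inj₁ j)) (place s (inj₁ k)) (place s (inj₂ z)))
    (sym (B≡ k j z)))
  A-sym : ∀ x y z → at A x y z ≡ at A y x z
  A-sym x y z = trans (A≡ x y z) (trans (t₁-sym (place s (inj₂ x)) (place s (inj₂ y)) (place s (inj₂ z)))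
    (sym (A≡ y x z)))

canonical-total : ∀ c {n} {r : Fin n → Fin 10 → Role} → Normalised r →
                  ∃ λ k → k ∈ List.map code attained × total (canonicalTip c) (tipOf r) ≡ 2 * k
canonical-total c {r = r} N =
  fastβ (at (tableβ c vertices)) (tabulate (arrange a)) + fastα (at (tableα c vertices)) (tabulate (arrange b))
  , checked-sum {arrays} {List.map code attained} {tableβ c vertices} {tableα c vertices}
      (All.lookup (allChecked c) (splits-complete vertices)) {tabulate (arrange a)} {tabulate (arrange b)}
        (arrays-complete a) (arrays-complete b)
  , total-fast (canonicalTip c) (tipOf r) vertices tips (canonicalTriangle-sym c) a b
      (proj₁ (proj₂ arranged-g)) (proj₁ (proj₂ arranged-m)) (tableβ c vertices) (tableα c vertices)
      (at-table (λ j k z → canonicalTriangle c (place vertices (inj₁ j)) (place vertices (inj₁ k))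
        (place vertices (inj₂ z))))
      (at-table (λ x y z → canonicalTriangle c (place vertices (inj₂ x)) (place vertices (inj₂ y))
        (place vertices (inj₂ z))))
  where
  open Normalised N
  arranged-g : ∃ λ a → (∀ i → g (arrange a i) ≡ halve i) × (∀ i → g i ≡ part a i)
  arranged-g = arrangement-of g g-balanced
  arranged-m : ∃ λ a → (∀ i → m (arrange a i) ≡ halve i) × (∀ i → m i ≡ part a i)
  arranged-m = arrangement-of m m-balanced
  a b : Arrangement
  a = proj₁ arranged-g
  b = proj₁ arranged-m

tipOf-relabel : ∀ {n} (r : Fin n → Fin 10 → Role) (f : Fin 10 → Fin 10) → Injective _≡_ _≡_ f →
                ∀ x y z → tipOf r (f x) (f y) (f z) ≡ tipOf (λ i → r i ∘ f) x y z
tipOf-relabel r f inj x y z = ≡true-ext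
  (λ e → let fx≢fy , i , sx , sy , tz = tipOf⇒ {r = r} {f x} {f y} {f z} e in
         tipOf⇐ {r = λ i → r i ∘ f} (fx≢fy ∘ cong f) i sx sy tz)
  (λ e → let x≢y , i , sx , sy , tz = tipOf⇒ {r = λ i → r i ∘ f} {x} {y} {z} e in
         tipOf⇐ {r = r} (x≢y ∘ inj) i sx sy tz)

-- Both designs are relabelled by the permutation that makes the first one canonical; the second is
-- then an arbitrary system, for which the normal form is enough.
attained-total : ∀ {n₁ n₂} {r₁ : Fin n₁ → Fin 10 → Role} {r₂ : Fin n₂ → Fin 10 → Role} → IsSystem r₁ → IsSystem r₂ →
                 ∃ λ k → k ∈ List.map code attained × total (tipOf r₁) (tipOf r₂) ≡ 2 * k
attained-total {r₁ = r₁} {r₂} sys₁ sys₂ = proj₁ result , proj₁ (proj₂ result) , (begin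
  total (tipOf r₁) (tipOf r₂)          ≡⟨ total-relabel (tipOf r₁) (tipOf r₂) order order-injective ⟨
  total (λ x y z → tipOf r₁ (order x) (order y) (order z)) (λ x y z → tipOf r₂ (order x) (order y) (order z))
                                       ≡⟨ total-cong {λ x y z → tipOf r₁ (order x) (order y) (order z)} {canonicalTip c}
                                            {λ x y z → tipOf r₂ (order x) (order y) (order z)} {tipOf (λ i → r₂ i ∘ order)}
                                            tips (tipOf-relabel r₂ order order-injective) ⟩
  total (canonicalTip c) (tipOf (λ i → r₂ i ∘ order))
                                       ≡⟨ proj₂ (proj₂ result) ⟩
  2 * proj₁ result                     ∎)
  where
  open ≡-Reasoning
  open Canonical (canonise sys₁)
  result : ∃ λ k → k ∈ List.map code attained ×
           total (canonicalTip c) (tipOf (λ i → r₂ i ∘ order)) ≡ 2 * k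
  result = canonical-total c (normalise (relabel order order-injective sys₂))

-- Blocks and designs

module _ (B : Block 10) where
  open Block B

  a≢b : a ≢ b
  a≢b with (p ∷ _) ∷ _ ← distinct = p
  a≢c : a ≢ c
  a≢c with (_ ∷ p ∷ _) ∷ _ ← distinct = p
  a≢d : a ≢ d
  a≢d with (_ ∷ _ ∷ p ∷ _) ∷ _ ← distinct = p
  b≢c : b ≢ c
  b≢c with _ ∷ (p ∷ _) ∷ _ ← distinct = p
  b≢d : b ≢ d
  b≢d with _ ∷ (_ ∷ p ∷ _) ∷ _ ← distinct = p
  c≢d : c ≢ d
  c≢d with _ ∷ _ ∷ (p ∷ _) ∷ _ ← distinct = p

  opaque
    role : Fin 10 → Role
    role x = if (x == a) ∨ (x == b) then spine else if (x == c) ∨ (x == d) then tip else none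

    isSpine-role : ∀ x → isSpine (role x) ≡ (x == a) ∨ (x == b)
    isSpine-role x with (x == a) ∨ (x == b) | (x == c) ∨ (x == d)
    ... | true  | _     = refl
    ... | false | true  = refl
    ... | false | false = refl

    -- `role` tests for spines first, so this is where the disjointness of {a, b} and {c, d} enters.
    isTip-role : ∀ x → isTip (role x) ≡ (x == c) ∨ (x == d)
    isTip-role x with x ≟ a | x ≟ b | x ≟ c | x ≟ d
    ... | yes refl | _        | yes p    | _     = contradiction p a≢c
    ... | yes refl | _        | no _     | yes p = contradiction p a≢d
    ... | yes refl | _        | no _     | no _  = refl
    ... | no _     | yes refl | yes p    | _     = contradiction p b≢c
    ... | no _     | yes refl | no _     | yes p = contradiction p b≢d
    ... | no _     | yes refl | no _     | no _  = refl
    ... | no _     | no _     | yes _    | _     = refl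
    ... | no _     | no _     | no _     | yes _ = refl
    ... | no _     | no _     | no _     | no _  = refl

  spine-a : isSpine (role a) ≡ true
  spine-a = trans (isSpine-role a) (cong (_∨ (a == b)) (==-refl a))
  spine-b : isSpine (role b) ≡ true
  spine-b = trans (isSpine-role b) (∨-trueʳ (b == a) (==-refl b))
  tip-c : isTip (role c) ≡ true
  tip-c = trans (isTip-role c) (cong (_∨ (c == d)) (==-refl c))
  tip-d : isTip (role d) ≡ true
  tip-d = trans (isTip-role d) (∨-trueʳ (d == c) (==-refl d))

  spine⇒ : ∀ {x} → isSpine (role x) ≡ true → x ≡ a ⊎ x ≡ b
  spine⇒ {x} e = Sum.map ==⇒≡ ==⇒≡ (∨-true {x == a} (trans (sym (isSpine-role x)) e))

  tip⇒ : ∀ {x} → isTip (role x) ≡ true → x ≡ c ⊎ x ≡ d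
  tip⇒ {x} e = Sum.map ==⇒≡ ==⇒≡ (∨-true {x == c} (trans (sym (isTip-role x)) e))

  role-spines : # (isSpine ∘ role) ≡ 2
  role-spines = trans (#-cong isSpine-role) (#-pair a≢b)

  role-tips : # (isTip ∘ role) ≡ 2
  role-tips = trans (#-cong isTip-role) (#-pair c≢d)

edge-adj : ∀ B {x y} → (x , y) ∈ edges B → x ≢ y × adj (role B x) (role B y) ≡ true
edge-adj B (here refl)                                 =
  a≢b B , adj-ss {role B (Block.a B)} {role B (Block.b B)} (spine-a B) (spine-b B)
edge-adj B (there (here refl))                         =
  a≢c B , adj-st {role B (Block.a B)} {role B (Block.c B)} (spine-a B) (tip-c B)
edge-adj B (there (there (here refl)))                 =
  a≢d B , adj-st {role B (Block.a B)} {role B (Block.d B)} (spine-a B) (tip-d B)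
edge-adj B (there (there (there (here refl))))         =
  b≢c B , adj-st {role B (Block.b B)} {role B (Block.c B)} (spine-b B) (tip-c B)
edge-adj B (there (there (there (there (here refl))))) =
  b≢d B , adj-st {role B (Block.b B)} {role B (Block.d B)} (spine-b B) (tip-d B)

Adjacent⇒adj : ∀ B {x y} → Adjacent B x y → x ≢ y × adj (role B x) (role B y) ≡ true
Adjacent⇒adj B (inj₁ e) = edge-adj B e
Adjacent⇒adj B {x} {y} (inj₂ e) =
  proj₁ (edge-adj B e) ∘ sym , trans (adj-comm (role B x) (role B y)) (proj₂ (edge-adj B e))

adj⇒Adjacent : ∀ B {x y} → x ≢ y → adj (role B x) (role B y) ≡ true → Adjacent B x y
adj⇒Adjacent B {x} {y} x≢y e with adj⇒ (role B x) (role B y) e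
... | inj₁ (sx , sy) = ss (spine⇒ B sx) (spine⇒ B sy)
  where
  ss : x ≡ Block.a B ⊎ x ≡ Block.b B → y ≡ Block.a B ⊎ y ≡ Block.b B → Adjacent B x y
  ss (inj₁ p) (inj₁ q) = contradiction (trans p (sym q)) x≢y
  ss (inj₁ refl) (inj₂ refl) = inj₁ (here refl)
  ss (inj₂ refl) (inj₁ refl) = inj₂ (here refl)
  ss (inj₂ p) (inj₂ q) = contradiction (trans p (sym q)) x≢y
... | inj₂ (inj₁ (sx , ty)) = inj₁ (st (spine⇒ B sx) (tip⇒ B ty))
  where
  st : x ≡ Block.a B ⊎ x ≡ Block.b B → y ≡ Block.c B ⊎ y ≡ Block.d B → (x , y) ∈ edges B
  st (inj₁ refl) (inj₁ refl) = there (here refl)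
  st (inj₁ refl) (inj₂ refl) = there (there (here refl))
  st (inj₂ refl) (inj₁ refl) = there (there (there (here refl)))
  st (inj₂ refl) (inj₂ refl) = there (there (there (there (here refl))))
... | inj₂ (inj₂ (tx , sy)) = inj₂ (st (spine⇒ B sy) (tip⇒ B tx))
  where
  st : y ≡ Block.a B ⊎ y ≡ Block.b B → x ≡ Block.c B ⊎ x ≡ Block.d B → (y , x) ∈ edges B
  st (inj₁ refl) (inj₁ refl) = there (here refl)
  st (inj₁ refl) (inj₂ refl) = there (there (here refl))
  st (inj₂ refl) (inj₁ refl) = there (there (there (here refl)))
  st (inj₂ refl) (inj₂ refl) = there (there (there (there (here refl))))

size : Design 10 → ℕ
size D = length (blocks D)

blockAt : ∀ (D : Design 10) → Fin (size D) → Block 10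
blockAt D = List.lookup (blocks D)

roles : (D : Design 10) → Fin (size D) → Fin 10 → Role
roles D i = role (blockAt D i)

opaque
  system : (D : Design 10) → IsSystem (roles D)
  system D = record
    { two-spines = λ i → role-spines (blockAt D i)
    ; two-tips   = λ i → role-tips (blockAt D i)
    ; cover      = λ {x} {y} x≢y → let i , e , unique = partition D x y x≢y in
        trans (#-cong (λ j → ≡true-ext
          (λ t → trans (cong (_== i) (sym (unique (adj⇒Adjacent (blockAt D j) x≢y t)))) (==-refl i))
          (λ t → trans (cong (λ k → adj (roles D k x) (roles D k y)) (==⇒≡ {x = j} t))
            (proj₂ (Adjacent⇒adj (blockAt D i) e)))))
          (#-== i)
    }

-- `total` runs over ordered pairs of vertices, whereas s and t count blocks. The two agree because
-- a pair is the spine of at most one block and each block has two such ordered pairs.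
module TotalByBlocks (t₁ : Ternary (Fin 10)) (t₁-sym : ∀ x y z → triangle t₁ x y z ≡ triangle t₁ y x z) (D : Design 10) where
  open IsSystem (system D)

  hitᶜ hitᵈ : Fin (size D) → Bool
  hitᶜ i = triangle t₁ a b c where open Block (blockAt D i)
  hitᵈ i = triangle t₁ a b d where open Block (blockAt D i)

  onSpine : Fin (size D) → Fin 10 → Fin 10 → Bool
  onSpine i x y = isSpine (roles D i x) ∧ (not (x == y) ∧ isSpine (roles D i y))

  onSpine-adj : ∀ i {x y} → onSpine i x y ≡ true → x ≢ y × isSpine (roles D i x) ≡ true × isSpine (roles D i y) ≡ true
  onSpine-adj i {x} {y} e = (λ { refl → true≢false (proj₁ e₂) (cong not (==-refl x)) }) , proj₁ e₁ , proj₂ e₂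
    where
    e₁ = ∧-true {isSpine (roles D i x)} e
    e₂ = ∧-true {not (x == y)} (proj₂ e₁)

  onSpine-unique : ∀ {i j x y} → onSpine i x y ≡ true → onSpine j x y ≡ true → i ≡ j
  onSpine-unique {i} {j} {x} {y} p q = let x≢y , sx , sy = onSpine-adj i {x} {y} p ; _ , sx′ , sy′ = onSpine-adj j {x} {y} q in
    #≡1-unique (λ i → adj (roles D i x) (roles D i y)) (cover x≢y) (adj-ss {roles D i x} sx sy)
      (adj-ss {roles D j x} sx′ sy′)

  common-onSpine : ∀ {i x y} → onSpine i x y ≡ true → weight (common t₁ (tipOf (roles D)) x y) ≡ weight₂
    (hitᶜ i) (hitᵈ i)
  common-onSpine {i} {x} {y} e =
    trans (cong weight (trans (#-cong pointwise) (#-pair-∧ (c≢d (blockAt D i)) (triangle t₁ x y))))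
    (trans (weight-+′ (triangle t₁ x y c) (triangle t₁ x y d)) (cong₂ weight₂ (same c) (same d)))
    where
    open Block (blockAt D i)
    x≢y : x ≢ y
    x≢y = proj₁ (onSpine-adj i {x} {y} e)
    sx : isSpine (roles D i x) ≡ true
    sx = proj₁ (proj₂ (onSpine-adj i {x} {y} e))
    sy : isSpine (roles D i y) ≡ true
    sy = proj₂ (proj₂ (onSpine-adj i {x} {y} e))
    weight-+′ : ∀ p q → weight ([ p ]ᵇ + [ q ]ᵇ) ≡ weight₂ p q
    weight-+′ p q = trans (cong (λ k → weight ([ p ]ᵇ + k)) (sym (+-identityʳ _))) (weight-+ p q)
    tip-here : ∀ z → tipOf (roles D) x y z ≡ isTip (roles D i z)
    tip-here z = ≡true-ext
      (λ t → let _ , j , sx′ , sy′ , tz = tipOf⇒ {r = roles D} {x} {y} {z} t in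
        trans (cong (λ k → isTip (roles D k z))
          (onSpine-unique {i} {j} {x} {y} e (cong₂ _∧_ sx′ (cong₂ _∧_ (cong not (≢⇒== x≢y)) sy′)))) tz)
      (tipOf⇐ {r = roles D} {x} {y} {z} x≢y i sx sy)
    pointwise : ∀ z → tipOf (roles D) x y z ∧ triangle t₁ x y z ≡ ((z == c) ∨ (z == d)) ∧ triangle t₁ x y z
    pointwise z = cong (_∧ triangle t₁ x y z) (trans (tip-here z) (isTip-role (blockAt D i) z))
    same : ∀ z → triangle t₁ x y z ≡ triangle t₁ a b z
    same z = cases (spine⇒ (blockAt D i) sx) (spine⇒ (blockAt D i) sy)
      where
      cases : x ≡ a ⊎ x ≡ b → y ≡ a ⊎ y ≡ b → triangle t₁ x y z ≡ triangle t₁ a b z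
      cases (inj₁ p) (inj₁ q) = contradiction (trans p (sym q)) x≢y
      cases (inj₁ p) (inj₂ q) = cong₂ (λ x y → triangle t₁ x y z) p q
      cases (inj₂ p) (inj₁ q) = trans (cong₂ (λ x y → triangle t₁ x y z) p q) (t₁-sym b a z)
      cases (inj₂ p) (inj₂ q) = contradiction (trans p (sym q)) x≢y

  w : Fin (size D) → ℕ
  w i = weight₂ (hitᶜ i) (hitᵈ i)

  -- At most one summand is nonzero, as one block covers the edge x, y. If x, y is no spine, no
  -- vertex is a tip over it and both sides are 0.
  common-sum : ∀ x y → weight (common t₁ (tipOf (roles D)) x y) ≡ sum (λ i → [ onSpine i x y ]ᵇ * w i)
  common-sum x y = cases (any? (λ i → onSpine i x y ≟ᴮ true))
    where
    cases : Dec (∃ λ i → onSpine i x y ≡ true) →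
            weight (common t₁ (tipOf (roles D)) x y) ≡ sum (λ i → [ onSpine i x y ]ᵇ * w i)
    cases (yes (i , e)) = trans (common-onSpine {i} {x} {y} e) (sym (trans
      (sum-point i (λ i → [ onSpine i x y ]ᵇ * w i)
        λ j j≢i → cong (λ b → [ b ]ᵇ * w j) (¬-not λ f → j≢i (onSpine-unique {j} {i} {x} {y} f e)))
      (trans (cong (λ b → [ b ]ᵇ * w i) e) (*-identityˡ (w i)))))
    cases (no ¬e) = trans
      (cong weight (sum-≗0 {f = λ z → [ tipOf (roles D) x y z ∧ triangle t₁ x y z ]ᵇ}
        λ z → cong (λ b → [ b ∧ triangle t₁ x y z ]ᵇ) (¬-not λ f →
          let x≢y , i , sx , sy , _ = tipOf⇒ {r = roles D} {x} {y} {z} f in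
          ¬e (i , cong₂ _∧_ sx (cong₂ _∧_ (cong not (≢⇒== x≢y)) sy)))))
      (sym (sum-≗0 {f = λ i → [ onSpine i x y ]ᵇ * w i} (λ i → cong (λ b → [ b ]ᵇ * w i) (¬-not λ f → ¬e (i , f)))))

  spine-pairs : ∀ i → sum (λ x → # (λ y → onSpine i x y)) ≡ 2
  spine-pairs i = trans (sum-cong-≗ (#-others (isSpine ∘ roles D i) (two-spines i))) (two-spines i)

  total-blocks : total t₁ (tipOf (roles D)) ≡ 2 * sum w
  total-blocks = begin
    sum (λ x → sum (λ y → weight (common t₁ (tipOf (roles D)) x y)))
      ≡⟨ sum²-cong {f = λ x y → weight (common t₁ (tipOf (roles D)) x y)} {λ x y → sum (f x y)} common-sum ⟩
    sum (λ x → sum (λ y → sum (λ i → f x y i)))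
      ≡⟨ sum-cong-≗ (λ x → ∑-comm (f x)) ⟩
    sum (λ x → sum (λ i → sum (λ y → f x y i)))
      ≡⟨ ∑-comm (λ x i → sum (λ y → f x y i)) ⟩
    sum (λ i → sum (λ x → sum (λ y → f x y i)))
      ≡⟨ sum-cong-≗ (λ i → trans (sum-cong-≗ (λ x → sym (*-distribʳ-sum (w i) (λ y → [ onSpine i x y ]ᵇ))))
           (sym (*-distribʳ-sum (w i) (λ x → # (λ y → onSpine i x y))))) ⟩
    sum (λ i → sum (λ x → # (λ y → onSpine i x y)) * w i)
      ≡⟨ sum-cong-≗ (λ i → cong (_* w i) (spine-pairs i)) ⟩
    sum (λ i → 2 * w i)
      ≡⟨ *-distribˡ-sum 2 w ⟨
    2 * sum w ∎
    where
    open ≡-Reasoning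
    f : Fin 10 → Fin 10 → Fin (size D) → ℕ
    f x y i = [ onSpine i x y ]ᵇ * w i

-- Cardinalities

module Cardinality {c ℓ} (S : Setoid c ℓ) where
  open Setoid S renaming (_≈_ to _≋_; refl to ≋-refl; sym to ≋-sym; trans to ≋-trans)
  open SetoidMembership S using () renaming (_∈_ to _∈ˢ_)

  lookup-injective : ∀ {xs} → SetoidUnique.Unique S xs → ∀ i j → List.lookup xs i ≋ List.lookup xs j → i ≡ j
  lookup-injective (x∉ ∷ u) zero    zero    e = refl
  lookup-injective (x∉ ∷ u) zero    (suc j) e = contradiction e (All.lookup x∉ (∈-lookup j))
  lookup-injective (x∉ ∷ u) (suc i) zero    e = contradiction (≋-sym e) (All.lookup x∉ (∈-lookup i))
  lookup-injective (x∉ ∷ u) (suc i) (suc j) e = cong suc (lookup-injective u i j e)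

  -- Send each position in `xs` to the position of an equal element of `ys`: a coincidence would
  -- make two elements of `xs` equal.
  unique-⊆⇒≤ : ∀ {xs ys} → SetoidUnique.Unique S xs → (∀ x → x ∈ˢ xs → x ∈ˢ ys) → length xs ≤ length ys
  unique-⊆⇒≤ {xs} {ys} u sub = injective⇒≤ {f = λ i → Any.index (position i)} λ {i} {j} e → lookup-injective u i j
    (≋-trans (Anyₚ.lookup-index (position i))
      (≋-trans (≋-reflexive (cong (List.lookup ys) e)) (≋-sym (Anyₚ.lookup-index (position j)))))
    where
    position : ∀ i → List.lookup xs i ∈ˢ ys
    position i = sub _ (SetoidMembershipₚ.∈-lookup S xs i)
    ≋-reflexive : ∀ {x y} → x ≡ y → x ≋ y
    ≋-reflexive refl = ≋-refl

  cardinality-unique : ∀ {p} {P : Pred Carrier p} {m n} → HasCardinality S P m → HasCardinality S P n → m ≡ n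
  cardinality-unique (xs , uxs , ∈xs , refl) (ys , uys , ∈ys , refl) = ≤-antisym
    (unique-⊆⇒≤ uxs (λ x → Equivalence.to (∈ys x) ∘ Equivalence.from (∈xs x)))
    (unique-⊆⇒≤ uys (λ x → Equivalence.to (∈xs x) ∘ Equivalence.from (∈ys x)))

  -- Serves both intersections: common blocks are indexed by the blocks of the second design, common
  -- triangles by a block with a choice of its tip, and a Boolean test selects the indices that
  -- count.
  cardinality-image : ∀ {i p} {I : Set i} {P : Pred Carrier p} (is : List I) → Unique is → (∀ i → i ∈ is) →
    (Q : I → Bool) (f : I → Carrier) → (∀ {i j} → f i ≋ f j → i ≡ j) →
    (∀ x → P x ⇔ ∃ λ i → Q i ≡ true × x ≋ f i) →
    HasCardinality S P (length (filter (λ i → Q i ≟ᴮ true) is))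
  cardinality-image is u all Q f inj P⇔ = List.map f js
    , SetoidUniqueₚ.map⁺ (setoid _) S inj (Uniqueₚ.filter⁺ (λ i → Q i ≟ᴮ true) u)
    , (λ x → mk⇔
        (λ px → let i , qi , e = Equivalence.to (P⇔ x) px in
                Anyₚ.map⁺ (lose (∈-filter⁺ (λ i → Q i ≟ᴮ true) (all i) qi) e))
        (λ x∈ → let i , i∈ , e = find (Anyₚ.map⁻ x∈) in
                Equivalence.from (P⇔ x) (i , proj₂ (∈-filter⁻ (λ i → Q i ≟ᴮ true) {xs = is} i∈) , e)))
    , length-map f js
    where
    js = filter (λ i → Q i ≟ᴮ true) is

length-filter-tabulate : ∀ {a} {A : Set a} {n} (Q : A → Bool) (f : Fin n → A) →
  length (filter (λ i → Q i ≟ᴮ true) (List.tabulate f)) ≡ # (Q ∘ f)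
length-filter-tabulate {n = zero}  Q f = refl
length-filter-tabulate {n = suc n} Q f with Q (f zero)
... | true  = cong suc (length-filter-tabulate Q (f ∘ suc))
... | false = length-filter-tabulate Q (f ∘ suc)

length-filter-×Bool : ∀ {a} {A : Set a} {n} (Q : A × Bool → Bool) (f : Fin n → A) →
  length (filter (λ i → Q i ≟ᴮ true) (cartesianProduct (List.tabulate f) (false ∷ true ∷ []))) ≡
  sum (λ i → [ Q (f i , false) ]ᵇ + [ Q (f i , true) ]ᵇ)
length-filter-×Bool {n = zero}  Q f = refl
length-filter-×Bool {n = suc n} Q f with Q (f zero , false)
... | true with Q (f zero , true)
...   | true  = cong (2 +_) (length-filter-×Bool Q (f ∘ suc))
...   | false = cong suc (length-filter-×Bool Q (f ∘ suc))
length-filter-×Bool {n = suc n} Q f | false with Q (f zero , true)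
...   | true  = cong suc (length-filter-×Bool Q (f ∘ suc))
...   | false = length-filter-×Bool Q (f ∘ suc)

-- The triangles of a design

tipOf-sym : ∀ {n} (r : Fin n → Fin 10 → Role) x y z → tipOf r x y z ≡ tipOf r y x z
tipOf-sym r x y z = ≡true-ext (flip x y) (flip y x)
  where
  flip : ∀ x y → tipOf r x y z ≡ true → tipOf r y x z ≡ true
  flip x y e = let x≢y , i , sx , sy , tz = tipOf⇒ {r = r} {x} {y} {z} e in
               tipOf⇐ {r = r} {y} {x} {z} (x≢y ∘ sym) i sy sx tz

record Mutual (ρ : Fin 10 → Role) (x y z : Fin 10) : Set where
  constructor mutually
  field
    x≢y : x ≢ y
    x≢z : x ≢ z
    y≢z : y ≢ z
    xy  : adj (ρ x) (ρ y) ≡ true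
    xz  : adj (ρ x) (ρ z) ≡ true
    yz  : adj (ρ y) (ρ z) ≡ true

rotateMutual : ∀ {ρ x y z} → Mutual ρ x y z → Mutual ρ y z x
rotateMutual {ρ} {x} {y} {z} (mutually x≢y x≢z y≢z xy xz yz) =
  mutually y≢z (x≢y ∘ sym) (x≢z ∘ sym) yz (trans (adj-comm (ρ y) (ρ x)) xy) (trans (adj-comm (ρ z) (ρ x)) xz)

spine≢tip : ∀ (ρ : Fin 10 → Role) {x z} → isSpine (ρ x) ≡ true → isTip (ρ z) ≡ true → x ≢ z
spine≢tip ρ {x} s t refl with ρ x
spine≢tip ρ s () refl | spine
spine≢tip ρ () t refl | tip

tip⇒Mutual : ∀ (ρ : Fin 10 → Role) {x y z} → x ≢ y → isSpine (ρ x) ≡ true → isSpine (ρ y) ≡ true → isTip (ρ z)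
  ≡ true → Mutual ρ x y z
tip⇒Mutual ρ {x} {y} {z} x≢y sx sy tz = mutually x≢y (spine≢tip ρ sx tz) (spine≢tip ρ sy tz)
  (adj-ss {ρ x} sx sy) (adj-st {ρ x} sx tz) (adj-st {ρ y} sy tz)

module Triangles (D : Design 10) where
  open IsSystem (system D)

  t : Ternary (Fin 10)
  t = tipOf (roles D)

  t-sym : ∀ x y z → triangle t x y z ≡ triangle t y x z
  t-sym = triangle-sym t (tipOf-sym (roles D))

  triangle⇒ : ∀ {x y z} → triangle t x y z ≡ true → ∃ λ j → Mutual (roles D j) x y z
  triangle⇒ {x} {y} {z} e with ∨-true {t x y z} e
  ... | inj₁ e = let x≢y , j , sx , sy , tz = tipOf⇒ {r = roles D} {x} {y} {z} e in j , tip⇒Mutual (roles D j) x≢y sx sy tz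
  ... | inj₂ e with ∨-true {t y z x} e
  ...   | inj₁ e = let y≢z , j , sy , sz , tx = tipOf⇒ {r = roles D} {y} {z} {x} e in
                   j , rotateMutual (rotateMutual (tip⇒Mutual (roles D j) y≢z sy sz tx))
  ...   | inj₂ e = let z≢x , j , sz , sx , ty = tipOf⇒ {r = roles D} {z} {x} {y} e in
                   j , rotateMutual (tip⇒Mutual (roles D j) z≢x sz sx ty)

  no-three-spines : ∀ j {x y z} → x ≢ y → x ≢ z → y ≢ z →
    isSpine (roles D j x) ≡ true → isSpine (roles D j y) ≡ true → isSpine (roles D j z) ≡ true → ⊥
  no-three-spines j x≢y x≢z y≢z sx sy sz with #≡2⇒∈ (isSpine ∘ roles D j) (two-spines j) x≢y sx sy sz
  ... | inj₁ e = x≢z (sym e)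
  ... | inj₂ e = y≢z (sym e)

  data Shape (a b c : Role) : Set where
    tip₁ : isTip a ≡ true → isSpine b ≡ true → isSpine c ≡ true → Shape a b c
    tip₂ : isSpine a ≡ true → isTip b ≡ true → isSpine c ≡ true → Shape a b c
    tip₃ : isSpine a ≡ true → isSpine b ≡ true → isTip c ≡ true → Shape a b c

  -- Two tips are not adjacent and a block has no third spine, so a triangle has exactly one tip.
  shape : ∀ j {x y z} → Mutual (roles D j) x y z → Shape (roles D j x) (roles D j y) (roles D j z)
  shape j {x} {y} {z} (mutually x≢y x≢z y≢z xy xz yz) =
    go (roles D j x) (roles D j y) (roles D j z) xy xz yz (no-three-spines j x≢y x≢z y≢z)
    where
    go : ∀ a b c → adj a b ≡ true → adj a c ≡ true → adj b c ≡ true →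
         (isSpine a ≡ true → isSpine b ≡ true → isSpine c ≡ true → ⊥) → Shape a b c
    go spine spine spine _ _ _ f = ⊥-elim (f refl refl refl)
    go spine spine tip   _ _ _ f = tip₃ refl refl refl
    go spine tip   spine _ _ _ f = tip₂ refl refl refl
    go tip   spine spine _ _ _ f = tip₁ refl refl refl

  triangle⇐ : ∀ j {x y z} → Mutual (roles D j) x y z → triangle t x y z ≡ true
  triangle⇐ j {x} {y} {z} M@(mutually x≢y x≢z y≢z _ _ _) with shape j M
  ... | tip₃ sx sy tz = cong (_∨ (t y z x ∨ t z x y)) (tipOf⇐ {r = roles D} {x} {y} {z} x≢y j sx sy tz)
  ... | tip₁ tx sy sz = ∨-trueʳ (t x y z) (cong (_∨ t z x y) (tipOf⇐ {r = roles D} {y} {z} {x} y≢z j sy sz tx))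
  ... | tip₂ sx ty sz = ∨-trueʳ (t x y z) (∨-trueʳ (t y z x)
    (tipOf⇐ {r = roles D} {z} {x} {y} (x≢z ∘ sym) j sz sx ty))

  same-index : ∀ {i j x y} → x ≢ y → adj (roles D i x) (roles D i y) ≡ true → adj (roles D j x) (roles D j y)
    ≡ true → i ≡ j
  same-index {x = x} {y} x≢y = #≡1-unique (λ i → adj (roles D i x) (roles D i y)) (cover x≢y)

-- Triangles as sets of three vertices

trio : (x y z : Fin 10) → Subset 10
trio x y z = ⁅ x ⁆ ∪ (⁅ y ⁆ ∪ ⁅ z ⁆)

∈-trio⁻ : ∀ {w} x y z → w ∈ₛ trio x y z → w ≡ x ⊎ w ≡ y ⊎ w ≡ z
∈-trio⁻ x y z w∈ with x∈p∪q⁻ ⁅ x ⁆ _ w∈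
... | inj₁ p = inj₁ (x∈⁅y⁆⇒x≡y x p)
... | inj₂ p with x∈p∪q⁻ ⁅ y ⁆ _ p
...   | inj₁ p = inj₂ (inj₁ (x∈⁅y⁆⇒x≡y y p))
...   | inj₂ p = inj₂ (inj₂ (x∈⁅y⁆⇒x≡y z p))

∈-trio₁ : ∀ x y z → x ∈ₛ trio x y z
∈-trio₁ x y z = x∈p∪q⁺ {p = ⁅ x ⁆} (inj₁ (x∈⁅x⁆ x))

∈-trio₂ : ∀ x y z → y ∈ₛ trio x y z
∈-trio₂ x y z = x∈p∪q⁺ {p = ⁅ x ⁆} (inj₂ (x∈p∪q⁺ {p = ⁅ y ⁆} (inj₁ (x∈⁅x⁆ y))))

∈-trio₃ : ∀ x y z → z ∈ₛ trio x y z
∈-trio₃ x y z = x∈p∪q⁺ {p = ⁅ x ⁆} (inj₂ (x∈p∪q⁺ {p = ⁅ y ⁆} (inj₂ (x∈⁅x⁆ z))))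

opaque
  ∣trio∣ : ∀ x y z → x ≢ y → x ≢ z → y ≢ z → ∣ trio x y z ∣ ≡ 3
  ∣trio∣ = toWitness {a? = all? λ x → all? λ y → all? λ z →
    ¬? (x ≟ y) →-dec (¬? (x ≟ z) →-dec (¬? (y ≟ z) →-dec (∣ trio x y z ∣ ℕ.≟ 3)))} _

⊆∧∣∣≡⇒≡ : ∀ {n} {p q : Subset n} → p ⊆ q → ∣ p ∣ ≡ ∣ q ∣ → p ≡ q
⊆∧∣∣≡⇒≡ {p = []} {[]} _ _ = refl
⊆∧∣∣≡⇒≡ {p = inside ∷ p}  {inside ∷ q}  p⊆q e = cong (inside ∷_) (⊆∧∣∣≡⇒≡ (drop-∷-⊆ p⊆q) (ℕ.suc-injective e))
⊆∧∣∣≡⇒≡ {p = outside ∷ p} {outside ∷ q} p⊆q e = cong (outside ∷_) (⊆∧∣∣≡⇒≡ (drop-∷-⊆ p⊆q) e)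
⊆∧∣∣≡⇒≡ {p = outside ∷ p} {inside ∷ q}  p⊆q e =
  contradiction (≤-trans (≤-reflexive (sym e)) (p⊆q⇒∣p∣≤∣q∣ (drop-∷-⊆ p⊆q))) 1+n≰n
⊆∧∣∣≡⇒≡ {p = inside ∷ p}  {outside ∷ q} p⊆q e with () ← p⊆q vhere

Mutual⇒IsTriangleOf : ∀ B {x y z} → Mutual (role B) x y z → IsTriangleOf B (trio x y z)
Mutual⇒IsTriangleOf B {x} {y} {z} (mutually x≢y x≢z y≢z xy xz yz) =
  ∣trio∣ x y z x≢y x≢z y≢z , λ u v u∈ v∈ u≢v → adj⇒Adjacent B u≢v (cases (∈-trio⁻ x y z u∈) (∈-trio⁻ x y z v∈) u≢v)
  where
  flip : ∀ {u v} → adj (role B u) (role B v) ≡ true → adj (role B v) (role B u) ≡ true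
  flip {u} {v} e = trans (adj-comm (role B v) (role B u)) e
  cases : ∀ {u v} → u ≡ x ⊎ u ≡ y ⊎ u ≡ z → v ≡ x ⊎ v ≡ y ⊎ v ≡ z → u ≢ v → adj (role B u) (role B v) ≡ true
  cases (inj₁ refl)        (inj₁ refl)        u≢v = contradiction refl u≢v
  cases (inj₁ refl)        (inj₂ (inj₁ refl)) u≢v = xy
  cases (inj₁ refl)        (inj₂ (inj₂ refl)) u≢v = xz
  cases (inj₂ (inj₁ refl)) (inj₁ refl)        u≢v = flip {x} {y} xy
  cases (inj₂ (inj₁ refl)) (inj₂ (inj₁ refl)) u≢v = contradiction refl u≢v
  cases (inj₂ (inj₁ refl)) (inj₂ (inj₂ refl)) u≢v = yz
  cases (inj₂ (inj₂ refl)) (inj₁ refl)        u≢v = flip {x} {z} xz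
  cases (inj₂ (inj₂ refl)) (inj₂ (inj₁ refl)) u≢v = flip {y} {z} yz
  cases (inj₂ (inj₂ refl)) (inj₂ (inj₂ refl)) u≢v = contradiction refl u≢v

IsTriangleOf⇒Mutual : ∀ B {x y z} → x ≢ y → x ≢ z → y ≢ z → IsTriangleOf B (trio x y z) → Mutual (role B) x y z
IsTriangleOf⇒Mutual B {x} {y} {z} x≢y x≢z y≢z (_ , f) = mutually x≢y x≢z y≢z
  (proj₂ (Adjacent⇒adj B (f x y (∈-trio₁ x y z) (∈-trio₂ x y z) x≢y)))
  (proj₂ (Adjacent⇒adj B (f x z (∈-trio₁ x y z) (∈-trio₃ x y z) x≢z)))
  (proj₂ (Adjacent⇒adj B (f y z (∈-trio₂ x y z) (∈-trio₃ x y z) y≢z)))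

module _ (B : Block 10) where
  open Block B

  -- A vertex outside the block has no neighbour in it, but `x` has one in `S`: otherwise `S` would
  -- lie in the singleton of `x`, although it has three elements.
  in-block : ∀ {S} → IsTriangleOf B S → ∀ {x} → x ∈ₛ S → (x ≡ a ⊎ x ≡ b) ⊎ (x ≡ c ⊎ x ≡ d)
  in-block {S} (three , f) {x} x∈ with any? (λ y → (y ∈ₛ? S) ×-dec ¬? (x ≟ y))
  ... | yes (y , y∈ , x≢y) with adj⇒ (role B x) (role B y) (proj₂ (Adjacent⇒adj B (f x y x∈ y∈ x≢y)))
  ...   | inj₁ (sx , _)        = inj₁ (spine⇒ B sx)
  ...   | inj₂ (inj₁ (sx , _)) = inj₁ (spine⇒ B sx)
  ...   | inj₂ (inj₂ (tx , _)) = inj₂ (tip⇒ B tx)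
  in-block {S} (three , f) {x} x∈ | no ¬y = contradiction
    (≤-trans (≤-reflexive (sym three)) (≤-trans (p⊆q⇒∣p∣≤∣q∣ S⊆) (≤-reflexive (∣⁅x⁆∣≡1 x)))) λ { (s≤s ()) }
    where
    S⊆ : S ⊆ ⁅ x ⁆
    S⊆ {y} y∈ with x ≟ y
    ... | yes refl = x∈⁅x⁆ x
    ... | no  x≢y  = contradiction (y , y∈ , x≢y) ¬y

  tips-nonadjacent : adj (role B c) (role B d) ≡ true → ⊥
  tips-nonadjacent e with role B c | role B d | tip-c B | tip-d B
  tips-nonadjacent () | tip | tip | refl | refl

  -- `c` and `d` are not adjacent, so `S` misses one of them and lies in the corresponding `trio`;
  -- equal sizes make the inclusion an equality.
  IsTriangleOf-trio : ∀ {S} → IsTriangleOf B S → S ≡ trio a b c ⊎ S ≡ trio a b d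
  IsTriangleOf-trio {S} tri@(three , f) with d ∈ₛ? S
  ... | no d∉ = inj₁ (⊆∧∣∣≡⇒≡ S⊆ (trans three (sym (∣trio∣ a b c (a≢b B) (a≢c B) (b≢c B)))))
    where
    S⊆ : S ⊆ trio a b c
    S⊆ x∈ with in-block tri x∈
    ... | inj₁ (inj₁ refl) = ∈-trio₁ a b c
    ... | inj₁ (inj₂ refl) = ∈-trio₂ a b c
    ... | inj₂ (inj₁ refl) = ∈-trio₃ a b c
    ... | inj₂ (inj₂ refl) = contradiction x∈ d∉
  ... | yes d∈ = inj₂ (⊆∧∣∣≡⇒≡ S⊆ (trans three (sym (∣trio∣ a b d (a≢b B) (a≢d B) (b≢d B)))))
    where
    S⊆ : S ⊆ trio a b d
    S⊆ x∈ with in-block tri x∈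
    ... | inj₁ (inj₁ refl) = ∈-trio₁ a b d
    ... | inj₁ (inj₂ refl) = ∈-trio₂ a b d
    ... | inj₂ (inj₂ refl) = ∈-trio₃ a b d
    ... | inj₂ (inj₁ refl) = ⊥-elim (tips-nonadjacent (proj₂ (Adjacent⇒adj B (f c d x∈ d∈ (c≢d B)))))

  Mutual-c : Mutual (role B) a b c
  Mutual-c = tip⇒Mutual (role B) (a≢b B) (spine-a B) (spine-b B) (tip-c B)

  Mutual-d : Mutual (role B) a b d
  Mutual-d = tip⇒Mutual (role B) (a≢b B) (spine-a B) (spine-b B) (tip-d B)

≈⇒adj : ∀ B B′ → B ≈ B′ → ∀ {x y} → x ≢ y → adj (role B x) (role B y) ≡ true → adj (role B′ x) (role B′ y) ≡ true
≈⇒adj B B′ e {x} {y} x≢y xy = proj₂ (Adjacent⇒adj B′ (Equivalence.to (e x y) (adj⇒Adjacent B x≢y xy)))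

roles⇒≈ : ∀ B B′ → (∀ x → role B x ≡ role B′ x) → B ≈ B′
roles⇒≈ B B′ e x y = mk⇔ (go B B′ e) (go B′ B (sym ∘ e))
  where
  go : ∀ B B′ → (∀ x → role B x ≡ role B′ x) → Adjacent B x y → Adjacent B′ x y
  go B B′ e h = let x≢y , t = Adjacent⇒adj B h in adj⇒Adjacent B′ x≢y (trans (sym (cong₂ adj (e x) (e y))) t)

-- Common blocks and common triangles of two designs

module Intersection (D₁ D₂ : Design 10) where
  open Triangles D₁
  open TotalByBlocks t t-sym D₂
  module D₂ = Triangles D₂

  both one : Fin (size D₂) → Bool
  both i = hitᶜ i ∧ hitᵈ i
  one  i = hitᶜ i xor hitᵈ i

  commonBlocks oneTriangle : ℕ
  commonBlocks = # both
  oneTriangle  = # one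

  -- Both triangles contain the edge a, b, so they lie in one block of the first design. If a or b
  -- were a tip there, the other one would be a spine together with c and d, three in all. Hence c
  -- and d are the tips, and all roles agree.
  both⇒≈ : ∀ i → both i ≡ true → ∃ λ j → blockAt D₁ j ≈ blockAt D₂ i
  both⇒≈ i e = j , roles⇒≈ (blockAt D₁ j) B same-roles
    where
    B : Block 10
    B = blockAt D₂ i
    open Block B
    Mc : ∃ λ j → Mutual (roles D₁ j) a b c
    Mc = triangle⇒ {a} {b} {c} (proj₁ (∧-true {hitᶜ i} e))
    Md : ∃ λ j → Mutual (roles D₁ j) a b d
    Md = triangle⇒ {a} {b} {d} (proj₂ (∧-true {hitᶜ i} e))
    j : Fin (size D₁)
    j = proj₁ Mc
    M : Mutual (roles D₁ j) a b c
    M = proj₂ Mc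
    M′ : Mutual (roles D₁ j) a b d
    M′ = subst (λ k → Mutual (roles D₁ k) a b d)
      (same-index (a≢b B) (Mutual.xy (proj₂ Md)) (Mutual.xy M)) (proj₂ Md)
    record Spines : Set where
      constructor spines
      field
        a-spine : isSpine (roles D₁ j a) ≡ true
        b-spine : isSpine (roles D₁ j b) ≡ true
        c-tip   : isTip (roles D₁ j c) ≡ true
        d-tip   : isTip (roles D₁ j d) ≡ true
    ⊥-both : ∀ {r} → isSpine r ≡ true → isTip r ≡ true → ⊥
    ⊥-both {spine} _ ()
    ⊥-both {tip}  () _
    found : Spines
    found with shape j M | shape j M′
    ... | tip₃ sa sb tc | tip₃ _ _ td = spines sa sb tc td
    ... | tip₁ ta sb sc | tip₁ _ _ sd = ⊥-elim (no-three-spines j (b≢c B) (b≢d B) (c≢d B) sb sc sd)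
    ... | tip₂ sa tb sc | tip₂ _ _ sd = ⊥-elim (no-three-spines j (a≢c B) (a≢d B) (c≢d B) sa sc sd)
    ... | tip₁ ta sb sc | tip₂ sa _ _ = ⊥-elim (⊥-both sa ta)
    ... | tip₁ ta sb sc | tip₃ sa _ _ = ⊥-elim (⊥-both sa ta)
    ... | tip₂ sa tb sc | tip₁ _ sb _ = ⊥-elim (⊥-both sb tb)
    ... | tip₂ sa tb sc | tip₃ _ sb _ = ⊥-elim (⊥-both sb tb)
    ... | tip₃ sa sb tc | tip₁ ta _ _ = ⊥-elim (⊥-both sa ta)
    ... | tip₃ sa sb tc | tip₂ _ tb _ = ⊥-elim (⊥-both sb tb)
    open Spines found
    same-spine : ∀ x → isSpine (roles D₁ j x) ≡ isSpine (role B x)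
    same-spine x = ≡true-ext
      (λ s → [ (λ { refl → spine-a B }) , (λ { refl → spine-b B }) ]′
        (#≡2⇒∈ (isSpine ∘ roles D₁ j) (IsSystem.two-spines (system D₁) j) (a≢b B) a-spine b-spine s))
      (λ s → [ (λ { refl → a-spine }) , (λ { refl → b-spine }) ]′ (spine⇒ B s))
    same-tip : ∀ x → isTip (roles D₁ j x) ≡ isTip (role B x)
    same-tip x = ≡true-ext
      (λ s → [ (λ { refl → tip-c B }) , (λ { refl → tip-d B }) ]′
        (#≡2⇒∈ (isTip ∘ roles D₁ j) (IsSystem.two-tips (system D₁) j) (c≢d B) c-tip d-tip s))
      (λ s → [ (λ { refl → c-tip }) , (λ { refl → d-tip }) ]′ (tip⇒ B s))
    role-ext : ∀ r r′ → isSpine r ≡ isSpine r′ → isTip r ≡ isTip r′ → r ≡ r′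
    role-ext spine spine _ _ = refl
    role-ext tip   tip   _ _ = refl
    role-ext none  none  _ _ = refl
    role-ext spine tip  () _
    role-ext spine none () _
    role-ext tip  spine () _
    role-ext tip  none  _ ()
    role-ext none spine () _
    role-ext none tip   _ ()
    same-roles : ∀ x → roles D₁ j x ≡ role B x
    same-roles x = role-ext (roles D₁ j x) (role B x) (same-spine x) (same-tip x)

  ≈⇒both : ∀ i j → blockAt D₁ j ≈ blockAt D₂ i → both i ≡ true
  ≈⇒both i j e = cong₂ _∧_ (hit (Mutual-c B)) (hit (Mutual-d B))
    where
    B : Block 10
    B = blockAt D₂ i
    back : ∀ {x y} → x ≢ y → adj (role B x) (role B y) ≡ true → adj (roles D₁ j x) (roles D₁ j y) ≡ true
    back = ≈⇒adj B (blockAt D₁ j) (Setoid.sym (blockSetoid 10) {blockAt D₁ j} {B} e)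
    hit : ∀ {x y z} → Mutual (role B) x y z → triangle t x y z ≡ true
    hit (mutually x≢y x≢z y≢z xy xz yz) = triangle⇐ j (mutually x≢y x≢z y≢z (back x≢y xy) (back x≢z xz) (back y≢z yz))

  intersectInBlocks : IntersectInBlocks D₁ D₂ commonBlocks
  intersectInBlocks = subst (HasCardinality (blockSetoid 10) _) (length-filter-tabulate both id)
    (Cardinality.cardinality-image (blockSetoid 10) (allFin (size D₂)) (Uniqueₚ.allFin⁺ (size D₂)) ∈-allFin both
      (blockAt D₂)
      (λ {i} {j} e → D₂.same-index (a≢b (blockAt D₂ i)) (Mutual.xy (Mutual-c (blockAt D₂ i)))
        (≈⇒adj (blockAt D₂ i) (blockAt D₂ j) e (a≢b (blockAt D₂ i)) (Mutual.xy (Mutual-c (blockAt D₂ i)))))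
      λ B → mk⇔
        (λ (B∈₁ , B∈₂) → Any.index B∈₂ , ≈⇒both (Any.index B∈₂) (Any.index B∈₁)
            (Setoid.trans (blockSetoid 10) {blockAt D₁ (Any.index B∈₁)} {B} {blockAt D₂ (Any.index B∈₂)}
              (Setoid.sym (blockSetoid 10) {B} {blockAt D₁ (Any.index B∈₁)} (Anyₚ.lookup-index B∈₁))
                (Anyₚ.lookup-index B∈₂))
          , Anyₚ.lookup-index B∈₂)
        (λ (i , q , e) → let j , e′ = both⇒≈ i q in
          lose (∈-lookup j) (Setoid.trans (blockSetoid 10) {B} {blockAt D₂ i} {blockAt D₁ j} e
            (Setoid.sym (blockSetoid 10) {blockAt D₁ j} {blockAt D₂ i} e′))
          , lose (∈-lookup i) e))

  hit : Fin (size D₂) × Bool → Bool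
  hit (i , false) = hitᶜ i
  hit (i , true)  = hitᵈ i

  apex : Fin (size D₂) × Bool → Fin 10
  apex (i , false) = Block.c (blockAt D₂ i)
  apex (i , true)  = Block.d (blockAt D₂ i)

  triangleAt : Fin (size D₂) × Bool → Subset 10
  triangleAt e@(i , _) = trio (Block.a (blockAt D₂ i)) (Block.b (blockAt D₂ i)) (apex e)

  triangleAt-Mutual : ∀ e → Mutual (roles D₂ (proj₁ e)) (Block.a (blockAt D₂ (proj₁ e)))
    (Block.b (blockAt D₂ (proj₁ e))) (apex e)
  triangleAt-Mutual (i , false) = Mutual-c (blockAt D₂ i)
  triangleAt-Mutual (i , true)  = Mutual-d (blockAt D₂ i)

  -- Equal triangles share a spine edge, which only one block covers; within a block the two
  -- triangles differ in the apex.
  triangleAt-injective : ∀ {e e′} → triangleAt e ≡ triangleAt e′ → e ≡ e′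
  triangleAt-injective {e@(i , _)} {e′@(j , _)} p = pair i≡j
    where
    a b : Fin 10
    a = Block.a (blockAt D₂ i)
    b = Block.b (blockAt D₂ i)
    ∈′ : ∀ {x} → x ∈ₛ triangleAt e → x ∈ₛ triangleAt e′
    ∈′ = subst (_ ∈ₛ_) p
    i≡j : i ≡ j
    i≡j = D₂.same-index (a≢b (blockAt D₂ i)) (Mutual.xy (triangleAt-Mutual e))
      (proj₂ (Adjacent⇒adj (blockAt D₂ j) (proj₂ (Mutual⇒IsTriangleOf (blockAt D₂ j) (triangleAt-Mutual e′)) a b
        (∈′ (∈-trio₁ a b (apex e))) (∈′ (∈-trio₂ a b (apex e))) (a≢b (blockAt D₂ i)))))
    pair : i ≡ j → e ≡ e′
    pair refl = cong (i ,_) (sides _ _ (apex∈ (∈-trio⁻ a b (apex e′) (∈′ (∈-trio₃ a b (apex e))))))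
      where
      apex∈ : apex e ≡ a ⊎ apex e ≡ b ⊎ apex e ≡ apex e′ → apex e ≡ apex e′
      apex∈ (inj₁ q)        = contradiction (sym q) (Mutual.x≢z (triangleAt-Mutual e))
      apex∈ (inj₂ (inj₁ q)) = contradiction (sym q) (Mutual.y≢z (triangleAt-Mutual e))
      apex∈ (inj₂ (inj₂ q)) = q
      sides : ∀ s s′ → apex (i , s) ≡ apex (i , s′) → s ≡ s′
      sides false false _ = refl
      sides true  true  _ = refl
      sides false true  q = contradiction q (c≢d (blockAt D₂ i))
      sides true  false q = contradiction (sym q) (c≢d (blockAt D₂ i))

  hit⇒T : ∀ e → hit e ≡ true → T D₁ (triangleAt e)
  hit⇒T e h = let j , M = triangle⇒ (go e h) in lose (∈-lookup j) (Mutual⇒IsTriangleOf (blockAt D₁ j) M)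
    where
    go : ∀ e → hit e ≡ true → triangle t (Block.a (blockAt D₂ (proj₁ e))) (Block.b (blockAt D₂ (proj₁ e)))
      (apex e) ≡ true
    go (i , false) h = h
    go (i , true)  h = h

  T⇒hit : ∀ e → T D₁ (triangleAt e) → hit e ≡ true
  T⇒hit e τ = go e (triangle⇐ (Any.index τ) (IsTriangleOf⇒Mutual (blockAt D₁ (Any.index τ))
    (Mutual.x≢y (triangleAt-Mutual e)) (Mutual.x≢z (triangleAt-Mutual e)) (Mutual.y≢z (triangleAt-Mutual e))
      (Anyₚ.lookup-index τ)))
    where
    go : ∀ e → triangle t (Block.a (blockAt D₂ (proj₁ e))) (Block.b (blockAt D₂ (proj₁ e))) (apex e) ≡ true →
      hit e ≡ true
    go (i , false) h = h
    go (i , true)  h = h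

  T⇒triangleAt : ∀ {S} → T D₂ S → ∃ λ e → S ≡ triangleAt e
  T⇒triangleAt τ with IsTriangleOf-trio (blockAt D₂ (Any.index τ)) (Anyₚ.lookup-index τ)
  ... | inj₁ p = (Any.index τ , false) , p
  ... | inj₂ p = (Any.index τ , true)  , p

  hits : ∀ i → [ hit (i , false) ]ᵇ + [ hit (i , true) ]ᵇ ≡ [ one i ]ᵇ + 2 * [ both i ]ᵇ
  hits i with hitᶜ i | hitᵈ i
  ... | true  | true  = refl
  ... | true  | false = refl
  ... | false | true  = refl
  ... | false | false = refl

  triangle-count : sum (λ i → [ hit (i , false) ]ᵇ + [ hit (i , true) ]ᵇ) ≡ oneTriangle + 2 * commonBlocks
  triangle-count = trans (sum-cong-≗ hits) (trans (∑-distrib-+ (λ i → [ one i ]ᵇ) (λ i → 2 * [ both i ]ᵇ))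
    (cong (oneTriangle +_) (sym (*-distribˡ-sum 2 (λ i → [ both i ]ᵇ)))))

  intersectInTriangles : IntersectInTriangles D₁ D₂ (oneTriangle + 2 * commonBlocks)
  intersectInTriangles = subst (HasCardinality (setoid (Subset 10)) _)
    (trans (length-filter-×Bool hit id) triangle-count)
    (Cardinality.cardinality-image (setoid (Subset 10)) (cartesianProduct (allFin (size D₂)) (false ∷ true ∷ []))
      (Uniqueₚ.cartesianProduct⁺ (Uniqueₚ.allFin⁺ (size D₂)) (((λ ()) ∷ []) ∷ [] ∷ []))
      (λ { (i , false) → ∈-cartesianProduct⁺ (∈-allFin i) (here refl)
         ; (i , true)  → ∈-cartesianProduct⁺ (∈-allFin i) (there (here refl)) })
      hit triangleAt triangleAt-injective
      λ S → mk⇔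
        (λ (τ₁ , τ₂) → let e , p = T⇒triangleAt τ₂ in e , T⇒hit e (subst (T D₁) p τ₁) , p)
        (λ { (e , h , refl) → hit⇒T e h , lose (∈-lookup (proj₁ e)) (Mutual⇒IsTriangleOf (blockAt D₂ (proj₁ e)) (triangleAt-Mutual e)) }))

  -- Here the number that the enumeration restricts is identified as twice the `code` of the two
  -- counts.
  total-code : total t (tipOf (roles D₂)) ≡ 2 * (16 * commonBlocks + oneTriangle)
  total-code = trans total-blocks (cong (2 *_) (trans (sum-cong-≗ weights)
    (trans (∑-distrib-+ (λ i → 16 * [ both i ]ᵇ) (λ i → [ one i ]ᵇ))
      (cong (_+ oneTriangle) (sym (*-distribˡ-sum 16 (λ i → [ both i ]ᵇ)))))))
    where
    weights : ∀ i → w i ≡ 16 * [ both i ]ᵇ + [ one i ]ᵇ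
    weights i with hitᶜ i | hitᵈ i
    ... | true  | true  = refl
    ... | true  | false = refl
    ... | false | true  = refl
    ... | false | false = refl

  -- No block satisfies `both` and `one` at once, and there are nine blocks. This also keeps
  -- `oneTriangle` below 16, so that the code can be read back.
  count≤ : commonBlocks + oneTriangle ≤ 9
  count≤ = ≤-trans (≤-reflexive (sym (∑-distrib-+ (λ i → [ both i ]ᵇ) (λ i → [ one i ]ᵇ))))
    (≤-trans (sum≤ (size D₂) (λ i → [ both i ]ᵇ + [ one i ]ᵇ) at-most-one)
      (≤-reflexive (Degrees.block-count (system D₂))))
    where
    sum≤ : ∀ n (f : Fin n → ℕ) → (∀ i → f i ≤ 1) → sum f ≤ n
    sum≤ zero    f h = ≤-refl
    sum≤ (suc n) f h = +-mono-≤ (h zero) (sum≤ n (f ∘ suc) (h ∘ suc))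
    at-most-one : ∀ i → [ both i ]ᵇ + [ one i ]ᵇ ≤ 1
    at-most-one i with hitᶜ i | hitᵈ i
    ... | true  | true  = s≤s z≤n
    ... | true  | false = s≤s z≤n
    ... | false | true  = s≤s z≤n
    ... | false | false = z≤n

-- Realising the attained pairs

⟦_,_,_-_⟧ : (a b c d : Fin 10) {distinct : True (unique? _≟_ (a ∷ b ∷ c ∷ d ∷ []))} → Block 10
⟦ a , b , c - d ⟧ {distinct} = block a b c d (toWitness distinct)

ten : Fin 4 → Fin 14
ten = 10 ↑ʳ_

-- Found by a random greedy search: every pair in attained arises from two of these.
family : Vec (List (Block 10)) 14
family
  = ( ⟦ 0F , 1F , 4F - 5F ⟧ ∷ ⟦ 0F , 2F , 6F - 7F ⟧ ∷ ⟦ 0F , 3F , 8F - 9F ⟧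
    ∷ ⟦ 1F , 2F , 8F - 9F ⟧ ∷ ⟦ 1F , 3F , 6F - 7F ⟧ ∷ ⟦ 2F , 3F , 4F - 5F ⟧
    ∷ ⟦ 4F , 9F , 6F - 7F ⟧ ∷ ⟦ 5F , 8F , 4F - 9F ⟧ ∷ ⟦ 6F , 7F , 5F - 8F ⟧ ∷ [])
  ∷ ( ⟦ 0F , 1F , 4F - 5F ⟧ ∷ ⟦ 0F , 2F , 6F - 7F ⟧ ∷ ⟦ 0F , 3F , 8F - 9F ⟧
    ∷ ⟦ 1F , 2F , 8F - 9F ⟧ ∷ ⟦ 1F , 3F , 6F - 7F ⟧ ∷ ⟦ 2F , 3F , 4F - 5F ⟧
    ∷ ⟦ 4F , 7F , 6F - 9F ⟧ ∷ ⟦ 5F , 8F , 4F - 7F ⟧ ∷ ⟦ 6F , 9F , 5F - 8F ⟧ ∷ [])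
  ∷ ( ⟦ 0F , 1F , 8F - 9F ⟧ ∷ ⟦ 0F , 2F , 6F - 7F ⟧ ∷ ⟦ 0F , 3F , 4F - 5F ⟧
    ∷ ⟦ 1F , 2F , 4F - 5F ⟧ ∷ ⟦ 1F , 3F , 6F - 7F ⟧ ∷ ⟦ 2F , 3F , 8F - 9F ⟧
    ∷ ⟦ 4F , 8F , 6F - 7F ⟧ ∷ ⟦ 5F , 9F , 4F - 8F ⟧ ∷ ⟦ 6F , 7F , 5F - 9F ⟧ ∷ [])
  ∷ ( ⟦ 0F , 6F , 3F - 8F ⟧ ∷ ⟦ 1F , 2F , 6F - 9F ⟧ ∷ ⟦ 1F , 5F , 0F - 8F ⟧
    ∷ ⟦ 1F , 7F , 3F - 4F ⟧ ∷ ⟦ 2F , 5F , 3F - 4F ⟧ ∷ ⟦ 2F , 7F , 0F - 8F ⟧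
    ∷ ⟦ 3F , 8F , 4F - 9F ⟧ ∷ ⟦ 4F , 9F , 0F - 6F ⟧ ∷ ⟦ 5F , 7F , 6F - 9F ⟧ ∷ [])
  ∷ ( ⟦ 0F , 1F , 6F - 7F ⟧ ∷ ⟦ 0F , 3F , 2F - 5F ⟧ ∷ ⟦ 0F , 4F , 8F - 9F ⟧
    ∷ ⟦ 1F , 3F , 8F - 9F ⟧ ∷ ⟦ 1F , 4F , 2F - 5F ⟧ ∷ ⟦ 2F , 9F , 6F - 7F ⟧
    ∷ ⟦ 3F , 4F , 6F - 7F ⟧ ∷ ⟦ 5F , 8F , 2F - 9F ⟧ ∷ ⟦ 6F , 7F , 5F - 8F ⟧ ∷ [])
  ∷ ( ⟦ 0F , 1F , 4F - 5F ⟧ ∷ ⟦ 0F , 2F , 6F - 7F ⟧ ∷ ⟦ 0F , 3F , 8F - 9F ⟧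
    ∷ ⟦ 1F , 2F , 8F - 9F ⟧ ∷ ⟦ 1F , 3F , 6F - 7F ⟧ ∷ ⟦ 2F , 3F , 4F - 5F ⟧
    ∷ ⟦ 4F , 7F , 5F - 8F ⟧ ∷ ⟦ 5F , 8F , 6F - 9F ⟧ ∷ ⟦ 6F , 9F , 4F - 7F ⟧ ∷ [])
  ∷ ( ⟦ 0F , 2F , 6F - 7F ⟧ ∷ ⟦ 1F , 3F , 5F - 8F ⟧ ∷ ⟦ 1F , 4F , 0F - 6F ⟧
    ∷ ⟦ 1F , 9F , 2F - 7F ⟧ ∷ ⟦ 3F , 4F , 2F - 7F ⟧ ∷ ⟦ 3F , 9F , 0F - 6F ⟧
    ∷ ⟦ 4F , 9F , 5F - 8F ⟧ ∷ ⟦ 5F , 8F , 0F - 2F ⟧ ∷ ⟦ 6F , 7F , 5F - 8F ⟧ ∷ [])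
  ∷ ( ⟦ 0F , 2F , 6F - 7F ⟧ ∷ ⟦ 1F , 3F , 6F - 7F ⟧ ∷ ⟦ 1F , 4F , 2F - 8F ⟧
    ∷ ⟦ 1F , 9F , 0F - 5F ⟧ ∷ ⟦ 3F , 4F , 0F - 5F ⟧ ∷ ⟦ 3F , 9F , 2F - 8F ⟧
    ∷ ⟦ 4F , 9F , 6F - 7F ⟧ ∷ ⟦ 5F , 8F , 0F - 2F ⟧ ∷ ⟦ 6F , 7F , 5F - 8F ⟧ ∷ [])
  ∷ ( ⟦ 0F , 2F , 6F - 7F ⟧ ∷ ⟦ 1F , 3F , 0F - 8F ⟧ ∷ ⟦ 1F , 4F , 2F - 5F ⟧
    ∷ ⟦ 1F , 9F , 6F - 7F ⟧ ∷ ⟦ 3F , 4F , 6F - 7F ⟧ ∷ ⟦ 3F , 9F , 2F - 5F ⟧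
    ∷ ⟦ 4F , 9F , 0F - 8F ⟧ ∷ ⟦ 5F , 8F , 0F - 2F ⟧ ∷ ⟦ 6F , 7F , 5F - 8F ⟧ ∷ [])
  ∷ ( ⟦ 0F , 2F , 6F - 7F ⟧ ∷ ⟦ 1F , 3F , 5F - 6F ⟧ ∷ ⟦ 1F , 4F , 0F - 8F ⟧
    ∷ ⟦ 1F , 9F , 2F - 7F ⟧ ∷ ⟦ 3F , 4F , 2F - 7F ⟧ ∷ ⟦ 3F , 9F , 0F - 8F ⟧
    ∷ ⟦ 4F , 9F , 5F - 6F ⟧ ∷ ⟦ 5F , 8F , 0F - 2F ⟧ ∷ ⟦ 6F , 7F , 5F - 8F ⟧ ∷ [])
  ∷ ( ⟦ 0F , 1F , 4F - 8F ⟧ ∷ ⟦ 0F , 2F , 5F - 7F ⟧ ∷ ⟦ 0F , 3F , 6F - 9F ⟧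
    ∷ ⟦ 1F , 2F , 6F - 9F ⟧ ∷ ⟦ 1F , 3F , 5F - 7F ⟧ ∷ ⟦ 2F , 3F , 4F - 8F ⟧
    ∷ ⟦ 4F , 9F , 6F - 7F ⟧ ∷ ⟦ 5F , 8F , 4F - 9F ⟧ ∷ ⟦ 6F , 7F , 5F - 8F ⟧ ∷ [])
  ∷ ( ⟦ 0F , 6F , 2F - 8F ⟧ ∷ ⟦ 1F , 3F , 5F - 6F ⟧ ∷ ⟦ 1F , 4F , 0F - 8F ⟧
    ∷ ⟦ 1F , 9F , 2F - 7F ⟧ ∷ ⟦ 2F , 8F , 5F - 7F ⟧ ∷ ⟦ 3F , 4F , 2F - 7F ⟧
    ∷ ⟦ 3F , 9F , 0F - 8F ⟧ ∷ ⟦ 4F , 9F , 5F - 6F ⟧ ∷ ⟦ 5F , 7F , 0F - 6F ⟧ ∷ [])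
  ∷ ( ⟦ 0F , 2F , 6F - 7F ⟧ ∷ ⟦ 1F , 3F , 6F - 7F ⟧ ∷ ⟦ 1F , 4F , 0F - 5F ⟧
    ∷ ⟦ 1F , 9F , 2F - 8F ⟧ ∷ ⟦ 3F , 4F , 2F - 8F ⟧ ∷ ⟦ 3F , 9F , 0F - 5F ⟧
    ∷ ⟦ 4F , 9F , 6F - 7F ⟧ ∷ ⟦ 5F , 8F , 0F - 2F ⟧ ∷ ⟦ 6F , 7F , 5F - 8F ⟧ ∷ [])
  ∷ ( ⟦ 0F , 2F , 6F - 7F ⟧ ∷ ⟦ 1F , 3F , 6F - 7F ⟧ ∷ ⟦ 1F , 4F , 0F - 2F ⟧
    ∷ ⟦ 1F , 9F , 5F - 8F ⟧ ∷ ⟦ 3F , 4F , 5F - 8F ⟧ ∷ ⟦ 3F , 9F , 0F - 2F ⟧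
    ∷ ⟦ 4F , 9F , 6F - 7F ⟧ ∷ ⟦ 5F , 8F , 0F - 2F ⟧ ∷ ⟦ 6F , 7F , 5F - 8F ⟧ ∷ [])
  ∷ []

adjacent? : ∀ (B : Block 10) x y → Dec (Adjacent B x y)
adjacent? B x y = ((x , y) ∈ᵉ? edges B) ⊎-dec ((y , x) ∈ᵉ? edges B)
  where open DecMembership (≡-dec (_≟_ {10}) (_≟_ {10})) using () renaming (_∈?_ to _∈ᵉ?_)

opaque
  family-partition : ∀ k x y → x ≢ y → ∃ λ (i : Fin (length (lookup family k))) → Adjacent
    (List.lookup (lookup family k) i) x y ×
                     (∀ j → Adjacent (List.lookup (lookup family k) j) x y → i ≡ j)
  family-partition = toWitness {a? = all? λ k → all? λ x → all? λ y → ¬? (x ≟ y) →-dec any? λ i →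
    adjacent? (List.lookup (lookup family k) i) x y ×-dec
    all? λ j → adjacent? (List.lookup (lookup family k) j) x y →-dec (i ≟ j)} _

design : Fin 14 → Design 10
design k = record
  { blocks    = lookup family k
  ; partition = λ x y x≢y → let i , e , unique = family-partition k x y x≢y in i , e , λ {j} → unique j
  }

intersection : Design 10 → Design 10 → ℕ × ℕ
intersection D₁ D₂ = commonBlocks , oneTriangle
  where open Intersection D₁ D₂

Realised : ℕ × ℕ → Set
Realised p = ∃₂ λ i j → intersection (design i) (design j) ≡ p

opaque
  unfolding tipOf role

  -- Indices into `family`, in the order of `attained`. Each `refl` evaluates both counts, for which
  -- `tipOf` and `role` have to unfold.
  realised : All Realised attained
  realised
    = (1F , 4F , refl) ∷ (4F , 5F , refl) ∷ (3F , 4F , refl) ∷ (2F , 3F , refl)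
    ∷ (2F , 4F , refl) ∷ (1F , 3F , refl) ∷ (1F , (ten 1F) , refl) ∷ (0F , 3F , refl)
    ∷ (0F , (ten 1F) , refl) ∷ ((ten 1F) , (ten 2F) , refl) ∷ (1F , 8F , refl) ∷ (0F , 4F , refl)
    ∷ (2F , 6F , refl) ∷ (2F , 8F , refl) ∷ (1F , 6F , refl) ∷ (1F , 9F , refl)
    ∷ (5F , 9F , refl) ∷ (9F , (ten 0F) , refl) ∷ (0F , 8F , refl) ∷ (1F , 7F , refl)
    ∷ (0F , 2F , refl) ∷ (1F , (ten 3F) , refl) ∷ (0F , 6F , refl) ∷ (1F , (ten 2F) , refl)
    ∷ (0F , 9F , refl) ∷ (6F , (ten 1F) , refl) ∷ (6F , 7F , refl) ∷ (6F , (ten 3F) , refl)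
    ∷ (4F , 8F , refl) ∷ (6F , 8F , refl) ∷ (0F , (ten 0F) , refl) ∷ (0F , 7F , refl)
    ∷ (0F , (ten 3F) , refl) ∷ (0F , (ten 2F) , refl) ∷ (7F , (ten 2F) , refl) ∷ (6F , 9F , refl)
    ∷ (1F , 5F , refl) ∷ (0F , 1F , refl) ∷ (9F , (ten 1F) , refl) ∷ (0F , 0F , refl) ∷ []

-- From the attained pairs to the admissible ones

excluded : List (ℕ × ℕ)
excluded = (1 , 8) ∷ (3 , 1) ∷ (3 , 5) ∷ (4 , 1) ∷ (4 , 3) ∷ (5 , 1) ∷ (5 , 2) ∷ []
opaque
  code-attained : ∀ {s} → s < 10 → ∀ {t} → t < 10 → code (s , t) ∈ List.map code attained → (s , t) ∈ attained
  code-attained = toWitness {a? = ℕ.allUpTo? (λ s → ℕ.allUpTo? (λ t →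
    (code (s , t) ∈ℕ? List.map code attained) →-dec ((s , t) ∈ᵖ? attained)) 10) 10} _

  attained-admissible : All (λ (s , t) → s + t ≤ 9 × ¬ (s , t) ∈ excluded) attained
  attained-admissible = toWitness {a? = All.all? (λ (s , t) → (s + t ℕ.≤? 9) ×-dec ¬? ((s , t) ∈ᵖ? excluded)) attained} _

  -- Membership in `J 10` and `J-T 10` is weakened here to membership in the projections of
  -- `attained`, which turns the harder inclusion into a check of 100 pairs.
  admissible-attained : ∀ {s} → s < 10 → ∀ {t} → t < 10 → s + t ≤ 9 → s ∈ List.map proj₁ attained →
    t + 2 * s ∈ List.map (λ (s , t) → t + 2 * s) attained → ¬ (s , t) ∈ excluded → (s , t) ∈ attained
  admissible-attained = toWitness {a? = ℕ.allUpTo? (λ s → ℕ.allUpTo? (λ t →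
    (s + t ℕ.≤? 9) →-dec ((s ∈ℕ? List.map proj₁ attained) →-dec
    ((t + 2 * s ∈ℕ? List.map (λ (s , t) → t + 2 * s) attained) →-dec
    (¬? ((s , t) ∈ᵖ? excluded) →-dec ((s , t) ∈ᵖ? attained))))) 10) 10} _

intersection-attained : ∀ D₁ D₂ → intersection D₁ D₂ ∈ attained
intersection-attained D₁ D₂ = code-attained
  (s≤s (ℕ.≤-trans (ℕ.m≤m+n commonBlocks oneTriangle) count≤))
    (s≤s (ℕ.≤-trans (ℕ.m≤n+m oneTriangle commonBlocks) count≤))
  (subst (_∈ List.map code attained)
    (ℕ.*-cancelˡ-≡ (proj₁ total-attained) (16 * commonBlocks + oneTriangle) 2
      (trans (sym (proj₂ (proj₂ total-attained))) total-code))
    (proj₁ (proj₂ total-attained)))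
  where
  open Intersection D₁ D₂
  total-attained : ∃ λ k → k ∈ List.map code attained × total (tipOf (roles D₁)) (tipOf (roles D₂)) ≡ 2 * k
  total-attained = attained-total (system D₁) (system D₂)

block-intersection : ∀ D₁ D₂ {s} → IntersectInBlocks D₁ D₂ s → s ≡ proj₁ (intersection D₁ D₂)
block-intersection D₁ D₂ h = Cardinality.cardinality-unique (blockSetoid 10) h (Intersection.intersectInBlocks D₁ D₂)

triangle-intersection : ∀ D₁ D₂ {τ} → IntersectInTriangles D₁ D₂ τ →
                        τ ≡ proj₂ (intersection D₁ D₂) + 2 * proj₁ (intersection D₁ D₂)
triangle-intersection D₁ D₂ h = Cardinality.cardinality-unique (setoid _) h (Intersection.intersectInTriangles D₁ D₂)

fine⇒attained : ∀ {s t} → Fine 10 (s , t) → (s , t) ∈ attained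
fine⇒attained {s} {t} (D₁ , D₂ , sb , tb) = subst (_∈ attained) (sym (cong₂ _,_ s≡ t≡)) (intersection-attained D₁ D₂)
  where
  s≡ : s ≡ proj₁ (intersection D₁ D₂)
  s≡ = block-intersection D₁ D₂ sb
  t≡ : t ≡ proj₂ (intersection D₁ D₂)
  t≡ = ℕ.+-cancelʳ-≡ (2 * proj₁ (intersection D₁ D₂)) t _
    (trans (cong (λ k → t + 2 * k) (sym s≡)) (triangle-intersection D₁ D₂ tb))

fine-intersection : ∀ D₁ D₂ → Fine 10 (intersection D₁ D₂)
fine-intersection D₁ D₂ = D₁ , D₂ , Intersection.intersectInBlocks D₁ D₂ , Intersection.intersectInTriangles D₁ D₂

attained⇒fine : ∀ {p} → p ∈ attained → Fine 10 p
attained⇒fine p∈ = let i , j , e = All.lookup realised p∈ in subst (Fine 10) e (fine-intersection (design i) (design j))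

-- Two designs that meet in s blocks also have some number of common triangles, so s is the first
-- component of an attained pair.
J⇒attained : ∀ {s} → J 10 s → s ∈ List.map proj₁ attained
J⇒attained (D₁ , D₂ , h) = subst (_∈ List.map proj₁ attained) (sym (block-intersection D₁ D₂ h))
  (∈-map⁺ proj₁ (intersection-attained D₁ D₂))

J-T⇒attained : ∀ {τ} → J-T 10 τ → τ ∈ List.map (λ (s , t) → t + 2 * s) attained
J-T⇒attained (D₁ , D₂ , h) =
  subst (_∈ List.map (λ (s , t) → t + 2 * s) attained) (sym (triangle-intersection D₁ D₂ h))
  (∈-map⁺ (λ (s , t) → t + 2 * s) (intersection-attained D₁ D₂))

theorem4p4 : Fine 10 ≐ (Adm 10 ∖ (_∈ ((1 , 8) ∷ (3 , 1) ∷ (3 , 5) ∷ (4 , 1) ∷ (4 , 3) ∷ (5 , 1) ∷ (5 , 2) ∷ [])))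
theorem4p4 = to , from
  where
  to : ∀ {p} → Fine 10 p → Adm 10 p × ¬ p ∈ excluded
  to {s , t} fine@(D₁ , D₂ , sb , tb) =
    let s+t≤9 , ∉excluded = All.lookup attained-admissible (fine⇒attained fine) in
    -- `b[ 10 ]` evaluates to 9.
    (s+t≤9 , (D₁ , D₂ , sb) , (D₁ , D₂ , tb)) , ∉excluded
  from : ∀ {p} → Adm 10 p × ¬ p ∈ excluded → Fine 10 p
  from {s , t} ((s+t≤9 , js , jt) , ∉excluded) = attained⇒fine (admissible-attained
    (s≤s (ℕ.≤-trans (ℕ.m≤m+n s t) s+t≤9)) (s≤s (ℕ.≤-trans (ℕ.m≤n+m t s) s+t≤9))
    s+t≤9 (J⇒attained js) (J-T⇒attained jt) ∉excluded)
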